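{- For every $n\ge2$, the caracol graph $\mathrm{Car}_{n+1}$ satisfies $$\operatorname{vol}\mathcal{F}_{\mathrm{Car}_{n+1}}(1,1,0,\ldots,0)=C_{n-2}\cdot n\cdot 2^{n-3},$$ where $(1,1,0,\ldots,0)\in\mathbb{Z}^n$ and $C_k=\frac{1}{k+1}\binom{2k}{k}$.
   Context: The caracol graph $\mathrm{Car}_{n+1}$ is the directed graph on $\{1,\ldots,n+1\}$ with edges $(1,j)$ for $2\le j\le n$, $(i,i+1)$ for $2\le i\le n$, and $(i,n+1)$ for $2\le i\le n-1$ (so $m=3n-4$ edges). For a connected directed graph $G$ on $[n+1]$ with $m$ edges, each directed from smaller to larger vertex, and $\mathbf{a}\in\mathbb{Z}^n$, the flow polytope $\mathcal{F}_G(\mathbf{a})\subset\mathbb{R}^m$ is the set of tuples $(b_e)_{e\in E(G)}$ of nonnegative reals such that for each $j=1,\ldots,n$, (sum of $b_e$ over edges leaving $j$) minus (sum of $b_e$ over edges entering $j$) equals $a_j$. It lies in an affine subspace of dimension $m-n$, and $\operatorname{vol}$ is normalized volume: $(m-n)!$ times the $(m-n)$-dimensional volume, normalized so that a fundamental cell of the lattice of integer points of the linear subspace parallel to this affine subspace has volume $1$. -}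

module Defs where

open import Level using (0ℓ)
open import Algebra.Bundles using (CommutativeMonoid; RawGroup)
import Algebra.Properties.CommutativeSemigroup as CommutativeSemigroupProperties
open import Algebra.Definitions.RawMonoid using () renaming (sum to sumᴹ)
open import Data.Bool.Base using (if_then_else_)
open import Data.Fin.Base using (Fin; toℕ)
open import Data.Integer.Base as ℤ using (ℤ; +_; -[1+_]; 0ℤ; 1ℤ)
open import Data.List.Base using (List; map; foldr; upTo; length; lookup; _++_)
open import Data.List.Relation.Unary.All using (All)
open import Data.List.Relation.Unary.Any using (Any)
open import Data.List.Relation.Unary.AllPairs using (AllPairs)
open import Data.Nat.Base as ℕ using (ℕ; zero; suc; _∸_; _≡ᵇ_; _!)
open import Data.Nat.Combinatorics using (_C_)
import Data.Nat.Properties as ℕₚ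
open import Data.Product.Base using (Σ; ∃; _×_; _,_; proj₁; proj₂)
open import Data.Rational.Base as ℚ
  using (ℚ; 0ℚ; 1ℚ; ½; _/_; ∣_∣; Positive)
import Data.Rational.Properties as ℚₚ
open import Data.Sum.Base using (_⊎_)
import Data.Vec.Functional as Vector
open import Relation.Binary.PropositionalEquality
  using (_≡_; refl; sym; trans; cong; cong₂; subst)
open import Relation.Unary using (Pred; _∈_; _⊆_)

-- Real numbers as Cauchy sequences of rationals, with pointwise operations.

record ℝ : Set where
  constructor mkℝ
  field
    seq    : ℕ → ℚ
    cauchy : ∀ ε → 0ℚ ℚ.< ε → ∃ λ N → ∀ m n → N ℕ.≤ m → N ℕ.≤ n →
             ∣ seq m ℚ.- seq n ∣ ℚ.< ε

open ℝ public

infix  4 _≤ᴿ_ _≈ᴿ_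
infixl 6 _+ᴿ_
infixl 7 _·ᴿ_

_≤ᴿ_ : ℝ → ℝ → Set
x ≤ᴿ y = ∀ ε → 0ℚ ℚ.< ε → ∃ λ N → ∀ n → N ℕ.≤ n → seq x n ℚ.≤ seq y n ℚ.+ ε

_≈ᴿ_ : ℝ → ℝ → Set
x ≈ᴿ y = x ≤ᴿ y × y ≤ᴿ x

fromℚ : ℚ → ℝ
fromℚ q = mkℝ (λ _ → q) λ ε 0<ε → 0 , λ _ _ _ _ →
  subst (λ r → ∣ r ∣ ℚ.< ε) (sym (ℚₚ.+-inverseʳ q)) 0<ε

fromℤ : ℤ → ℝ
fromℤ z = fromℚ (z / 1)

private
  open CommutativeSemigroupProperties
    (CommutativeMonoid.commutativeSemigroup ℚₚ.+-0-commutativeMonoid)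
    using (interchange)

  halves : ∀ ε → ½ ℚ.* ε ℚ.+ ½ ℚ.* ε ≡ ε
  halves ε = trans (sym (ℚₚ.*-distribʳ-+ ε ½ ½)) (ℚₚ.*-identityˡ ε)

  half-pos : ∀ {ε} → 0ℚ ℚ.< ε → 0ℚ ℚ.< ½ ℚ.* ε
  half-pos {ε} 0<ε =
    subst (ℚ._< ½ ℚ.* ε) (ℚₚ.*-zeroʳ ½) (ℚₚ.*-monoʳ-<-pos ½ 0<ε)

  +-shuffle : ∀ a b c d → (a ℚ.+ b) ℚ.- (c ℚ.+ d) ≡ (a ℚ.- c) ℚ.+ (b ℚ.- d)
  +-shuffle a b c d = trans
    (cong ((a ℚ.+ b) ℚ.+_) (ℚₚ.neg-distrib-+ c d))
    (interchange a b (ℚ.- c) (ℚ.- d))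

  *-factor : ∀ q a b → q ℚ.* a ℚ.- q ℚ.* b ≡ q ℚ.* (a ℚ.- b)
  *-factor q a b = trans
    (cong (q ℚ.* a ℚ.+_) (ℚₚ.neg-distribʳ-* q b))
    (sym (ℚₚ.*-distribˡ-+ q a (ℚ.- b)))

_+ᴿ_ : ℝ → ℝ → ℝ
x +ᴿ y = mkℝ (λ n → seq x n ℚ.+ seq y n) λ ε 0<ε →
  let N₁ , c₁ = cauchy x (½ ℚ.* ε) (half-pos 0<ε)
      N₂ , c₂ = cauchy y (½ ℚ.* ε) (half-pos 0<ε)
  in N₁ ℕ.⊔ N₂ , λ m n N≤m N≤n → begin-strict
    ∣ (seq x m ℚ.+ seq y m) ℚ.- (seq x n ℚ.+ seq y n) ∣
      ≡⟨ cong ∣_∣ (+-shuffle (seq x m) (seq y m) (seq x n) (seq y n)) ⟩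
    ∣ (seq x m ℚ.- seq x n) ℚ.+ (seq y m ℚ.- seq y n) ∣
      ≤⟨ ℚₚ.∣p+q∣≤∣p∣+∣q∣ (seq x m ℚ.- seq x n) (seq y m ℚ.- seq y n) ⟩
    ∣ seq x m ℚ.- seq x n ∣ ℚ.+ ∣ seq y m ℚ.- seq y n ∣
      <⟨ ℚₚ.+-mono-<
           (c₁ m n (ℕₚ.m⊔n≤o⇒m≤o N₁ N₂ N≤m) (ℕₚ.m⊔n≤o⇒m≤o N₁ N₂ N≤n))
           (c₂ m n (ℕₚ.m⊔n≤o⇒n≤o N₁ N₂ N≤m) (ℕₚ.m⊔n≤o⇒n≤o N₁ N₂ N≤n)) ⟩
    ½ ℚ.* ε ℚ.+ ½ ℚ.* ε
      ≡⟨ halves ε ⟩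
    ε ∎
  where open ℚₚ.≤-Reasoning

_·ᴿ_ : ℚ → ℝ → ℝ
q ·ᴿ x = mkℝ (λ n → q ℚ.* seq x n) bound
  where
  open ℚₚ.≤-Reasoning

  K : ℚ
  K = 1ℚ ℚ.+ ∣ q ∣

  ∣q∣≤K : ∣ q ∣ ℚ.≤ K
  ∣q∣≤K = subst (ℚ._≤ K) (ℚₚ.+-identityˡ ∣ q ∣)
            (ℚₚ.+-monoˡ-≤ ∣ q ∣ (ℚₚ.nonNegative⁻¹ 1ℚ))

  instance
    K-pos : Positive K
    K-pos = ℚ.positive
      (ℚₚ.+-mono-<-≤ (ℚₚ.positive⁻¹ 1ℚ) (ℚₚ.0≤∣p∣ q))

    K-nonZero : ℚ.NonZero K
    K-nonZero = ℚₚ.pos⇒nonZero K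

  bound : ∀ ε → 0ℚ ℚ.< ε → ∃ λ N → ∀ m n → N ℕ.≤ m → N ℕ.≤ n →
          ∣ q ℚ.* seq x m ℚ.- q ℚ.* seq x n ∣ ℚ.< ε
  bound ε 0<ε =
    let δ = ℚ.1/ K ℚ.* ε
        0<δ = subst (ℚ._< δ) (ℚₚ.*-zeroʳ (ℚ.1/ K))
                (ℚₚ.*-monoʳ-<-pos (ℚ.1/ K) {{ℚₚ.1/pos⇒pos K}} 0<ε)
        N , c = cauchy x δ 0<δ
    in N , λ m n N≤m N≤n → begin-strict
      ∣ q ℚ.* seq x m ℚ.- q ℚ.* seq x n ∣
        ≡⟨ cong ∣_∣ (*-factor q (seq x m) (seq x n)) ⟩
      ∣ q ℚ.* (seq x m ℚ.- seq x n) ∣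
        ≡⟨ ℚₚ.∣p*q∣≡∣p∣*∣q∣ q (seq x m ℚ.- seq x n) ⟩
      ∣ q ∣ ℚ.* ∣ seq x m ℚ.- seq x n ∣
        ≤⟨ ℚₚ.*-monoʳ-≤-nonNeg ∣ seq x m ℚ.- seq x n ∣
             {{ℚ.nonNegative (ℚₚ.0≤∣p∣ (seq x m ℚ.- seq x n))}} ∣q∣≤K ⟩
      K ℚ.* ∣ seq x m ℚ.- seq x n ∣
        <⟨ ℚₚ.*-monoʳ-<-pos K (c m n N≤m N≤n) ⟩
      K ℚ.* (ℚ.1/ K ℚ.* ε)
        ≡⟨ ℚₚ.*-assoc K (ℚ.1/ K) ε ⟨
      (K ℚ.* ℚ.1/ K) ℚ.* ε
        ≡⟨ cong (ℚ._* ε) (ℚₚ.*-inverseʳ K) ⟩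
      1ℚ ℚ.* ε
        ≡⟨ ℚₚ.*-identityˡ ε ⟩
      ε ∎

-ᴿ_ : ℝ → ℝ
-ᴿ x = (ℚ.- 1ℚ) ·ᴿ x

+-0-rawGroupᴿ : RawGroup 0ℓ 0ℓ
+-0-rawGroupᴿ = record
  { Carrier = ℝ ; _≈_ = _≈ᴿ_ ; _∙_ = _+ᴿ_ ; ε = fromℚ 0ℚ ; _⁻¹ = -ᴿ_ }

-- Jordan content in ℝᵈ.

record Box (d : ℕ) : Set where
  field
    lo hi : Fin d → ℚ
    lo≤hi : ∀ i → lo i ℚ.≤ hi i

open Box public

⟦_⟧ : ∀ {d} → Box d → Pred (Fin d → ℝ) 0ℓ
⟦ B ⟧ x = ∀ i → fromℚ (lo B i) ≤ᴿ x i × x i ≤ᴿ fromℚ (hi B i)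

boxVolume : ∀ {d} → Box d → ℚ
boxVolume B = Vector.foldr ℚ._*_ 1ℚ (λ i → hi B i ℚ.- lo B i)

totalVolume : ∀ {d} → List (Box d) → ℚ
totalVolume = foldr (λ B s → boxVolume B ℚ.+ s) 0ℚ

NonOverlapping : ∀ {d} → Box d → Box d → Set
NonOverlapping B B′ = ∃ λ i → hi B i ℚ.≤ lo B′ i ⊎ hi B′ i ℚ.≤ lo B i

⋃ : ∀ {d} → List (Box d) → Pred (Fin d → ℝ) 0ℓ
⋃ Bs x = Any (λ B → x ∈ ⟦ B ⟧) Bs

-- Inner content ≥ v and outer content ≤ v; since the inner content never
-- exceeds the outer one, this says that both equal v.
HasContent : ∀ {d} → Pred (Fin d → ℝ) 0ℓ → ℚ → Set
HasContent S v = ∀ ε → 0ℚ ℚ.< ε →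
    (∃ λ Bs → AllPairs NonOverlapping Bs × All (λ B → ⟦ B ⟧ ⊆ S) Bs
              × v ℚ.- ε ℚ.≤ totalVolume Bs)
  × (∃ λ Bs → S ⊆ ⋃ Bs × totalVolume Bs ℚ.≤ v ℚ.+ ε)

-- A directed graph on {1,…,n+1} is given by the list of its edges (tail , head);
-- the coordinates of a flow are indexed by the positions in this list.

Edges : Set
Edges = List (ℕ × ℕ)

module Netflow (A : RawGroup 0ℓ 0ℓ) where
  open RawGroup A

  netflow : (G : Edges) → (Fin (length G) → Carrier) → ℕ → Carrier
  netflow G b j =
      sumᴹ rawMonoid (λ e → if proj₁ (lookup G e) ≡ᵇ j then b e else ε)
    ∙ sumᴹ rawMonoid (λ e → if proj₂ (lookup G e) ≡ᵇ j then b e else ε) ⁻¹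

open Netflow +-0-rawGroupᴿ public using () renaming (netflow to netflowᴿ)
open Netflow ℤ.+-0-rawGroup public using () renaming (netflow to netflowᶻ)

-- `j : Fin n` stands for the vertex `suc (toℕ j)`.
HasNetflow : ∀ {n} (G : Edges) → (Fin n → ℤ) → Pred (Fin (length G) → ℝ) 0ℓ
HasNetflow G a b = ∀ j → netflowᴿ G b (suc (toℕ j)) ≈ᴿ fromℤ (a j)

FlowPolytope : ∀ {n} (G : Edges) → (Fin n → ℤ) → Pred (Fin (length G) → ℝ) 0ℓ
FlowPolytope G a b = (∀ e → fromℚ 0ℚ ≤ᴿ b e) × HasNetflow G a b

Circulation : (n : ℕ) (G : Edges) → Pred (Fin (length G) → ℤ) 0ℓ
Circulation n G z = ∀ (j : Fin n) → netflowᶻ G z (suc (toℕ j)) ≡ 0ℤ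

integerCombination : ∀ {d m} → (Fin d → Fin m → ℤ) → (Fin d → ℤ) → Fin m → ℤ
integerCombination v c e = sumᴹ ℤ.+-0-rawMonoid (λ i → c i ℤ.* v i e)

-- Lattice coordinates on the affine subspace of flows with netflow a: a point of
-- it, and a ℤ-basis of the integer points of the parallel linear subspace.
record Frame {n : ℕ} (G : Edges) (a : Fin n → ℤ) (d : ℕ) : Set where
  field
    origin      : Fin (length G) → ℝ
    origin∈     : HasNetflow G a origin
    basis       : Fin d → Fin (length G) → ℤ
    basis∈      : ∀ i → Circulation n G (basis i)
    spanning    : ∀ z → Circulation n G z →
                  ∃ λ c → ∀ e → integerCombination basis c e ≡ z e
    independent : ∀ c → (∀ e → integerCombination basis c e ≡ 0ℤ) →
                  ∀ i → c i ≡ 0ℤ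

  point : (Fin d → ℝ) → (Fin (length G) → ℝ)
  point x e = origin e +ᴿ
    sumᴹ (RawGroup.rawMonoid +-0-rawGroupᴿ) (λ i → (basis i e / 1) ·ᴿ x i)

-- The coordinates given by a frame send a fundamental cell of the lattice to the
-- unit cube.  Two frames differ by a translation and an element of GL_d(ℤ), so
-- the content does not depend on the frame.  For G connected on {1,…,n+1} with m
-- edges, the lattice of circulations has rank m - n.
HasNormalizedVolume : ∀ {n} → (G : Edges) → (Fin n → ℤ) → ℚ → Set
HasNormalizedVolume {n} G a V =
  Σ (Frame G a d) λ F → ∃ λ c →
    HasContent (λ x → Frame.point F x ∈ FlowPolytope G a) c
    × V ≡ (+ (d !) / 1) ℚ.* c
  where
  d : ℕ
  d = length G ∸ n

[_⋯_] : ℕ → ℕ → List ℕ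
[ a ⋯ b ] = map (a ℕ.+_) (upTo (suc b ∸ a))

-- Car_{n+1}, a graph on {1,…,n+1}
caracol : ℕ → Edges
caracol n = map (λ j → 1 , j) [ 2 ⋯ n ]
         ++ map (λ i → i , suc i) [ 2 ⋯ n ]
         ++ map (λ i → i , suc n) [ 2 ⋯ n ∸ 1 ]

⟨1,1,0,…,0⟩ : ∀ n → Fin n → ℤ
⟨1,1,0,…,0⟩ n j = if toℕ j ℕ.<ᵇ 2 then 1ℤ else 0ℤ

catalan : ℕ → ℚ
catalan k = + ((2 ℕ.* k) C k) / suc k

2^_ : ℤ → ℚ
2^ (+ k)    = + (2 ℕ.^ k) / 1
2^ -[1+ k ] = (1ℤ / (2 ℕ.^ suc k)) {{ℕₚ.m^n≢0 2 (suc k)}}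

{-# OPTIONS --safe #-}
module Submission where

-- With k = n - 2, the flows are parametrised by two decreasing sequences
--   1 ≥ u₁ ≥ … ≥ u_k ≥ 0,   2 ≥ v₁ ≥ … ≥ v_k ≥ 0,   u_j ≤ v_j:
-- each edge carries the difference of two consecutive entries of one sequence
-- or of v_j and u_j (potentials on the faces of the planar graph), and these
-- coordinates are unimodular.  Cut the cube into a grid of mesh 1/M.  Sweeping
-- the levels downwards, a strict chain of cells is a choice of levels together
-- with a ballot word recording whether u or v is met, where u may be met only
-- if more u's than v's remain; the h last v's lie below level 1, so the number of
-- chains is Σ_h (M choose k-h) (M choose k+h) B(k,h) with B the ballot numbers
-- B(k,h) = (k+h)! (k+1-h) / ((k+1)! h!).  Strict chains are cells inside the
-- polytope, and weak chains, which correspond to strict chains for M + 2k levels,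
-- cover it.  Both counts are M²ᵏ / (2k)! · Σ_h (2k choose k-h) B(k,h) up to lower
-- order, and the sum equals C_k (k+2) 2ᵏ⁻¹ by the binomial theorem.

open import Defs
open import Algebra.Bundles using (RawGroup)
open import Algebra.Definitions.RawMonoid using () renaming (sum to sumᴹ)
open import Data.Bool.Base using (Bool; true; false; if_then_else_)
open import Data.Fin.Base as Fin using (Fin; toℕ; _↑ˡ_; _↑ʳ_)
import Data.Fin.Properties as Finₚ
open import Data.Integer.Base as ℤ using (ℤ; +_; _-_; 0ℤ; 1ℤ)
import Data.Integer.Properties as ℤₚ
import Data.Integer.Tactic.RingSolver as ℤ-Solver
open import Data.List.Base as List using (List; map; length; _++_; applyUpTo; lookup)
import Data.List.Properties as Listₚ
open import Data.List.Relation.Unary.All as All using (All)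
import Data.List.Relation.Unary.All.Properties as Allₚ
open import Data.List.Relation.Unary.AllPairs as AllPairs using (AllPairs)
import Data.List.Relation.Unary.AllPairs.Properties as AllPairsₚ
open import Data.List.Relation.Unary.Any as Any using (Any)
import Data.List.Relation.Unary.Any.Properties as Anyₚ
open import Data.Nat.Base as ℕ using (ℕ; zero; suc; _∸_; _!; _<_; _≤_; s≤s; z≤n; _≡ᵇ_)
open import Data.Nat.Combinatorics
  using (_C_; nCk+nC[k+1]≡[n+1]C[k+1]; nCk≡n!/k![n-k]!; k![n∸k]!∣n!; k>n⇒nCk≡0)
open import Data.Nat.DivMod using (m/n*n≡m)
import Data.Nat.Properties as ℕₚ
import Data.Nat.Tactic.RingSolver as ℕ-Solver
open import Data.Product.Base using (Σ; ∃; _×_; _,_; proj₁; proj₂)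
open import Data.Rational.Base as ℚ using (ℚ; 0ℚ; 1ℚ; ½; _*_; _/_)
import Data.Rational.Properties as ℚₚ
import Data.Rational.Unnormalised.Base as ℚᵘ
import Data.Rational.Unnormalised.Properties as ℚᵘₚ
open import Data.Sum.Base using (_⊎_; inj₁; inj₂; [_,_]′)
import Data.Vec.Functional as Vector
open import Function.Base using (_∘_)
open import Level using (0ℓ)
open import Relation.Binary.PropositionalEquality
open import Relation.Nullary using (Dec; yes; no; ¬_; contradiction)
open import Relation.Nullary.Decidable.Core using (dec⇒maybe)
open import Relation.Unary using (_∈_; _⊆_)
import Tactic.RingSolver as RingSolver
open import Tactic.RingSolver.Core.AlmostCommutativeRing
  using (AlmostCommutativeRing; fromCommutativeRing)

open Netflow ℚ.+-0-rawGroup using () renaming (netflow to netflowℚ)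

-- Strict chains of cells and their number

-- The obstacle is constructive. The order of reals given by Cauchy sequences is undecidable, yet
-- the outer content demands one explicit box for every point of the polytope.
-- `approximate-dichotomy` only chooses between two overlapping half-lines, so the covering cells
-- have to overlap: their width is `h + δ`, and `δ = h * h` makes this cost a factor `1 + h` for
-- each of the 2k coordinates, which disappears in the limit. The inner cells need no such choice.
--
-- The ballot rule is the inequality u_j ≤ v_j: on the way down, v_j has to be met before u_j.
--
-- Both families of cells come from one recursion and have their length computed once; they differ
-- only in the map from levels to grid indices. Estimates are cleared of denominators and compared
-- in ℕ, which is why factorials and powers of `M` stand on both sides of most identities.

guard : {P A : Set} → Dec P → List A → List A
guard (yes _) xs = xs
guard (no _)  xs = List.[]

restrict : {P : Set} → Dec P → ℕ → ℕ
restrict (yes _) m = m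
restrict (no _)  m = 0

guard-yes : {P A : Set} (d : Dec P) {xs : List A} → P → guard d xs ≡ xs
guard-yes (yes _) p = refl
guard-yes (no ¬p) p = contradiction p ¬p

guard-no : {P A : Set} (d : Dec P) {xs : List A} → ¬ P → guard d xs ≡ List.[]
guard-no (yes p) ¬p = contradiction p ¬p
guard-no (no _)  ¬p = refl

length-guard : {P A : Set} (d : Dec P) (xs : List A) →
               length (guard d xs) ≡ restrict d (length xs)
length-guard (yes _) xs = refl
length-guard (no _)  xs = refl

restrict-* : {P : Set} (d : Dec P) (m n : ℕ) → restrict d (m ℕ.* n) ≡ restrict d m ℕ.* n
restrict-* (yes _) m n = refl
restrict-* (no _)  m n = refl

Corner : ℕ → ℕ → Set
Corner a b = (Fin a → ℕ) × (Fin b → ℕ)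

consˡ : ∀ {a b} → ℕ → Corner a b → Corner (suc a) b
consˡ x (c , d) = (x Vector.∷ c) , d

consʳ : ∀ {a b} → ℕ → Corner a b → Corner a (suc b)
consʳ x (c , d) = c , (x Vector.∷ d)

-- Each recursive step settles level `s`: it stays empty, or it receives the highest remaining u or
-- the highest remaining v. `cell n s` is the grid index recorded for level `s` when `n` values are
-- still to be placed below it. It is a parameter because strict and weak chains differ only there,
-- while the length of the list does not depend on it. Levels from `M` on are closed to u.
module Corners (cell : ℕ → ℕ → ℕ) (M : ℕ) where

  corners : ∀ a b → ℕ → List (Corner a b)
  takeˡ   : ∀ a b → ℕ → List (Corner a b)
  takeʳ   : ∀ a b → ℕ → List (Corner a b)

  corners zero    zero    zero = (Vector.[] , Vector.[]) List.∷ List.[]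
  corners zero    (suc b) zero = List.[]
  corners (suc a) b       zero = List.[]
  corners a b (suc s) = corners a b s ++ (takeˡ a b s ++ takeʳ a b s)

  takeˡ zero    b s = List.[]
  -- Here `a` counts the u's left after this one, so `b ≤ a` means that the v matched with this u
  -- has already been placed above it.
  takeˡ (suc a) b s = guard (s ℕₚ.<? M) (guard (b ℕₚ.≤? a)
                        (map (consˡ (cell (a ℕ.+ b) s)) (corners a b s)))

  takeʳ a zero    s = List.[]
  takeʳ a (suc b) s = map (consʳ (cell (a ℕ.+ b) s)) (corners a b s)

-- The recursion of `corners` with the choice of levels forgotten: only the order in which the u's
-- and v's are met remains.
ballot : ℕ → ℕ → ℕ
ballot zero    zero    = 1
ballot zero    (suc b) = ballot zero b
ballot (suc a) zero    = ballot a zero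
ballot (suc a) (suc b) = restrict (suc b ℕₚ.≤? a) (ballot a (suc b)) ℕ.+ ballot (suc a) b

pascal : ∀ n k → suc n C suc k ≡ n C k ℕ.+ n C suc k
pascal n k = sym (nCk+nC[k+1]≡[n+1]C[k+1] n k)

nC0≡1 : ∀ n → n C 0 ≡ 1
nC0≡1 zero = refl
nC0≡1 (suc n) = refl

binomial-factorials : ∀ i j → ((i ℕ.+ j) C i) ℕ.* (i ! ℕ.* j !) ≡ (i ℕ.+ j) !
binomial-factorials i j = subst (λ m → ((i ℕ.+ j) C i) ℕ.* (i ! ℕ.* m !) ≡ (i ℕ.+ j) !) (ℕₚ.m+n∸m≡n i j) (trans
  (cong (ℕ._* (i ! ℕ.* r !)) (nCk≡n!/k![n-k]! i≤n))
  (m/n*n≡m {{ℕₚ.m*n≢0 (i !) (r !) {{ℕₚ._!≢0 i}} {{ℕₚ._!≢0 r}}}} (k![n∸k]!∣n! i≤n)))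
  where
  i≤n = ℕₚ.m≤m+n i j
  r = (i ℕ.+ j) ∸ i

-- Both sides moved so that no subtraction occurs; the number itself is
-- (a + b)! (a + 1 - b) / ((a + 1)! b!).
ballot-closed : ∀ a b → b ≤ a →
  ballot a b ℕ.* ((suc a) ! ℕ.* b !) ℕ.+ (a ℕ.+ b) ! ℕ.* b ≡ (a ℕ.+ b) ! ℕ.* suc a
ballot-closed zero    zero    z≤n = refl
ballot-closed (suc a) zero    z≤n = lemma (ballot-closed a zero z≤n)
  where
  identity : ∀ f p q a → f ℕ.* (((2 ℕ.+ a) ℕ.* p) ℕ.* 1) ℕ.+ (suc a ℕ.* q) ℕ.* 0
                       ≡ (2 ℕ.+ a) ℕ.* (f ℕ.* (p ℕ.* 1) ℕ.+ q ℕ.* 0)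
  identity = ℕ-Solver.solve-∀
  identity₂ : ∀ q a → (2 ℕ.+ a) ℕ.* (q ℕ.* suc a) ≡ (suc a ℕ.* q) ℕ.* (2 ℕ.+ a)
  identity₂ = ℕ-Solver.solve-∀
  lemma : ballot a 0 ℕ.* ((suc a) ! ℕ.* 1) ℕ.+ (a ℕ.+ 0) ! ℕ.* 0 ≡ (a ℕ.+ 0) ! ℕ.* suc a → _
  lemma e = begin
    ballot a 0 ℕ.* ((suc (suc a)) ! ℕ.* 1) ℕ.+ (suc (a ℕ.+ 0)) ! ℕ.* 0
      ≡⟨ cong (λ m → ballot a 0 ℕ.* ((suc (suc a)) ! ℕ.* 1) ℕ.+ (suc m ℕ.* (a ℕ.+ 0) !) ℕ.* 0)
           (ℕₚ.+-identityʳ a) ⟩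
    ballot a 0 ℕ.* ((suc (suc a)) ! ℕ.* 1) ℕ.+ (suc a ℕ.* (a ℕ.+ 0) !) ℕ.* 0
      ≡⟨ identity (ballot a 0) ((suc a) !) ((a ℕ.+ 0) !) a ⟩
    (2 ℕ.+ a) ℕ.* (ballot a 0 ℕ.* ((suc a) ! ℕ.* 1) ℕ.+ (a ℕ.+ 0) ! ℕ.* 0)
      ≡⟨ cong ((2 ℕ.+ a) ℕ.*_) e ⟩
    (2 ℕ.+ a) ℕ.* ((a ℕ.+ 0) ! ℕ.* suc a)
      ≡⟨ identity₂ ((a ℕ.+ 0) !) a ⟩
    (suc a ℕ.* (a ℕ.+ 0) !) ℕ.* (2 ℕ.+ a)
      ≡⟨ cong (λ m → (suc m ℕ.* (a ℕ.+ 0) !) ℕ.* (2 ℕ.+ a)) (ℕₚ.+-identityʳ a) ⟨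
    (suc (a ℕ.+ 0)) ! ℕ.* (2 ℕ.+ a) ∎
    where open ≡-Reasoning
ballot-closed (suc a) (suc b) (s≤s b≤a) = ℕₚ.+-cancelʳ-≡
    ((2 ℕ.+ a) ℕ.* (q ℕ.* suc b) ℕ.+ suc b ℕ.* (q ℕ.* b)) _ _ (begin
    (f ℕ.+ g) ℕ.* (((2 ℕ.+ a) ℕ.* p) ℕ.* (suc b ℕ.* r)) ℕ.+ (suc a ℕ.+ suc b) ! ℕ.* suc b ℕ.+ _
      ≡⟨ cong (λ m → (f ℕ.+ g) ℕ.* (((2 ℕ.+ a) ℕ.* p) ℕ.* (suc b ℕ.* r)) ℕ.+ m ℕ.* suc b ℕ.+
           ((2 ℕ.+ a) ℕ.* (q ℕ.* suc b) ℕ.+ suc b ℕ.* (q ℕ.* b))) top ⟩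
    (f ℕ.+ g) ℕ.* (((2 ℕ.+ a) ℕ.* p) ℕ.* (suc b ℕ.* r)) ℕ.+ ((2 ℕ.+ a ℕ.+ b) ℕ.* q) ℕ.* suc b ℕ.+ _
      ≡⟨ collect f g a b p r q ⟩
    (2 ℕ.+ a) ℕ.* (f ℕ.* (p ℕ.* (suc b ℕ.* r)) ℕ.+ q ℕ.* suc b)
      ℕ.+ suc b ℕ.* (g ℕ.* (((2 ℕ.+ a) ℕ.* p) ℕ.* r) ℕ.+ q ℕ.* b)
      ℕ.+ q ℕ.* (suc b ℕ.* (2 ℕ.+ a ℕ.+ b))
      ≡⟨ cong₂ (λ x y → (2 ℕ.+ a) ℕ.* x ℕ.+ suc b ℕ.* y ℕ.+ q ℕ.* (suc b ℕ.* (2 ℕ.+ a ℕ.+ b)))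
           stepˡ (ballot-closed (suc a) b (ℕₚ.m≤n⇒m≤1+n b≤a)) ⟩
    (2 ℕ.+ a) ℕ.* (q ℕ.* suc a) ℕ.+ suc b ℕ.* (q ℕ.* (2 ℕ.+ a)) ℕ.+ q ℕ.* (suc b ℕ.* (2 ℕ.+ a ℕ.+ b))
      ≡⟨ distribute a b q ⟩
    ((2 ℕ.+ a ℕ.+ b) ℕ.* q) ℕ.* (2 ℕ.+ a) ℕ.+ ((2 ℕ.+ a) ℕ.* (q ℕ.* suc b) ℕ.+ suc b ℕ.* (q ℕ.* b))
      ≡⟨ cong (λ m → m ℕ.* (2 ℕ.+ a) ℕ.+ ((2 ℕ.+ a) ℕ.* (q ℕ.* suc b) ℕ.+ suc b ℕ.* (q ℕ.* b))) top ⟨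
    (suc a ℕ.+ suc b) ! ℕ.* (2 ℕ.+ a) ℕ.+ _ ∎)
  where
  open ≡-Reasoning
  p = (suc a) !
  r = b !
  q = (suc a ℕ.+ b) !
  f = restrict (suc b ℕₚ.≤? a) (ballot a (suc b))
  g = ballot (suc a) b

  top : (suc a ℕ.+ suc b) ! ≡ (2 ℕ.+ a ℕ.+ b) ℕ.* q
  top = cong _! (ℕₚ.+-suc (suc a) b)

  -- For `b = a` the rule forbids starting with u; the closed form agrees, since its factor `a - b`
  -- vanishes as well.
  stepˡ : f ℕ.* (p ℕ.* (suc b ℕ.* r)) ℕ.+ q ℕ.* suc b ≡ q ℕ.* suc a
  stepˡ with suc b ℕₚ.≤? a
  ... | yes b<a = subst (λ m → ballot a (suc b) ℕ.* (p ℕ.* (suc b ℕ.* r)) ℕ.+ m ! ℕ.* suc b ≡ m ! ℕ.* suc a)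
                    (ℕₚ.+-suc a b) (ballot-closed a (suc b) b<a)
  ... | no  b≮a = cong (λ m → q ℕ.* suc m) (ℕₚ.≤-antisym b≤a (ℕₚ.≮⇒≥ b≮a))

  collect : ∀ f g a b p r q →
    (f ℕ.+ g) ℕ.* (((2 ℕ.+ a) ℕ.* p) ℕ.* (suc b ℕ.* r)) ℕ.+ ((2 ℕ.+ a ℕ.+ b) ℕ.* q) ℕ.* suc b
      ℕ.+ ((2 ℕ.+ a) ℕ.* (q ℕ.* suc b) ℕ.+ suc b ℕ.* (q ℕ.* b))
    ≡ (2 ℕ.+ a) ℕ.* (f ℕ.* (p ℕ.* (suc b ℕ.* r)) ℕ.+ q ℕ.* suc b)
      ℕ.+ suc b ℕ.* (g ℕ.* (((2 ℕ.+ a) ℕ.* p) ℕ.* r) ℕ.+ q ℕ.* b)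
      ℕ.+ q ℕ.* (suc b ℕ.* (2 ℕ.+ a ℕ.+ b))
  collect = ℕ-Solver.solve-∀

  distribute : ∀ a b q →
    (2 ℕ.+ a) ℕ.* (q ℕ.* suc a) ℕ.+ suc b ℕ.* (q ℕ.* (2 ℕ.+ a)) ℕ.+ q ℕ.* (suc b ℕ.* (2 ℕ.+ a ℕ.+ b))
    ≡ ((2 ℕ.+ a ℕ.+ b) ℕ.* q) ℕ.* (2 ℕ.+ a) ℕ.+ ((2 ℕ.+ a) ℕ.* (q ℕ.* suc b) ℕ.+ suc b ℕ.* (q ℕ.* b))
  distribute = ℕ-Solver.solve-∀

-- A coefficient of a Cauchy product. Shifting `φ` in the recursion avoids indices of the form
-- `b ∸ i`.
conv : (ℕ → ℕ) → (ℕ → ℕ) → ℕ → ℕ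
conv φ g zero    = φ 0 ℕ.* g 0
conv φ g (suc b) = φ 0 ℕ.* g (suc b) ℕ.+ conv (φ ∘ suc) g b

conv-distribˡ : ∀ φ ψ g b → conv (λ i → φ i ℕ.+ ψ i) g b ≡ conv φ g b ℕ.+ conv ψ g b
conv-distribˡ φ ψ g zero    = ℕₚ.*-distribʳ-+ (g 0) (φ 0) (ψ 0)
conv-distribˡ φ ψ g (suc b) = begin
  (φ 0 ℕ.+ ψ 0) ℕ.* g (suc b) ℕ.+ conv (λ i → φ (suc i) ℕ.+ ψ (suc i)) g b
    ≡⟨ cong ((φ 0 ℕ.+ ψ 0) ℕ.* g (suc b) ℕ.+_) (conv-distribˡ (φ ∘ suc) (ψ ∘ suc) g b) ⟩
  (φ 0 ℕ.+ ψ 0) ℕ.* g (suc b) ℕ.+ (conv (φ ∘ suc) g b ℕ.+ conv (ψ ∘ suc) g b)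
    ≡⟨ shuffle (φ 0) (ψ 0) (g (suc b)) (conv (φ ∘ suc) g b) (conv (ψ ∘ suc) g b) ⟩
  conv φ g (suc b) ℕ.+ conv ψ g (suc b) ∎
  where
  open ≡-Reasoning
  shuffle : ∀ x y z u v → (x ℕ.+ y) ℕ.* z ℕ.+ (u ℕ.+ v) ≡ x ℕ.* z ℕ.+ u ℕ.+ (y ℕ.* z ℕ.+ v)
  shuffle = ℕ-Solver.solve-∀

-- The constants `c` and `e` carry factorials and powers multiplied across the inequality; the
-- equation `i + j ≡ b` is what lets them be split differently in each summand.
conv-mono : ∀ {φ g ψ h} c e b → (∀ i j → i ℕ.+ j ≡ b → c ℕ.* (φ i ℕ.* g j) ≤ e ℕ.* (ψ i ℕ.* h j)) →
            c ℕ.* conv φ g b ≤ e ℕ.* conv ψ h b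
conv-mono c e zero    le = le 0 0 refl
conv-mono {φ} {g} {ψ} {h} c e (suc b) le = begin
  c ℕ.* (φ 0 ℕ.* g (suc b) ℕ.+ conv (φ ∘ suc) g b)
    ≡⟨ ℕₚ.*-distribˡ-+ c (φ 0 ℕ.* g (suc b)) _ ⟩
  c ℕ.* (φ 0 ℕ.* g (suc b)) ℕ.+ c ℕ.* conv (φ ∘ suc) g b
    ≤⟨ ℕₚ.+-mono-≤ (le 0 (suc b) refl) (conv-mono c e b (λ i j eq → le (suc i) j (cong suc eq))) ⟩
  e ℕ.* (ψ 0 ℕ.* h (suc b)) ℕ.+ e ℕ.* conv (ψ ∘ suc) h b
    ≡⟨ ℕₚ.*-distribˡ-+ e (ψ 0 ℕ.* h (suc b)) _ ⟨
  e ℕ.* (ψ 0 ℕ.* h (suc b) ℕ.+ conv (ψ ∘ suc) h b) ∎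
  where open ℕₚ.≤-Reasoning

conv-cong : ∀ {φ g ψ h} c e b → (∀ i j → i ℕ.+ j ≡ b → c ℕ.* (φ i ℕ.* g j) ≡ e ℕ.* (ψ i ℕ.* h j)) →
            c ℕ.* conv φ g b ≡ e ℕ.* conv ψ h b
conv-cong c e b eq = ℕₚ.≤-antisym
  (conv-mono c e b (λ i j p → ℕₚ.≤-reflexive (eq i j p)))
  (conv-mono e c b (λ i j p → ℕₚ.≤-reflexive (sym (eq i j p))))

module Counting (cell : ℕ → ℕ → ℕ) (M : ℕ) where
  open Corners cell M

  length-corners-low : ∀ a b s → s ≤ M → length (corners a b s) ≡ ballot a b ℕ.* (s C (a ℕ.+ b))
  length-corners-low zero zero zero s≤M = refl
  length-corners-low zero (suc b) zero s≤M = sym (ℕₚ.*-zeroʳ (ballot zero b))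
  length-corners-low (suc a) b zero s≤M = sym (ℕₚ.*-zeroʳ (ballot (suc a) b))
  length-corners-low zero zero (suc s) s<M = begin
    length (corners zero zero s ++ List.[])  ≡⟨ cong length (Listₚ.++-identityʳ (corners zero zero s)) ⟩
    length (corners zero zero s)             ≡⟨ length-corners-low zero zero s (ℕₚ.<⇒≤ s<M) ⟩
    1 ℕ.* (s C 0)                            ≡⟨ cong (1 ℕ.*_) (nC0≡1 s) ⟩
    1 ∎
    where open ≡-Reasoning
  length-corners-low zero (suc b) (suc s) s<M = begin
    length (corners zero (suc b) s ++ map _ (corners zero b s))
      ≡⟨ Listₚ.length-++ (corners zero (suc b) s) ⟩
    length (corners zero (suc b) s) ℕ.+ length (map (consʳ _) (corners zero b s))
      ≡⟨ cong₂ ℕ._+_ (length-corners-low zero (suc b) s (ℕₚ.<⇒≤ s<M))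
           (trans (Listₚ.length-map _ (corners zero b s)) (length-corners-low zero b s (ℕₚ.<⇒≤ s<M))) ⟩
    β ℕ.* (s C suc b) ℕ.+ β ℕ.* (s C b)
      ≡⟨ ℕₚ.+-comm (β ℕ.* (s C suc b)) _ ⟩
    β ℕ.* (s C b) ℕ.+ β ℕ.* (s C suc b)
      ≡⟨ ℕₚ.*-distribˡ-+ β (s C b) (s C suc b) ⟨
    β ℕ.* (s C b ℕ.+ s C suc b)
      ≡⟨ cong (β ℕ.*_) (pascal s b) ⟨
    β ℕ.* (suc s C suc b) ∎
    where
    open ≡-Reasoning
    β = ballot zero b
  length-corners-low (suc a) zero (suc s) s<M = begin
    length (corners (suc a) zero s ++ (takeˡ (suc a) zero s ++ List.[]))
      ≡⟨ Listₚ.length-++ (corners (suc a) zero s) ⟩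
    length (corners (suc a) zero s) ℕ.+ length (takeˡ (suc a) zero s ++ List.[])
      ≡⟨ cong₂ ℕ._+_ (length-corners-low (suc a) zero s (ℕₚ.<⇒≤ s<M)) (begin
           length (takeˡ (suc a) zero s ++ List.[]) ≡⟨ cong length (Listₚ.++-identityʳ (takeˡ (suc a) zero s)) ⟩
           length (takeˡ (suc a) zero s)            ≡⟨ cong length (guard-yes (s ℕₚ.<? M) s<M) ⟩
           length (map _ (corners a zero s))        ≡⟨ Listₚ.length-map _ (corners a zero s) ⟩
           length (corners a zero s)                ≡⟨ length-corners-low a zero s (ℕₚ.<⇒≤ s<M) ⟩
           β ℕ.* (s C (a ℕ.+ 0)) ∎) ⟩
    β ℕ.* (s C suc (a ℕ.+ 0)) ℕ.+ β ℕ.* (s C (a ℕ.+ 0))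
      ≡⟨ ℕₚ.+-comm (β ℕ.* (s C suc (a ℕ.+ 0))) _ ⟩
    β ℕ.* (s C (a ℕ.+ 0)) ℕ.+ β ℕ.* (s C suc (a ℕ.+ 0))
      ≡⟨ ℕₚ.*-distribˡ-+ β (s C (a ℕ.+ 0)) (s C suc (a ℕ.+ 0)) ⟨
    β ℕ.* (s C (a ℕ.+ 0) ℕ.+ s C suc (a ℕ.+ 0))
      ≡⟨ cong (β ℕ.*_) (pascal s (a ℕ.+ 0)) ⟨
    β ℕ.* (suc s C suc (a ℕ.+ 0)) ∎
    where
    open ≡-Reasoning
    β = ballot a zero
  length-corners-low (suc a) (suc b) (suc s) s<M = begin
    length (corners (suc a) (suc b) s ++ (takeˡ (suc a) (suc b) s ++ takeʳ (suc a) (suc b) s))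
      ≡⟨ Listₚ.length-++ (corners (suc a) (suc b) s) ⟩
    length (corners (suc a) (suc b) s) ℕ.+ length (takeˡ (suc a) (suc b) s ++ takeʳ (suc a) (suc b) s)
      ≡⟨ cong₂ ℕ._+_ (length-corners-low (suc a) (suc b) s (ℕₚ.<⇒≤ s<M))
           (Listₚ.length-++ (takeˡ (suc a) (suc b) s)) ⟩
    (f ℕ.+ g) ℕ.* (s C suc (a ℕ.+ suc b)) ℕ.+
        (length (takeˡ (suc a) (suc b) s) ℕ.+ length (takeʳ (suc a) (suc b) s))
      ≡⟨ cong₂ (λ x y → (f ℕ.+ g) ℕ.* (s C suc (a ℕ.+ suc b)) ℕ.+ (x ℕ.+ y)) lengthˡ lengthʳ ⟩
    (f ℕ.+ g) ℕ.* (s C suc (a ℕ.+ suc b)) ℕ.+ (f ℕ.* (s C (a ℕ.+ suc b)) ℕ.+ g ℕ.* (s C (a ℕ.+ suc b)))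
      ≡⟨ collect f g (s C suc (a ℕ.+ suc b)) (s C (a ℕ.+ suc b)) ⟩
    (f ℕ.+ g) ℕ.* (s C (a ℕ.+ suc b) ℕ.+ s C suc (a ℕ.+ suc b))
      ≡⟨ cong ((f ℕ.+ g) ℕ.*_) (pascal s (a ℕ.+ suc b)) ⟨
    (f ℕ.+ g) ℕ.* (suc s C suc (a ℕ.+ suc b)) ∎
    where
    open ≡-Reasoning
    f = restrict (suc b ℕₚ.≤? a) (ballot a (suc b))
    g = ballot (suc a) b

    collect : ∀ f g x y → (f ℕ.+ g) ℕ.* x ℕ.+ (f ℕ.* y ℕ.+ g ℕ.* y) ≡ (f ℕ.+ g) ℕ.* (y ℕ.+ x)
    collect = ℕ-Solver.solve-∀

    lengthˡ : length (takeˡ (suc a) (suc b) s) ≡ f ℕ.* (s C (a ℕ.+ suc b))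
    lengthˡ = begin
      length (takeˡ (suc a) (suc b) s)
        ≡⟨ cong length (guard-yes (s ℕₚ.<? M) s<M) ⟩
      length (guard (suc b ℕₚ.≤? a) (map _ (corners a (suc b) s)))
        ≡⟨ length-guard (suc b ℕₚ.≤? a) _ ⟩
      restrict (suc b ℕₚ.≤? a) (length (map (consˡ (cell (a ℕ.+ suc b) s)) (corners a (suc b) s)))
        ≡⟨ cong (restrict (suc b ℕₚ.≤? a)) (trans (Listₚ.length-map _ (corners a (suc b) s))
             (length-corners-low a (suc b) s (ℕₚ.<⇒≤ s<M))) ⟩
      restrict (suc b ℕₚ.≤? a) (ballot a (suc b) ℕ.* (s C (a ℕ.+ suc b)))
        ≡⟨ restrict-* (suc b ℕₚ.≤? a) (ballot a (suc b)) _ ⟩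
      f ℕ.* (s C (a ℕ.+ suc b)) ∎

    lengthʳ : length (takeʳ (suc a) (suc b) s) ≡ g ℕ.* (s C (a ℕ.+ suc b))
    lengthʳ = begin
      length (takeʳ (suc a) (suc b) s)      ≡⟨ Listₚ.length-map _ (corners (suc a) b s) ⟩
      length (corners (suc a) b s)          ≡⟨ length-corners-low (suc a) b s (ℕₚ.<⇒≤ s<M) ⟩
      g ℕ.* (s C suc (a ℕ.+ b))             ≡⟨ cong (λ m → g ℕ.* (s C m)) (ℕₚ.+-suc a b) ⟨
      g ℕ.* (s C (a ℕ.+ suc b)) ∎

  takeˡ-high : ∀ a b s → M ≤ s → takeˡ a b s ≡ List.[]
  takeˡ-high zero    b s M≤s = refl
  takeˡ-high (suc a) b s M≤s = guard-no (s ℕₚ.<? M) (ℕₚ.≤⇒≯ M≤s)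

  -- The upper `r` levels can hold v's only, so they contribute a plain choice of `i` levels; the
  -- other `j` v's share the lower `M` levels with all the u's. The induction on `r` is that of
  -- Vandermonde's identity.
  length-corners-high : ∀ a b r → length (corners a b (r ℕ.+ M)) ≡
                        conv (r C_) (λ j → ballot a j ℕ.* (M C (a ℕ.+ j))) b
  length-corners-high a b zero = trans (length-corners-low a b M ℕₚ.≤-refl) (sym (lemma b))
    where
    lemma₀ : ∀ g b → conv (λ i → 0 C suc i) g b ≡ 0
    lemma₀ g zero = refl
    lemma₀ g (suc b) = lemma₀ g b
    lemma : ∀ {g} b → conv (0 C_) g b ≡ g b
    lemma {g} zero    = ℕₚ.*-identityˡ (g 0)
    lemma {g} (suc b) = begin
      1 ℕ.* g (suc b) ℕ.+ conv (λ i → 0 C suc i) g b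
        ≡⟨ cong₂ ℕ._+_ (ℕₚ.*-identityˡ (g (suc b))) (lemma₀ g b) ⟩
      g (suc b) ℕ.+ 0 ≡⟨ ℕₚ.+-identityʳ _ ⟩
      g (suc b) ∎
      where open ≡-Reasoning
  length-corners-high a b (suc r) = begin
    length (corners a b (suc r ℕ.+ M))
      ≡⟨ cong length (unfold a b) ⟩
    length (corners a b (r ℕ.+ M) ++ (takeˡ a b (r ℕ.+ M) ++ takeʳ a b (r ℕ.+ M)))
      ≡⟨ cong (λ xs → length (corners a b (r ℕ.+ M) ++ (xs ++ takeʳ a b (r ℕ.+ M))))
           (takeˡ-high a b (r ℕ.+ M) (ℕₚ.m≤n+m M r)) ⟩
    length (corners a b (r ℕ.+ M) ++ takeʳ a b (r ℕ.+ M))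
      ≡⟨ Listₚ.length-++ (corners a b (r ℕ.+ M)) ⟩
    length (corners a b (r ℕ.+ M)) ℕ.+ length (takeʳ a b (r ℕ.+ M))
      ≡⟨ cong (ℕ._+ length (takeʳ a b (r ℕ.+ M))) (length-corners-high a b r) ⟩
    conv (r C_) g b ℕ.+ length (takeʳ a b (r ℕ.+ M))
      ≡⟨ step b ⟩
    conv (suc r C_) g b ∎
    where
    open ≡-Reasoning
    g : ℕ → ℕ
    g j = ballot a j ℕ.* (M C (a ℕ.+ j))

    -- `corners` matches on `a` and `b` before the level, so its last clause reduces only after
    -- these cases are split.
    unfold : ∀ a b → corners a b (suc r ℕ.+ M) ≡
             corners a b (r ℕ.+ M) ++ (takeˡ a b (r ℕ.+ M) ++ takeʳ a b (r ℕ.+ M))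
    unfold zero    zero    = refl
    unfold zero    (suc b) = refl
    unfold (suc a) b       = refl

    step : ∀ b → conv (r C_) g b ℕ.+ length (takeʳ a b (r ℕ.+ M)) ≡ conv (suc r C_) g b
    step zero    = trans (ℕₚ.+-identityʳ _) (cong (ℕ._* g 0) (trans (nC0≡1 r) (sym (nC0≡1 (suc r)))))
    step (suc b) = begin
      conv (r C_) g (suc b) ℕ.+ length (map (consʳ (cell (a ℕ.+ b) (r ℕ.+ M))) (corners a b (r ℕ.+ M)))
        ≡⟨ cong (conv (r C_) g (suc b) ℕ.+_)
             (trans (Listₚ.length-map _ (corners a b (r ℕ.+ M))) (length-corners-high a b r)) ⟩
      (r C 0) ℕ.* g (suc b) ℕ.+ conv (λ i → r C suc i) g b ℕ.+ conv (r C_) g b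
        ≡⟨ ℕₚ.+-assoc ((r C 0) ℕ.* g (suc b)) _ _ ⟩
      (r C 0) ℕ.* g (suc b) ℕ.+ (conv (λ i → r C suc i) g b ℕ.+ conv (r C_) g b)
        ≡⟨ cong₂ ℕ._+_ (cong (ℕ._* g (suc b)) (trans (nC0≡1 r) (sym (nC0≡1 (suc r)))))
             (trans (ℕₚ.+-comm (conv (λ i → r C suc i) g b) _)
                 (sym (conv-distribˡ (r C_) (λ i → r C suc i) g b))) ⟩
      (suc r C 0) ℕ.* g (suc b) ℕ.+ conv (λ i → r C i ℕ.+ r C suc i) g b
        ≡⟨ cong ((suc r C 0) ℕ.* g (suc b) ℕ.+_) (conv-congˡ b (λ i → sym (pascal r i))) ⟩
      (suc r C 0) ℕ.* g (suc b) ℕ.+ conv (λ i → suc r C suc i) g b ∎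
      where
      conv-congˡ : ∀ {φ ψ} b → (∀ i → φ i ≡ ψ i) → conv φ g b ≡ conv ψ g b
      conv-congˡ zero    eq = cong (ℕ._* g 0) (eq 0)
      conv-congˡ (suc b) eq = cong₂ (λ x y → x ℕ.* g (suc b) ℕ.+ y) (eq 0) (conv-congˡ b (λ i → eq (suc i)))

-- Asymptotics of the number of chains

absorption : ∀ n k → (suc n C suc k) ℕ.* suc k ≡ suc n ℕ.* (n C k)
absorption zero    zero    = refl
absorption zero    (suc k) = refl
absorption (suc n) zero    = begin
  (suc (suc n) C 1) ℕ.* 1            ≡⟨ cong (ℕ._* 1) (pascal (suc n) 0) ⟩
  (suc n C 0 ℕ.+ suc n C 1) ℕ.* 1    ≡⟨ ℕₚ.*-distribʳ-+ 1 (suc n C 0) (suc n C 1) ⟩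
  1 ℕ.+ (suc n C 1) ℕ.* 1            ≡⟨ cong (1 ℕ.+_) (absorption n 0) ⟩
  1 ℕ.+ suc n ℕ.* (n C 0)            ≡⟨ cong (λ m → 1 ℕ.+ suc n ℕ.* m) (nC0≡1 n) ⟩
  suc (suc n) ℕ.* 1 ∎
  where open ≡-Reasoning
absorption (suc n) (suc k) = begin
  (suc (suc n) C suc (suc k)) ℕ.* suc (suc k)
    ≡⟨ cong (ℕ._* suc (suc k)) (pascal (suc n) (suc k)) ⟩
  (x ℕ.+ suc n C suc (suc k)) ℕ.* suc (suc k)
    ≡⟨ ℕₚ.*-distribʳ-+ (suc (suc k)) x _ ⟩
  x ℕ.* suc (suc k) ℕ.+ (suc n C suc (suc k)) ℕ.* suc (suc k)
    ≡⟨ cong (x ℕ.* suc (suc k) ℕ.+_) (absorption n (suc k)) ⟩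
  x ℕ.* suc (suc k) ℕ.+ suc n ℕ.* (n C suc k)
    ≡⟨ cong (ℕ._+ suc n ℕ.* (n C suc k)) (ℕₚ.*-suc x (suc k)) ⟩
  x ℕ.+ x ℕ.* suc k ℕ.+ suc n ℕ.* (n C suc k)
    ≡⟨ cong (λ m → x ℕ.+ m ℕ.+ suc n ℕ.* (n C suc k)) (absorption n k) ⟩
  x ℕ.+ suc n ℕ.* (n C k) ℕ.+ suc n ℕ.* (n C suc k)
    ≡⟨ ℕₚ.+-assoc x _ _ ⟩
  x ℕ.+ (suc n ℕ.* (n C k) ℕ.+ suc n ℕ.* (n C suc k))
    ≡⟨ cong (x ℕ.+_) (ℕₚ.*-distribˡ-+ (suc n) (n C k) (n C suc k)) ⟨
  x ℕ.+ suc n ℕ.* (n C k ℕ.+ n C suc k)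
    ≡⟨ cong (λ m → x ℕ.+ suc n ℕ.* m) (pascal n k) ⟨
  x ℕ.+ suc n ℕ.* x ∎
  where
  open ≡-Reasoning
  x = suc n C suc k

-- The product `(m C j) * j !` is the falling factorial m (m - 1) ... (m - j + 1), used in this form
-- to compare binomial coefficients with powers.
falling-suc : ∀ m j → (suc m C suc j) ℕ.* (suc j) ! ≡ suc m ℕ.* ((m C j) ℕ.* j !)
falling-suc m j = begin
  (suc m C suc j) ℕ.* (suc j ℕ.* j !)   ≡⟨ ℕₚ.*-assoc (suc m C suc j) (suc j) (j !) ⟨
  (suc m C suc j) ℕ.* suc j ℕ.* j !     ≡⟨ cong (ℕ._* j !) (absorption m j) ⟩
  suc m ℕ.* (m C j) ℕ.* j !             ≡⟨ ℕₚ.*-assoc (suc m) (m C j) (j !) ⟩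
  suc m ℕ.* ((m C j) ℕ.* j !) ∎
  where open ≡-Reasoning

falling-≤ : ∀ m j → (m C j) ℕ.* j ! ≤ m ℕ.^ j
falling-≤ m zero = ℕₚ.≤-reflexive (cong (ℕ._* 1) (nC0≡1 m))
falling-≤ zero    (suc j) = z≤n
falling-≤ (suc m) (suc j) = begin
  (suc m C suc j) ℕ.* (suc j) !   ≡⟨ falling-suc m j ⟩
  suc m ℕ.* ((m C j) ℕ.* j !)     ≤⟨ ℕₚ.*-monoʳ-≤ (suc m) (falling-≤ m j) ⟩
  suc m ℕ.* m ℕ.^ j               ≤⟨ ℕₚ.*-monoʳ-≤ (suc m) (ℕₚ.^-monoˡ-≤ j (ℕₚ.n≤1+n m)) ⟩
  suc m ℕ.* suc m ℕ.^ j           ∎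
  where open ℕₚ.≤-Reasoning

-- The falling factorial has `j ≤ d` factors, the least of them m - j + 1. One base `m ∸ d` serves
-- every `j` up to `d`, so that the powers from different binomials can be merged.
falling-≥ : ∀ m {d} j → j ≤ d → (m ∸ d) ℕ.^ j ≤ (m C j) ℕ.* j !
falling-≥ m       zero    z≤n = ℕₚ.≤-reflexive (cong (ℕ._* 1) (sym (nC0≡1 m)))
falling-≥ zero    (suc j) (s≤s j≤d) = z≤n
falling-≥ (suc m) {suc d} (suc j) (s≤s j≤d) = begin
  (m ∸ d) ℕ.* (m ∸ d) ℕ.^ j     ≤⟨ ℕₚ.*-mono-≤ (ℕₚ.≤-trans (ℕₚ.m∸n≤m m d) (ℕₚ.n≤1+n m)) (falling-≥ m j j≤d) ⟩
  suc m ℕ.* ((m C j) ℕ.* j !)   ≡⟨ falling-suc m j ⟨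
  (suc m C suc j) ℕ.* (suc j) ! ∎
  where open ℕₚ.≤-Reasoning

chainCount : ℕ → ℕ → ℕ
chainCount k M = conv (M C_) (λ j → ballot k j ℕ.* (M C (k ℕ.+ j))) k

-- This is (2k)! times the leading coefficient of `chainCount k M` as a polynomial in `M`, hence the
-- normalized volume itself.
shuffleCount : ℕ → ℕ
shuffleCount k = conv ((k ℕ.+ k) C_) (ballot k) k

module _ (k : ℕ) where
  private
    d = k ℕ.+ k

    split : ∀ i j → i ℕ.+ j ≡ k → i ℕ.+ (k ℕ.+ j) ≡ d
    split i j eq = trans (rotate i k j) (cong (k ℕ.+_) eq)
      where
      rotate : ∀ i k j → i ℕ.+ (k ℕ.+ j) ≡ k ℕ.+ (i ℕ.+ j)
      rotate = ℕ-Solver.solve-∀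

    -- Because `i + (k + j)` is the dimension `d`, the factorial `d !` equals
    -- `(d C i) * (i ! * (k + j) !)`. Its last two factors turn both binomials in `M` into falling
    -- factorials, and what is left is the summand of `shuffleCount`.
    regroup : ∀ M i j → i ℕ.+ j ≡ k →
      d ! ℕ.* ((M C i) ℕ.* (ballot k j ℕ.* (M C (k ℕ.+ j))))
      ≡ ((M C i) ℕ.* i ! ℕ.* ((M C (k ℕ.+ j)) ℕ.* (k ℕ.+ j) !)) ℕ.* ((d C i) ℕ.* ballot k j)
    regroup M i j eq = begin
      d ! ℕ.* ((M C i) ℕ.* (ballot k j ℕ.* (M C (k ℕ.+ j))))
        ≡⟨ cong (λ m → m ! ℕ.* ((M C i) ℕ.* (ballot k j ℕ.* (M C (k ℕ.+ j))))) (split i j eq) ⟨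
      (i ℕ.+ (k ℕ.+ j)) ! ℕ.* ((M C i) ℕ.* (ballot k j ℕ.* (M C (k ℕ.+ j))))
        ≡⟨ cong (ℕ._* ((M C i) ℕ.* (ballot k j ℕ.* (M C (k ℕ.+ j))))) (binomial-factorials i (k ℕ.+ j)) ⟨
      ((i ℕ.+ (k ℕ.+ j)) C i) ℕ.* (i ! ℕ.* (k ℕ.+ j) !) ℕ.* ((M C i) ℕ.* (ballot k j ℕ.* (M C (k ℕ.+ j))))
        ≡⟨ cong (λ m → (m C i) ℕ.* (i ! ℕ.* (k ℕ.+ j) !) ℕ.* ((M C i) ℕ.* (ballot k j ℕ.* (M C (k ℕ.+ j)))))
             (split i j eq) ⟩
      (d C i) ℕ.* (i ! ℕ.* (k ℕ.+ j) !) ℕ.* ((M C i) ℕ.* (ballot k j ℕ.* (M C (k ℕ.+ j))))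
        ≡⟨ permute (d C i) (i !) ((k ℕ.+ j) !) (M C i) (ballot k j) (M C (k ℕ.+ j)) ⟩
      ((M C i) ℕ.* i ! ℕ.* ((M C (k ℕ.+ j)) ℕ.* (k ℕ.+ j) !)) ℕ.* ((d C i) ℕ.* ballot k j) ∎
      where
      open ≡-Reasoning
      permute : ∀ c p q x β y → c ℕ.* (p ℕ.* q) ℕ.* (x ℕ.* (β ℕ.* y)) ≡ (x ℕ.* p ℕ.* (y ℕ.* q)) ℕ.* (c ℕ.* β)
      permute = ℕ-Solver.solve-∀

  chainCount-≤ : ∀ M → d ! ℕ.* chainCount k M ≤ M ℕ.^ d ℕ.* shuffleCount k
  chainCount-≤ M = conv-mono (d !) (M ℕ.^ d) k λ i j eq → begin
    d ! ℕ.* ((M C i) ℕ.* (ballot k j ℕ.* (M C (k ℕ.+ j))))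
      ≡⟨ regroup M i j eq ⟩
    ((M C i) ℕ.* i ! ℕ.* ((M C (k ℕ.+ j)) ℕ.* (k ℕ.+ j) !)) ℕ.* ((d C i) ℕ.* ballot k j)
      ≤⟨ ℕₚ.*-monoˡ-≤ ((d C i) ℕ.* ballot k j) (ℕₚ.*-mono-≤ (falling-≤ M i) (falling-≤ M (k ℕ.+ j))) ⟩
    (M ℕ.^ i ℕ.* M ℕ.^ (k ℕ.+ j)) ℕ.* ((d C i) ℕ.* ballot k j)
      ≡⟨ cong (ℕ._* ((d C i) ℕ.* ballot k j)) (ℕₚ.^-distribˡ-+-* M i (k ℕ.+ j)) ⟨
    M ℕ.^ (i ℕ.+ (k ℕ.+ j)) ℕ.* ((d C i) ℕ.* ballot k j)
      ≡⟨ cong (λ m → M ℕ.^ m ℕ.* ((d C i) ℕ.* ballot k j)) (split i j eq) ⟩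
    M ℕ.^ d ℕ.* ((d C i) ℕ.* ballot k j) ∎
    where open ℕₚ.≤-Reasoning

  chainCount-≥ : ∀ M → (M ∸ d) ℕ.^ d ℕ.* shuffleCount k ≤ d ! ℕ.* chainCount k M
  chainCount-≥ M = conv-mono ((M ∸ d) ℕ.^ d) (d !) k λ i j eq → begin
    (M ∸ d) ℕ.^ d ℕ.* ((d C i) ℕ.* ballot k j)
      ≡⟨ cong (λ m → (M ∸ d) ℕ.^ m ℕ.* ((d C i) ℕ.* ballot k j)) (split i j eq) ⟨
    (M ∸ d) ℕ.^ (i ℕ.+ (k ℕ.+ j)) ℕ.* ((d C i) ℕ.* ballot k j)
      ≡⟨ cong (ℕ._* ((d C i) ℕ.* ballot k j)) (ℕₚ.^-distribˡ-+-* (M ∸ d) i (k ℕ.+ j)) ⟩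
    ((M ∸ d) ℕ.^ i ℕ.* (M ∸ d) ℕ.^ (k ℕ.+ j)) ℕ.* ((d C i) ℕ.* ballot k j)
      ≤⟨ ℕₚ.*-monoˡ-≤ ((d C i) ℕ.* ballot k j) (ℕₚ.*-mono-≤
           (falling-≥ M i (ℕₚ.m+n≤o⇒m≤o i (ℕₚ.≤-reflexive (split i j eq))))
           (falling-≥ M (k ℕ.+ j) (ℕₚ.m+n≤o⇒n≤o i (ℕₚ.≤-reflexive (split i j eq))))) ⟩
    ((M C i) ℕ.* i ! ℕ.* ((M C (k ℕ.+ j)) ℕ.* (k ℕ.+ j) !)) ℕ.* ((d C i) ℕ.* ballot k j)
      ≡⟨ regroup M i j eq ⟨
    d ! ℕ.* ((M C i) ℕ.* (ballot k j ℕ.* (M C (k ℕ.+ j)))) ∎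
    where open ℕₚ.≤-Reasoning

-- Evaluation of the sum of ballot numbers

private
  one : ℕ → ℕ
  one _ = 1

conv-last : ∀ w b → conv w one (suc b) ≡ conv w one b ℕ.+ w (suc b)
conv-last w zero    = cong₂ ℕ._+_ refl (ℕₚ.*-identityʳ (w 1))
conv-last w (suc b) = trans (cong (w 0 ℕ.* 1 ℕ.+_) (conv-last (w ∘ suc) b)) (sym (ℕₚ.+-assoc (w 0 ℕ.* 1) _ _))

binomialSum : (ℕ → ℕ) → ℕ → ℕ
binomialSum w n = conv (λ i → (n C i) ℕ.* w i) one n

binomialSum-suc : ∀ w n → binomialSum w (suc n) ≡ binomialSum w n ℕ.+ binomialSum (w ∘ suc) n
binomialSum-suc w n = begin
  conv (λ i → (suc n C i) ℕ.* w i) one (suc n)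
    ≡⟨ cong₂ ℕ._+_ (cong (λ m → m ℕ.* w 0 ℕ.* 1) (trans (nC0≡1 (suc n)) (sym (nC0≡1 n)))) (ptwise n) ⟩
  (n C 0) ℕ.* w 0 ℕ.* 1 ℕ.+ conv (λ i → (n C i) ℕ.* w (suc i) ℕ.+ (n C suc i) ℕ.* w (suc i)) one n
    ≡⟨ cong ((n C 0) ℕ.* w 0 ℕ.* 1 ℕ.+_) (conv-distribˡ (λ i → (n C i) ℕ.* w (suc i)) _ one n) ⟩
  (n C 0) ℕ.* w 0 ℕ.* 1 ℕ.+ (binomialSum (w ∘ suc) n ℕ.+ conv (λ i → (n C suc i) ℕ.* w (suc i)) one n)
    ≡⟨ rotate ((n C 0) ℕ.* w 0 ℕ.* 1) (binomialSum (w ∘ suc) n) _ ⟩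
  conv (λ i → (n C i) ℕ.* w i) one (suc n) ℕ.+ binomialSum (w ∘ suc) n
    ≡⟨ cong (ℕ._+ binomialSum (w ∘ suc) n) (begin
         conv (λ i → (n C i) ℕ.* w i) one (suc n)       ≡⟨ conv-last _ n ⟩
         binomialSum w n ℕ.+ (n C suc n) ℕ.* w (suc n)
           ≡⟨ cong (λ m → binomialSum w n ℕ.+ m ℕ.* w (suc n)) (k>n⇒nCk≡0 (ℕₚ.n<1+n n)) ⟩
         binomialSum w n ℕ.+ 0                          ≡⟨ ℕₚ.+-identityʳ _ ⟩
         binomialSum w n ∎) ⟩
  binomialSum w n ℕ.+ binomialSum (w ∘ suc) n ∎
  where
  open ≡-Reasoning
  rotate : ∀ x y z → x ℕ.+ (y ℕ.+ z) ≡ x ℕ.+ z ℕ.+ y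
  rotate = ℕ-Solver.solve-∀
  ptwise : ∀ b → conv (λ i → (suc n C suc i) ℕ.* w (suc i)) one b
               ≡ conv (λ i → (n C i) ℕ.* w (suc i) ℕ.+ (n C suc i) ℕ.* w (suc i)) one b
  ptwise b = ℕₚ.*-cancelˡ-≡ _ _ 1 (conv-cong 1 1 b λ i j _ → cong (λ m → 1 ℕ.* (m ℕ.* 1))
    (trans (cong (ℕ._* w (suc i)) (pascal n i)) (ℕₚ.*-distribʳ-+ (w (suc i)) (n C i) (n C suc i))))

-- The first moment of the binomial coefficients, doubled so that no exponent n - 1 occurs. The
-- offset `c` is general because Pascal's rule produces the same sum for `suc c`.
binomialSum-linear : ∀ c n → 2 ℕ.* binomialSum (ℕ._+ c) n ≡ (n ℕ.+ 2 ℕ.* c) ℕ.* 2 ℕ.^ n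
binomialSum-linear c zero    = base c
  where
  base : ∀ c → 2 ℕ.* (1 ℕ.* c ℕ.* 1) ≡ (2 ℕ.* c) ℕ.* 1
  base = ℕ-Solver.solve-∀
binomialSum-linear c (suc n) = begin
  2 ℕ.* binomialSum (ℕ._+ c) (suc n)
    ≡⟨ cong (2 ℕ.*_) (binomialSum-suc (ℕ._+ c) n) ⟩
  2 ℕ.* (binomialSum (ℕ._+ c) n ℕ.+ binomialSum (λ i → suc (i ℕ.+ c)) n)
    ≡⟨ cong (λ m → 2 ℕ.* (binomialSum (ℕ._+ c) n ℕ.+ m)) shift ⟩
  2 ℕ.* (binomialSum (ℕ._+ c) n ℕ.+ binomialSum (ℕ._+ suc c) n)
    ≡⟨ ℕₚ.*-distribˡ-+ 2 (binomialSum (ℕ._+ c) n) _ ⟩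
  2 ℕ.* binomialSum (ℕ._+ c) n ℕ.+ 2 ℕ.* binomialSum (ℕ._+ suc c) n
    ≡⟨ cong₂ ℕ._+_ (binomialSum-linear c n) (binomialSum-linear (suc c) n) ⟩
  (n ℕ.+ 2 ℕ.* c) ℕ.* 2 ℕ.^ n ℕ.+ (n ℕ.+ 2 ℕ.* suc c) ℕ.* 2 ℕ.^ n
    ≡⟨ combine n c (2 ℕ.^ n) ⟩
  (suc n ℕ.+ 2 ℕ.* c) ℕ.* 2 ℕ.^ suc n ∎
  where
  open ≡-Reasoning
  combine : ∀ n c p → (n ℕ.+ 2 ℕ.* c) ℕ.* p ℕ.+ (n ℕ.+ 2 ℕ.* suc c) ℕ.* p ≡ (suc n ℕ.+ 2 ℕ.* c) ℕ.* (2 ℕ.* p)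
  combine = ℕ-Solver.solve-∀
  shift : binomialSum (λ i → suc (i ℕ.+ c)) n ≡ binomialSum (ℕ._+ suc c) n
  shift = ℕₚ.*-cancelˡ-≡ _ _ 1 (conv-cong 1 1 n λ i j _ →
            cong (λ m → 1 ℕ.* ((n C i) ℕ.* m ℕ.* 1)) (sym (ℕₚ.+-suc i c)))

-- Write j = k - i. In (2k choose i) B(k,j) the factorial (k + j)! cancels, and the rest is (2k)! /
-- ((k + 1)! k!) times (k choose i) (i + 1), since k + 1 - j = i + 1. The first factor is the
-- Catalan number C_k and does not depend on i, so a first moment of binomial coefficients remains.
shuffleCount-closed : ∀ k →
  2 ℕ.* (((suc k) ! ℕ.* k !) ℕ.* shuffleCount k) ≡ (k ℕ.+ k) ! ℕ.* ((k ℕ.+ 2) ℕ.* 2 ℕ.^ k)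
shuffleCount-closed k = begin
  2 ℕ.* (((suc k) ! ℕ.* k !) ℕ.* shuffleCount k)
    ≡⟨ cong (2 ℕ.*_) (conv-cong ((suc k) ! ℕ.* k !) ((k ℕ.+ k) !) k term) ⟩
  2 ℕ.* ((k ℕ.+ k) ! ℕ.* binomialSum (ℕ._+ 1) k)
    ≡⟨ swap ((k ℕ.+ k) !) (binomialSum (ℕ._+ 1) k) ⟩
  (k ℕ.+ k) ! ℕ.* (2 ℕ.* binomialSum (ℕ._+ 1) k)
    ≡⟨ cong ((k ℕ.+ k) ! ℕ.*_) (binomialSum-linear 1 k) ⟩
  (k ℕ.+ k) ! ℕ.* ((k ℕ.+ 2) ℕ.* 2 ℕ.^ k) ∎
  where
  open ≡-Reasoning
  swap : ∀ x y → 2 ℕ.* (x ℕ.* y) ≡ x ℕ.* (2 ℕ.* y)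
  swap = ℕ-Solver.solve-∀

  term : ∀ i j → i ℕ.+ j ≡ k →
    ((suc k) ! ℕ.* k !) ℕ.* (((k ℕ.+ k) C i) ℕ.* ballot k j) ≡ (k ℕ.+ k) ! ℕ.* (((k C i) ℕ.* (i ℕ.+ 1)) ℕ.* 1)
  term i j refl = begin
    ((suc k) ! ℕ.* k !) ℕ.* (c ℕ.* ballot k j)
      ≡⟨ cong (λ m → ((suc k) ! ℕ.* m) ℕ.* (c ℕ.* ballot k j)) (binomial-factorials i j) ⟨
    ((suc k) ! ℕ.* ((k C i) ℕ.* (i ! ℕ.* j !))) ℕ.* (c ℕ.* ballot k j)
      ≡⟨ permute ((suc k) !) (k C i) (i !) (j !) c (ballot k j) ⟩
    (c ℕ.* i !) ℕ.* (k C i) ℕ.* (ballot k j ℕ.* ((suc k) ! ℕ.* j !))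
      ≡⟨ cong ((c ℕ.* i !) ℕ.* (k C i) ℕ.*_) ballot≡ ⟩
    (c ℕ.* i !) ℕ.* (k C i) ℕ.* ((k ℕ.+ j) ! ℕ.* (i ℕ.+ 1))
      ≡⟨ permute₂ c (i !) (k C i) ((k ℕ.+ j) !) (i ℕ.+ 1) ⟩
    (c ℕ.* (i ! ℕ.* (k ℕ.+ j) !)) ℕ.* (((k C i) ℕ.* (i ℕ.+ 1)) ℕ.* 1)
      ≡⟨ cong (ℕ._* (((k C i) ℕ.* (i ℕ.+ 1)) ℕ.* 1)) whole ⟩
    (k ℕ.+ k) ! ℕ.* (((k C i) ℕ.* (i ℕ.+ 1)) ℕ.* 1) ∎
    where
    c = (k ℕ.+ k) C i
    permute : ∀ s x p q c β → (s ℕ.* (x ℕ.* (p ℕ.* q))) ℕ.* (c ℕ.* β) ≡ (c ℕ.* p) ℕ.* x ℕ.* (β ℕ.* (s ℕ.* q))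
    permute = ℕ-Solver.solve-∀
    permute₂ : ∀ c p x r y → (c ℕ.* p) ℕ.* x ℕ.* (r ℕ.* y) ≡ (c ℕ.* (p ℕ.* r)) ℕ.* ((x ℕ.* y) ℕ.* 1)
    permute₂ = ℕ-Solver.solve-∀
    swap₂ : ∀ i j → i ℕ.+ (i ℕ.+ j ℕ.+ j) ≡ (i ℕ.+ j) ℕ.+ (i ℕ.+ j)
    swap₂ = ℕ-Solver.solve-∀
    whole : c ℕ.* (i ! ℕ.* (k ℕ.+ j) !) ≡ (k ℕ.+ k) !
    whole = subst (λ m → (m C i) ℕ.* (i ! ℕ.* (k ℕ.+ j) !) ≡ m !) (swap₂ i j) (binomial-factorials i (k ℕ.+ j))
    regroup : ∀ q i j → q ℕ.* suc (i ℕ.+ j) ≡ q ℕ.* (i ℕ.+ 1) ℕ.+ q ℕ.* j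
    regroup = ℕ-Solver.solve-∀
    ballot≡ : ballot k j ℕ.* ((suc k) ! ℕ.* j !) ≡ (k ℕ.+ j) ! ℕ.* (i ℕ.+ 1)
    ballot≡ = ℕₚ.+-cancelʳ-≡ ((k ℕ.+ j) ! ℕ.* j) _ _
      (trans (ballot-closed k j (ℕₚ.m≤n+m j i)) (regroup ((k ℕ.+ j) !) i j))

-- Rational and real numbers

ℚ-ring : AlmostCommutativeRing _ _
ℚ-ring = fromCommutativeRing ℚₚ.+-*-commutativeRing λ p → dec⇒maybe (0ℚ ℚₚ.≟ p)

-1*p≡-p : ∀ p → (ℚ.- 1ℚ) ℚ.* p ≡ ℚ.- p
-1*p≡-p p = trans (sym (ℚₚ.neg-distribˡ-* 1ℚ p)) (cong ℚ.-_ (ℚₚ.*-identityˡ p))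

/1-+ : ∀ x y → (x ℤ.+ y) / 1 ≡ x / 1 ℚ.+ y / 1
/1-+ x y = ℚₚ.toℚᵘ-injective (begin
  ℚ.toℚᵘ ((x ℤ.+ y) / 1)                   ≈⟨ ℚₚ.toℚᵘ-fromℚᵘ (ℚᵘ.mkℚᵘ (x ℤ.+ y) 0) ⟩
  ℚᵘ.mkℚᵘ (x ℤ.+ y) 0                      ≈⟨ ℚᵘ.*≡* (identity x y) ⟩
  ℚᵘ.mkℚᵘ x 0 ℚᵘ.+ ℚᵘ.mkℚᵘ y 0
    ≈⟨ ℚᵘₚ.+-cong (ℚₚ.toℚᵘ-fromℚᵘ (ℚᵘ.mkℚᵘ x 0)) (ℚₚ.toℚᵘ-fromℚᵘ (ℚᵘ.mkℚᵘ y 0)) ⟨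
  ℚ.toℚᵘ (x / 1) ℚᵘ.+ ℚ.toℚᵘ (y / 1)       ≈⟨ ℚₚ.toℚᵘ-homo-+ (x / 1) (y / 1) ⟨
  ℚ.toℚᵘ (x / 1 ℚ.+ y / 1) ∎)
  where
  open import Relation.Binary.Reasoning.Setoid ℚᵘₚ.≃-setoid
  identity : ∀ x y → (x ℤ.+ y) ℤ.* 1ℤ ≡ (x ℤ.* 1ℤ ℤ.+ y ℤ.* 1ℤ) ℤ.* 1ℤ
  identity = ℤ-Solver.solve-∀

/1-* : ∀ x y → (x ℤ.* y) / 1 ≡ (x / 1) ℚ.* (y / 1)
/1-* x y = ℚₚ.toℚᵘ-injective (begin
  ℚ.toℚᵘ ((x ℤ.* y) / 1)                   ≈⟨ ℚₚ.toℚᵘ-fromℚᵘ (ℚᵘ.mkℚᵘ (x ℤ.* y) 0) ⟩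
  ℚᵘ.mkℚᵘ x 0 ℚᵘ.* ℚᵘ.mkℚᵘ y 0
    ≈⟨ ℚᵘₚ.*-cong (ℚₚ.toℚᵘ-fromℚᵘ (ℚᵘ.mkℚᵘ x 0)) (ℚₚ.toℚᵘ-fromℚᵘ (ℚᵘ.mkℚᵘ y 0)) ⟨
  ℚ.toℚᵘ (x / 1) ℚᵘ.* ℚ.toℚᵘ (y / 1)       ≈⟨ ℚₚ.toℚᵘ-homo-* (x / 1) (y / 1) ⟨
  ℚ.toℚᵘ ((x / 1) ℚ.* (y / 1)) ∎)
  where open import Relation.Binary.Reasoning.Setoid ℚᵘₚ.≃-setoid

/1-neg : ∀ x → (ℤ.- x) / 1 ≡ ℚ.- (x / 1)
/1-neg x = trans (cong (_/ 1) (sym (ℤₚ.-1*i≡-i x))) (trans (/1-* (ℤ.- 1ℤ) x) (-1*p≡-p (x / 1)))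

ι : ℕ → ℚ
ι n = + n / 1

ι-+ : ∀ m n → ι (m ℕ.+ n) ≡ ι m ℚ.+ ι n
ι-+ m n = /1-+ (+ m) (+ n)

ι-* : ∀ m n → ι (m ℕ.* n) ≡ ι m ℚ.* ι n
ι-* m n = trans (cong (_/ 1) (ℤₚ.pos-* m n)) (/1-* (+ m) (+ n))

ι-mono : ∀ {m n} → m ≤ n → ι m ℚ.≤ ι n
ι-mono {m} {n} m≤n = ℚₚ.toℚᵘ-cancel-≤ (ℚᵘₚ.≤-trans
  (ℚᵘₚ.≤-reflexive (ℚₚ.toℚᵘ-fromℚᵘ (ℚᵘ.mkℚᵘ (+ m) 0)))
  (ℚᵘₚ.≤-trans (ℚᵘ.*≤* (ℤₚ.*-monoʳ-≤-nonNeg 1ℤ (ℤ.+≤+ m≤n)))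
  (ℚᵘₚ.≤-reflexive (ℚᵘₚ.≃-sym (ℚₚ.toℚᵘ-fromℚᵘ (ℚᵘ.mkℚᵘ (+ n) 0))))))

ι-positive : ∀ n .{{_ : ℕ.NonZero n}} → ℚ.Positive (ι n)
ι-positive n = ℚₚ.normalize-pos n 1

denominator : ∀ n d .{{_ : ℕ.NonZero d}} → ι d ℚ.* (+ n / d) ≡ ι n
denominator n (suc d) = ℚₚ.toℚᵘ-injective (begin
  ℚ.toℚᵘ (ι (suc d) ℚ.* (+ n / suc d))                ≈⟨ ℚₚ.toℚᵘ-homo-* (ι (suc d)) (+ n / suc d) ⟩
  ℚ.toℚᵘ (ι (suc d)) ℚᵘ.* ℚ.toℚᵘ (+ n / suc d)
    ≈⟨ ℚᵘₚ.*-cong (ℚₚ.toℚᵘ-fromℚᵘ (ℚᵘ.mkℚᵘ (+ suc d) 0)) (ℚₚ.toℚᵘ-fromℚᵘ (ℚᵘ.mkℚᵘ (+ n) d)) ⟩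
  ℚᵘ.mkℚᵘ (+ suc d) 0 ℚᵘ.* ℚᵘ.mkℚᵘ (+ n) d
    ≈⟨ ℚᵘ.*≡* (trans (identity (+ suc d) (+ n)) (cong (λ m → + n ℤ.* + suc m) (sym (ℕₚ.+-identityʳ d)))) ⟩
  ℚᵘ.mkℚᵘ (+ n) 0                                     ≈⟨ ℚₚ.toℚᵘ-fromℚᵘ (ℚᵘ.mkℚᵘ (+ n) 0) ⟨
  ℚ.toℚᵘ (ι n) ∎)
  where
  open import Relation.Binary.Reasoning.Setoid ℚᵘₚ.≃-setoid
  identity : ∀ x y → (x ℤ.* y) ℤ.* 1ℤ ≡ y ℤ.* x
  identity = ℤ-Solver.solve-∀

unit-fraction-≤ : ∀ ε → 0ℚ ℚ.< ε → ∃ λ q → (+ 1 / suc q) ℚ.≤ ε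
unit-fraction-≤ ε@(ℚ.mkℚ (+ suc p) q _) _ = q , subst ((+ 1 / suc q) ℚ.≤_) (ℚₚ.↥p/↧p≡p ε)
  (ℚₚ.*-cancelˡ-≤-pos (ι (suc q)) {{ι-positive (suc q)}}
    (subst₂ ℚ._≤_ (sym (denominator 1 (suc q))) (sym (denominator (suc p) (suc q)))
        (ι-mono {1} {suc p} (s≤s z≤n))))
unit-fraction-≤ (ℚ.mkℚ (+ zero) q _) (ℚ.*<* (ℤ.+<+ ()))
unit-fraction-≤ (ℚ.mkℚ ℤ.-[1+ p ] q _) (ℚ.*<* ())

-- The bridge from rational comparisons to natural numbers: `P` is a common denominator of both
-- sides.
≤-cleared : ∀ P {x y m n} .{{_ : ℕ.NonZero P}} → ι P ℚ.* x ≡ ι m → ι P ℚ.* y ≡ ι n → m ≤ n → x ℚ.≤ y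
≤-cleared P Px≡m Py≡n m≤n = ℚₚ.*-cancelˡ-≤-pos (ι P) {{ι-positive P}}
  (subst₂ ℚ._≤_ (sym Px≡m) (sym Py≡n) (ι-mono m≤n))

≡-cleared : ∀ P {x y m} .{{_ : ℕ.NonZero P}} → ι P ℚ.* x ≡ ι m → ι P ℚ.* y ≡ ι m → x ≡ y
≡-cleared P {m = m} Px≡m Py≡m = ℚₚ.≤-antisym
  (≤-cleared P {m = m} Px≡m Py≡m ℕₚ.≤-refl) (≤-cleared P {m = m} Py≡m Px≡m ℕₚ.≤-refl)

_^ℚ_ : ℚ → ℕ → ℚ
w ^ℚ zero  = 1ℚ
w ^ℚ suc n = w ℚ.* (w ^ℚ n)

^ℚ-cleared : ∀ {w N L} d → ι N ℚ.* w ≡ ι L → ι (N ℕ.^ d) ℚ.* (w ^ℚ d) ≡ ι (L ℕ.^ d)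
^ℚ-cleared zero eq = refl
^ℚ-cleared {w} {N} {L} (suc d) eq = begin
  ι (N ℕ.* N ℕ.^ d) ℚ.* (w ℚ.* (w ^ℚ d))        ≡⟨ cong (ℚ._* (w ℚ.* (w ^ℚ d))) (ι-* N (N ℕ.^ d)) ⟩
  (ι N ℚ.* ι (N ℕ.^ d)) ℚ.* (w ℚ.* (w ^ℚ d))    ≡⟨ interchange (ι N) (ι (N ℕ.^ d)) w (w ^ℚ d) ⟩
  (ι N ℚ.* w) ℚ.* (ι (N ℕ.^ d) ℚ.* (w ^ℚ d))    ≡⟨ cong₂ ℚ._*_ eq (^ℚ-cleared d eq) ⟩
  ι L ℚ.* ι (L ℕ.^ d)                           ≡⟨ ι-* L (L ℕ.^ d) ⟨
  ι (L ℕ.^ suc d) ∎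
  where
  open ≡-Reasoning
  interchange : ∀ a b c e → (a ℚ.* b) ℚ.* (c ℚ.* e) ≡ (a ℚ.* c) ℚ.* (b ℚ.* e)
  interchange = RingSolver.solve-∀ ℚ-ring

≤+ε : ∀ {p q ε} → p ℚ.≤ q → 0ℚ ℚ.< ε → p ℚ.≤ q ℚ.+ ε
≤+ε {p} {q} p≤q 0<ε = subst (ℚ._≤ _) (ℚₚ.+-identityʳ p) (ℚₚ.+-mono-≤ p≤q (ℚₚ.<⇒≤ 0<ε))

≤⇒≤ᴿ : ∀ {x y} → (∀ m → seq x m ℚ.≤ seq y m) → x ≤ᴿ y
≤⇒≤ᴿ le ε 0<ε = 0 , λ n _ → ≤+ε (le n) 0<ε

≡⇒≤ᴿ : ∀ {x y} → (∀ m → seq x m ≡ seq y m) → x ≤ᴿ y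
≡⇒≤ᴿ {x} {y} eq = ≤⇒≤ᴿ {x} {y} λ m → ℚₚ.≤-reflexive (eq m)

≡⇒≈ᴿ : ∀ {x y} → (∀ m → seq x m ≡ seq y m) → x ≈ᴿ y
≡⇒≈ᴿ {x} {y} eq = ≡⇒≤ᴿ {x} {y} eq , ≡⇒≤ᴿ {y} {x} (sym ∘ eq)

fromℚ-mono : ∀ {p q} → p ℚ.≤ q → fromℚ p ≤ᴿ fromℚ q
fromℚ-mono {p} {q} p≤q = ≤⇒≤ᴿ {fromℚ p} {fromℚ q} (λ _ → p≤q)

half+half : ∀ ε → ½ ℚ.* ε ℚ.+ ½ ℚ.* ε ≡ ε
half+half ε = trans (sym (ℚₚ.*-distribʳ-+ ε ½ ½)) (ℚₚ.*-identityˡ ε)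

half-positive : ∀ {ε} → 0ℚ ℚ.< ε → 0ℚ ℚ.< ½ ℚ.* ε
half-positive {ε} 0<ε = subst (ℚ._< ½ ℚ.* ε) (ℚₚ.*-zeroʳ ½) (ℚₚ.*-monoʳ-<-pos ½ 0<ε)

≤ᴿ-trans : ∀ {x y z} → x ≤ᴿ y → y ≤ᴿ z → x ≤ᴿ z
≤ᴿ-trans {x} {y} {z} x≤y y≤z ε 0<ε =
  let N₁ , le₁ = x≤y (½ ℚ.* ε) (half-positive 0<ε)
      N₂ , le₂ = y≤z (½ ℚ.* ε) (half-positive 0<ε)
  in N₁ ℕ.⊔ N₂ , λ n N≤n → begin
    seq x n                                 ≤⟨ le₁ n (ℕₚ.m⊔n≤o⇒m≤o N₁ N₂ N≤n) ⟩
    seq y n ℚ.+ ½ ℚ.* ε                     ≤⟨ ℚₚ.+-monoˡ-≤ (½ ℚ.* ε) (le₂ n (ℕₚ.m⊔n≤o⇒n≤o N₁ N₂ N≤n)) ⟩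
    seq z n ℚ.+ ½ ℚ.* ε ℚ.+ ½ ℚ.* ε         ≡⟨ ℚₚ.+-assoc (seq z n) _ _ ⟩
    seq z n ℚ.+ (½ ℚ.* ε ℚ.+ ½ ℚ.* ε)       ≡⟨ cong (seq z n ℚ.+_) (half+half ε) ⟩
    seq z n ℚ.+ ε ∎
  where open ℚₚ.≤-Reasoning

0≤-⇒≤ᴿ : ∀ {x y z} → (∀ m → seq z m ≡ seq y m ℚ.- seq x m) → fromℚ 0ℚ ≤ᴿ z → x ≤ᴿ y
0≤-⇒≤ᴿ {x} {y} {z} eq 0≤z ε 0<ε = let N , le = 0≤z ε 0<ε in N , λ n N≤n →
  subst₂ ℚ._≤_ (ℚₚ.+-identityˡ (seq x n))
    (trans (cong (λ q → q ℚ.+ ε ℚ.+ seq x n) (eq n)) (cancel (seq y n) (seq x n) ε))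
    (ℚₚ.+-monoˡ-≤ (seq x n) (le n N≤n))
  where
  cancel : ∀ a b e → (a ℚ.- b) ℚ.+ e ℚ.+ b ≡ a ℚ.+ e
  cancel = RingSolver.solve-∀ ℚ-ring

≤ᴿ⇒0≤- : ∀ {x y z} → (∀ m → seq z m ≡ seq y m ℚ.- seq x m) → x ≤ᴿ y → fromℚ 0ℚ ≤ᴿ z
≤ᴿ⇒0≤- {x} {y} {z} eq x≤y ε 0<ε = let N , le = x≤y ε 0<ε in N , λ n N≤n →
  subst₂ ℚ._≤_ (ℚₚ.+-inverseʳ (seq x n))
    (trans (cancel (seq y n) (seq x n) ε) (cong (ℚ._+ ε) (sym (eq n))))
    (ℚₚ.+-monoˡ-≤ (ℚ.- seq x n) (le n N≤n))
  where
  cancel : ∀ a b e → (a ℚ.+ e) ℚ.- b ≡ (a ℚ.- b) ℚ.+ e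
  cancel = RingSolver.solve-∀ ℚ-ring

p≤∣p∣ : ∀ p → p ℚ.≤ ℚ.∣ p ∣
p≤∣p∣ p with ℚₚ.≤-total 0ℚ p
... | inj₁ 0≤p = ℚₚ.≤-reflexive (sym (ℚₚ.0≤p⇒∣p∣≡p 0≤p))
... | inj₂ p≤0 = ℚₚ.≤-trans p≤0 (ℚₚ.0≤∣p∣ p)

-- The constructive substitute for the dichotomy x ≤ p or p ≤ x.
approximate-dichotomy : ∀ {p q} x → p ℚ.< q → x ≤ᴿ fromℚ q ⊎ fromℚ p ≤ᴿ x
approximate-dichotomy {p} {q} x p<q = result
  where
  open ℚₚ.≤-Reasoning
  ε : ℚ
  ε = ½ ℚ.* (q ℚ.- p)

  0<ε : 0ℚ ℚ.< ε
  0<ε = half-positive (subst (ℚ._< q ℚ.- p) (ℚₚ.+-inverseʳ p) (ℚₚ.+-monoˡ-< (ℚ.- p) p<q))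

  N : ℕ
  N = proj₁ (cauchy x ε 0<ε)

  close : ∀ m n → N ≤ m → N ≤ n → seq x m ℚ.≤ seq x n ℚ.+ ε
  close m n N≤m N≤n = begin
    seq x m                              ≡⟨ cancel (seq x m) (seq x n) ⟩
    seq x n ℚ.+ (seq x m ℚ.- seq x n)
      ≤⟨ ℚₚ.+-monoʳ-≤ (seq x n) (ℚₚ.≤-trans (p≤∣p∣ _) (ℚₚ.<⇒≤ (proj₂ (cauchy x ε 0<ε) m n N≤m N≤n))) ⟩
    seq x n ℚ.+ ε ∎
    where
    cancel : ∀ a b → a ≡ b ℚ.+ (a ℚ.- b)
    cancel = RingSolver.solve-∀ ℚ-ring

  p+2ε≡q : (p ℚ.+ ε) ℚ.+ ε ≡ q
  p+2ε≡q = trans (ℚₚ.+-assoc p ε ε) (trans (cong (p ℚ.+_) (half+half (q ℚ.- p))) (cancel p q))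
    where
    cancel : ∀ a b → a ℚ.+ (b ℚ.- a) ≡ b
    cancel = RingSolver.solve-∀ ℚ-ring

  result : x ≤ᴿ fromℚ q ⊎ fromℚ p ≤ᴿ x
  -- One rational term is compared with the midpoint of `p` and `q`. All later terms stay within
  -- `ε`, half the gap, of it.
  result with seq x N ℚₚ.≤? p ℚ.+ ε
  ... | yes xN≤ = inj₁ λ η 0<η → N , λ n N≤n → ≤+ε (begin
          seq x n              ≤⟨ close n N N≤n ℕₚ.≤-refl ⟩
          seq x N ℚ.+ ε        ≤⟨ ℚₚ.+-monoˡ-≤ ε xN≤ ⟩
          (p ℚ.+ ε) ℚ.+ ε      ≡⟨ p+2ε≡q ⟩
          q ∎) 0<η
  ... | no xN≰ = inj₂ λ η 0<η → N , λ n N≤n → ≤+ε (begin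
          p                          ≡⟨ cancel p ε ⟩
          (p ℚ.+ ε) ℚ.- ε            ≤⟨ ℚₚ.+-monoˡ-≤ (ℚ.- ε) (ℚₚ.<⇒≤ (ℚₚ.≰⇒> xN≰)) ⟩
          seq x N ℚ.- ε              ≤⟨ ℚₚ.+-monoˡ-≤ (ℚ.- ε) (close N n ℕₚ.≤-refl N≤n) ⟩
          (seq x n ℚ.+ ε) ℚ.- ε      ≡⟨ cancel (seq x n) ε ⟨
          seq x n ∎) 0<η
    where
    cancel : ∀ a b → a ≡ (a ℚ.+ b) ℚ.- b
    cancel = RingSolver.solve-∀ ℚ-ring

-- Flows on the caracol graph

/1-minus : ∀ x y → (x ℤ.- y) / 1 ≡ x / 1 ℚ.- y / 1
/1-minus x y = trans (/1-+ x (ℤ.- y)) (cong (x / 1 ℚ.+_) (/1-neg y))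

/1-injective : ∀ {x y} → x / 1 ≡ y / 1 → x ≡ y
/1-injective {x} {y} eq with ℚₚ./-injective-≃ (ℚᵘ.mkℚᵘ x 0) (ℚᵘ.mkℚᵘ y 0) eq
... | ℚᵘ.*≡* x1≡y1 = trans (sym (ℤₚ.*-identityʳ x)) (trans x1≡y1 (ℤₚ.*-identityʳ y))

sumℚ : ∀ {n} → (Fin n → ℚ) → ℚ
sumℚ = sumᴹ ℚ.+-0-rawMonoid

sumℚ-cong : ∀ {n} {f g : Fin n → ℚ} → (∀ i → f i ≡ g i) → sumℚ f ≡ sumℚ g
sumℚ-cong {zero}  eq = refl
sumℚ-cong {suc n} eq = cong₂ ℚ._+_ (eq Fin.zero) (sumℚ-cong (eq ∘ Fin.suc))

module _ (A : RawGroup 0ℓ 0ℓ) (φ : RawGroup.Carrier A → ℚ) (φ-ε : φ (RawGroup.ε A) ≡ 0ℚ)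
         (φ-∙ : ∀ x y → φ (RawGroup._∙_ A x y) ≡ φ x ℚ.+ φ y) where
  open RawGroup A

  sum-homo : ∀ {n} (f : Fin n → Carrier) → φ (sumᴹ rawMonoid f) ≡ sumℚ (φ ∘ f)
  sum-homo {zero}  f = φ-ε
  sum-homo {suc n} f = trans (φ-∙ _ _) (cong (φ (f Fin.zero) ℚ.+_) (sum-homo (f ∘ Fin.suc)))

  -- Real netflows, term by term of the sequences, and integer netflows are both carried to ℚ, so
  -- the graph has to be analysed only once.
  netflow-homo : (∀ x → φ (x ⁻¹) ≡ ℚ.- φ x) → ∀ G b j →
                 φ (Netflow.netflow A G b j) ≡ netflowℚ G (φ ∘ b) j
  netflow-homo φ-⁻¹ G b j = begin
    φ (out ∙ inn ⁻¹)        ≡⟨ φ-∙ out (inn ⁻¹) ⟩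
    φ out ℚ.+ φ (inn ⁻¹)    ≡⟨ cong (φ out ℚ.+_) (φ-⁻¹ inn) ⟩
    φ out ℚ.- φ inn         ≡⟨ cong₂ ℚ._-_ (masked proj₁) (masked proj₂) ⟩
    netflowℚ G (φ ∘ b) j ∎
    where
    open ≡-Reasoning
    mask : (ℕ × ℕ → ℕ) → Fin (length G) → Carrier
    mask end e = if end (lookup G e) ≡ᵇ j then b e else ε
    out = sumᴹ rawMonoid (mask proj₁)
    inn = sumᴹ rawMonoid (mask proj₂)

    if-homo : ∀ c x → φ (if c then x else ε) ≡ (if c then φ x else 0ℚ)
    if-homo true  x = refl
    if-homo false x = φ-ε

    masked : ∀ end → φ (sumᴹ rawMonoid (mask end))
                   ≡ sumℚ (λ e → if end (lookup G e) ≡ᵇ j then φ (b e) else 0ℚ)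
    masked end = trans (sum-homo (mask end)) (sumℚ-cong λ e → if-homo (end (lookup G e) ≡ᵇ j) (b e))

netflow-seq : ∀ G b j m → seq (netflowᴿ G b j) m ≡ netflowℚ G (λ e → seq (b e) m) j
netflow-seq G b j m = netflow-homo +-0-rawGroupᴿ (λ x → seq x m) refl (λ _ _ → refl)
                        (λ x → -1*p≡-p (seq x m)) G b j

netflow-/1 : ∀ G b j → netflowᶻ G b j / 1 ≡ netflowℚ G (λ e → b e / 1) j
netflow-/1 G b j = netflow-homo ℤ.+-0-rawGroup (_/ 1) refl /1-+ /1-neg G b j

-- Edges are addressed by natural numbers because the length of the edge list is only
-- propositionally the sum of its three block lengths. The default makes this total.
at : {A : Set} → A → ∀ {n} → (Fin n → A) → ℕ → A
at z {zero}  b i       = z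
at z {suc n} b zero    = b Fin.zero
at z {suc n} b (suc i) = at z (b ∘ Fin.suc) i

at-toℕ : {A : Set} (z : A) → ∀ {n} (b : Fin n → A) e → at z b (toℕ e) ≡ b e
at-toℕ z b Fin.zero    = refl
at-toℕ z b (Fin.suc e) = at-toℕ z (b ∘ Fin.suc) e

at-map : {A B : Set} (φ : A → B) (z : A) → ∀ {n} (b : Fin n → A) i → φ (at z b i) ≡ at (φ z) (φ ∘ b) i
at-map φ z {zero}  b i       = refl
at-map φ z {suc n} b zero    = refl
at-map φ z {suc n} b (suc i) = at-map φ z (b ∘ Fin.suc) i

flux : (ℕ × ℕ → Bool) → Edges → (ℕ → ℚ) → ℚ
flux p List.[]      b = 0ℚ
flux p (e List.∷ G) b = (if p e then b 0 else 0ℚ) ℚ.+ flux p G (b ∘ suc)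

sum≡flux : ∀ p G (b : Fin (length G) → ℚ) →
           sumℚ (λ e → if p (lookup G e) then b e else 0ℚ) ≡ flux p G (at 0ℚ b)
sum≡flux p List.[]      b = refl
sum≡flux p (e List.∷ G) b = cong ((if p e then b Fin.zero else 0ℚ) ℚ.+_) (sum≡flux p G (b ∘ Fin.suc))

flux-++ : ∀ p G H b → flux p (G ++ H) b ≡ flux p G b ℚ.+ flux p H (λ i → b (length G ℕ.+ i))
flux-++ p List.[]      H b = sym (ℚₚ.+-identityˡ _)
flux-++ p (e List.∷ G) H b = trans
  (cong ((if p e then b 0 else 0ℚ) ℚ.+_) (flux-++ p G H (b ∘ suc)))
  (sym (ℚₚ.+-assoc (if p e then b 0 else 0ℚ) _ _))

∑< : ℕ → (ℕ → ℚ) → ℚ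
∑< zero    f = 0ℚ
∑< (suc n) f = ∑< n f ℚ.+ f n

∑<-front : ∀ n f → ∑< (suc n) f ≡ f 0 ℚ.+ ∑< n (f ∘ suc)
∑<-front zero    f = ℚₚ.+-comm 0ℚ (f 0)
∑<-front (suc n) f = trans (cong (ℚ._+ f (suc n)) (∑<-front n f)) (ℚₚ.+-assoc (f 0) _ _)

∑<-cong : ∀ n {f g} → (∀ i → i < n → f i ≡ g i) → ∑< n f ≡ ∑< n g
∑<-cong zero    eq = refl
∑<-cong (suc n) eq = cong₂ ℚ._+_ (∑<-cong n (λ i i<n → eq i (ℕₚ.m≤n⇒m≤1+n i<n))) (eq n ℕₚ.≤-refl)

∑<-zero : ∀ n {f} → (∀ i → i < n → f i ≡ 0ℚ) → ∑< n f ≡ 0ℚ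
∑<-zero n eq = trans (∑<-cong n eq) (zeros n)
  where
  zeros : ∀ n → ∑< n (λ _ → 0ℚ) ≡ 0ℚ
  zeros zero    = refl
  zeros (suc n) = trans (ℚₚ.+-identityʳ _) (zeros n)

flux-applyUpTo : ∀ p f n b → flux p (applyUpTo f n) b ≡ ∑< n (λ i → if p (f i) then b i else 0ℚ)
flux-applyUpTo p f zero    b = refl
flux-applyUpTo p f (suc n) b = trans
  (cong ((if p (f 0) then b 0 else 0ℚ) ℚ.+_) (flux-applyUpTo p (f ∘ suc) n (b ∘ suc)))
  (sym (∑<-front n (λ i → if p (f i) then b i else 0ℚ)))

if-≡ᵇ : ∀ {i j} {x : ℚ} → i ≡ j → (if i ≡ᵇ j then x else 0ℚ) ≡ x
if-≡ᵇ {zero}  refl = refl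
if-≡ᵇ {suc i} refl = if-≡ᵇ {i} refl

if-≢ᵇ : ∀ {i j} {x : ℚ} → i ≢ j → (if i ≡ᵇ j then x else 0ℚ) ≡ 0ℚ
if-≢ᵇ {zero}  {zero}  i≢j = contradiction refl i≢j
if-≢ᵇ {zero}  {suc j} i≢j = refl
if-≢ᵇ {suc i} {zero}  i≢j = refl
if-≢ᵇ {suc i} {suc j} i≢j = if-≢ᵇ {i} {j} (i≢j ∘ cong suc)

∑<-pick : ∀ n (f : ℕ → ℚ) {j} → j < n → ∑< n (λ i → if i ≡ᵇ j then f i else 0ℚ) ≡ f j
∑<-pick (suc n) f {j} (s≤s j≤n) with j ℕₚ.≟ n
... | yes refl = trans (cong₂ ℚ._+_ (∑<-zero n (λ i i<n → if-≢ᵇ (ℕₚ.<⇒≢ i<n))) (if-≡ᵇ {n} refl))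
    (ℚₚ.+-identityˡ (f n))
... | no j≢n = trans (cong₂ ℚ._+_ (∑<-pick n f (ℕₚ.≤∧≢⇒< j≤n j≢n)) (if-≢ᵇ (j≢n ∘ sym))) (ℚₚ.+-identityʳ (f j))

xEdge yEdge : ℕ → ℕ × ℕ
xEdge i = 1 , 2 ℕ.+ i
yEdge i = 2 ℕ.+ i , 3 ℕ.+ i

zEdge : ℕ → ℕ → ℕ × ℕ
zEdge k i = 2 ℕ.+ i , 3 ℕ.+ k

caracol-applyUpTo : ∀ k → caracol (2 ℕ.+ k) ≡
  applyUpTo xEdge (suc k) ++ applyUpTo yEdge (suc k) ++ applyUpTo (zEdge k) k
caracol-applyUpTo k = cong₂ _++_ (eq (λ j → 1 , j) (suc k))
    (cong₂ _++_ (eq (λ i → i , suc i) (suc k)) (eq (λ i → i , 3 ℕ.+ k) k))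
  where
  eq : ∀ (f : ℕ → ℕ × ℕ) m → map f (map (2 ℕ.+_) (List.upTo m)) ≡ applyUpTo (λ i → f (2 ℕ.+ i)) m
  eq f m = trans (cong (map f) (Listₚ.map-upTo (2 ℕ.+_) m)) (Listₚ.map-applyUpTo (2 ℕ.+_) f m)

length-caracol : ∀ k → length (caracol (2 ℕ.+ k)) ≡ suc k ℕ.+ (suc k ℕ.+ k)
length-caracol k = begin
  length (caracol (2 ℕ.+ k))            ≡⟨ cong length (caracol-applyUpTo k) ⟩
  length (X ++ (Y ++ Z))                ≡⟨ Listₚ.length-++ X ⟩
  length X ℕ.+ length (Y ++ Z)
    ≡⟨ cong₂ ℕ._+_ (Listₚ.length-applyUpTo xEdge (suc k)) (Listₚ.length-++ Y) ⟩
  suc k ℕ.+ (length Y ℕ.+ length Z)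
    ≡⟨ cong (suc k ℕ.+_) (cong₂ ℕ._+_ (Listₚ.length-applyUpTo yEdge (suc k))
         (Listₚ.length-applyUpTo (zEdge k) k)) ⟩
  suc k ℕ.+ (suc k ℕ.+ k) ∎
  where
  open ≡-Reasoning
  X = applyUpTo xEdge (suc k)
  Y = applyUpTo yEdge (suc k)
  Z = applyUpTo (zEdge k) k

-- The flow that enters vertex `2 + i` along the path; the path begins at vertex 2, hence the value
-- 0.
prev : (ℕ → ℚ) → ℕ → ℚ
prev y zero    = 0ℚ
prev y (suc i) = y i

module Vertices (k : ℕ) (b : Fin (length (caracol (2 ℕ.+ k))) → ℚ) where
  x y z : ℕ → ℚ
  x i = at 0ℚ b i
  y i = at 0ℚ b (suc k ℕ.+ i)
  z i = at 0ℚ b (suc k ℕ.+ (suc k ℕ.+ i))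

  flux-caracol : ∀ p → sumℚ (λ e → if p (lookup (caracol (2 ℕ.+ k)) e) then b e else 0ℚ) ≡
      ∑< (suc k) (λ i → if p (1 , 2 ℕ.+ i) then x i else 0ℚ)
    ℚ.+ (∑< (suc k) (λ i → if p (2 ℕ.+ i , 3 ℕ.+ i) then y i else 0ℚ)
    ℚ.+ ∑< k (λ i → if p (2 ℕ.+ i , 3 ℕ.+ k) then z i else 0ℚ))
  flux-caracol p = begin
    _ ≡⟨ sum≡flux p (caracol (2 ℕ.+ k)) b ⟩
    flux p (caracol (2 ℕ.+ k)) β
      ≡⟨ cong (λ G → flux p G β) (caracol-applyUpTo k) ⟩
    flux p (X ++ (Y ++ Z)) β
      ≡⟨ flux-++ p X (Y ++ Z) β ⟩
    flux p X β ℚ.+ flux p (Y ++ Z) (λ i → β (length X ℕ.+ i))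
      ≡⟨ cong (λ l → flux p X β ℚ.+ flux p (Y ++ Z) (λ i → β (l ℕ.+ i)))
           (Listₚ.length-applyUpTo xEdge (suc k)) ⟩
    flux p X β ℚ.+ flux p (Y ++ Z) y
      ≡⟨ cong (flux p X β ℚ.+_) (flux-++ p Y Z y) ⟩
    flux p X β ℚ.+ (flux p Y y ℚ.+ flux p Z (λ i → y (length Y ℕ.+ i)))
      ≡⟨ cong (λ l → flux p X β ℚ.+ (flux p Y y ℚ.+ flux p Z (λ i → y (l ℕ.+ i))))
           (Listₚ.length-applyUpTo yEdge (suc k)) ⟩
    flux p X β ℚ.+ (flux p Y y ℚ.+ flux p Z z)
      ≡⟨ cong₂ ℚ._+_ (flux-applyUpTo p xEdge (suc k) β)
           (cong₂ ℚ._+_ (flux-applyUpTo p yEdge (suc k) y) (flux-applyUpTo p (zEdge k) k z)) ⟩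
    _ ∎
    where
    open ≡-Reasoning
    β = at 0ℚ b
    X = applyUpTo xEdge (suc k)
    Y = applyUpTo yEdge (suc k)
    Z = applyUpTo (zEdge k) k

  source : netflowℚ (caracol (2 ℕ.+ k)) b 1 ≡ ∑< (suc k) x
  source = trans (cong₂ ℚ._-_ (flux-caracol (λ e → proj₁ e ≡ᵇ 1)) (flux-caracol (λ e → proj₂ e ≡ᵇ 1)))
    (trans (cong₂ ℚ._-_
             (cong (∑< (suc k) x ℚ.+_)
                 (cong₂ ℚ._+_ (∑<-zero (suc k) (λ _ _ → refl)) (∑<-zero k (λ _ _ → refl))))
             (cong₂ ℚ._+_ (∑<-zero (suc k) (λ _ _ → refl))
                 (cong₂ ℚ._+_ (∑<-zero (suc k) (λ _ _ → refl)) (∑<-zero k (λ _ _ → refl)))))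
           (simplify (∑< (suc k) x)))
    where
    simplify : ∀ s → s ℚ.+ (0ℚ ℚ.+ 0ℚ) ℚ.- (0ℚ ℚ.+ (0ℚ ℚ.+ 0ℚ)) ≡ s
    simplify = RingSolver.solve-∀ ℚ-ring

  private
    inflow : ∀ i → i ≤ k →
      sumℚ (λ e → if proj₂ (lookup (caracol (2 ℕ.+ k)) e) ≡ᵇ (2 ℕ.+ i) then b e else 0ℚ) ≡ x i ℚ.+ prev y i
    inflow i i≤k = trans (flux-caracol (λ e → proj₂ e ≡ᵇ (2 ℕ.+ i)))
      (trans (cong₂ ℚ._+_ (∑<-pick (suc k) x (s≤s i≤k))
               (cong₂ ℚ._+_ (shifted i i≤k) (∑<-zero k (λ _ _ → if-≢ᵇ {suc k} (ℕₚ.<⇒≢ (s≤s i≤k) ∘ sym)))))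
             (cong (x i ℚ.+_) (ℚₚ.+-identityʳ _)))
      where
      shifted : ∀ i → i ≤ k → ∑< (suc k) (λ j → if suc j ≡ᵇ i then y j else 0ℚ) ≡ prev y i
      shifted zero    _   = ∑<-zero (suc k) (λ _ _ → refl)
      shifted (suc i) i<k = ∑<-pick (suc k) y (ℕₚ.m≤n⇒m≤1+n i<k)

    outflow : ∀ i → i ≤ k →
      sumℚ (λ e → if proj₁ (lookup (caracol (2 ℕ.+ k)) e) ≡ᵇ (2 ℕ.+ i) then b e else 0ℚ)
      ≡ y i ℚ.+ ∑< k (λ j → if j ≡ᵇ i then z j else 0ℚ)
    outflow i i≤k = trans (flux-caracol (λ e → proj₁ e ≡ᵇ (2 ℕ.+ i)))
      (trans (cong₂ (λ s t → s ℚ.+ (t ℚ.+ ∑< k (λ j → if j ≡ᵇ i then z j else 0ℚ)))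
               (∑<-zero (suc k) (λ _ _ → refl)) (∑<-pick (suc k) y (s≤s i≤k)))
             (ℚₚ.+-identityˡ _))

  inner : ∀ i → i < k → netflowℚ (caracol (2 ℕ.+ k)) b (2 ℕ.+ i) ≡ (y i ℚ.+ z i) ℚ.- (x i ℚ.+ prev y i)
  inner i i<k = cong₂ ℚ._-_ (trans (outflow i (ℕₚ.<⇒≤ i<k)) (cong (y i ℚ.+_) (∑<-pick k z i<k)))
                  (inflow i (ℕₚ.<⇒≤ i<k))

  -- This vertex has no edge of the third block: its path edge already leads to the sink.
  final : netflowℚ (caracol (2 ℕ.+ k)) b (2 ℕ.+ k) ≡ y k ℚ.- (x k ℚ.+ prev y k)
  final = cong₂ ℚ._-_ (trans (outflow k ℕₚ.≤-refl)
            (trans (cong (y k ℚ.+_) (∑<-zero k (λ i i<k → if-≢ᵇ (ℕₚ.<⇒≢ i<k)))) (ℚₚ.+-identityʳ (y k))))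
            (inflow k ℕₚ.≤-refl)

-- Adds the potentials of the outer faces at both ends of a sequence, so that the first and last
-- differences need no separate formula.
pad : {A : Set} → A → A → ∀ {n} → (Fin n → A) → ℕ → A
pad z t         u zero    = t
pad z t {zero}  u (suc i) = z
pad z t {suc n} u (suc i) = pad z (u Fin.zero) (u ∘ Fin.suc) i

pad-map : {A B : Set} (φ : A → B) (z t : A) → ∀ {n} (u : Fin n → A) i →
          φ (pad z t u i) ≡ pad (φ z) (φ t) (φ ∘ u) i
pad-map φ z t         u zero    = refl
pad-map φ z t {zero}  u (suc i) = refl
pad-map φ z t {suc n} u (suc i) = pad-map φ z (u Fin.zero) (u ∘ Fin.suc) i

pad-cong : {A : Set} (z t : A) → ∀ {n} {u v : Fin n → A} → (∀ j → u j ≡ v j) → ∀ i → pad z t u i ≡ pad z t v i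
pad-cong z t         eq zero    = refl
pad-cong z t {zero}  eq (suc i) = refl
pad-cong z t {suc n} {u} {v} eq (suc i) = trans
  (cong (λ s → pad z s (u ∘ Fin.suc) i) (eq Fin.zero)) (pad-cong z (v Fin.zero) (eq ∘ Fin.suc) i)

pad-suc-toℕ : {A : Set} (z t : A) → ∀ {n} (u : Fin n → A) j → pad z t u (suc (toℕ j)) ≡ u j
pad-suc-toℕ z t u Fin.zero    = refl
pad-suc-toℕ z t u (Fin.suc j) = pad-suc-toℕ z (u Fin.zero) (u ∘ Fin.suc) j

pad-end : {A : Set} (z t : A) → ∀ {n} (u : Fin n → A) → pad z t u (suc n) ≡ z
pad-end z t {zero}  u = refl
pad-end z t {suc n} u = pad-end z (u Fin.zero) (u ∘ Fin.suc)

pad-+ : ∀ s t {n} (u v : Fin n → ℚ) i →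
        pad 0ℚ s u i ℚ.+ pad 0ℚ t v i ≡ pad 0ℚ (s ℚ.+ t) (λ j → u j ℚ.+ v j) i
pad-+ s t         u v zero    = refl
pad-+ s t {zero}  u v (suc i) = refl
pad-+ s t {suc n} u v (suc i) = pad-+ (u Fin.zero) (v Fin.zero) (u ∘ Fin.suc) (v ∘ Fin.suc) i

sumℚ-zero : ∀ {n} (f : Fin n → ℚ) → (∀ i → f i ≡ 0ℚ) → sumℚ f ≡ 0ℚ
sumℚ-zero {zero}  f eq = refl
sumℚ-zero {suc n} f eq = cong₂ ℚ._+_ (eq Fin.zero) (sumℚ-zero (f ∘ Fin.suc) (eq ∘ Fin.suc))

sumℚ-*-minus : ∀ {n} (c f g : Fin n → ℚ) →
  sumℚ (λ i → c i ℚ.* (f i ℚ.- g i)) ≡ sumℚ (λ i → c i ℚ.* f i) ℚ.- sumℚ (λ i → c i ℚ.* g i)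
sumℚ-*-minus {zero}  c f g = refl
sumℚ-*-minus {suc n} c f g = trans
  (cong (c Fin.zero ℚ.* (f Fin.zero ℚ.- g Fin.zero) ℚ.+_)
      (sumℚ-*-minus (c ∘ Fin.suc) (f ∘ Fin.suc) (g ∘ Fin.suc)))
  (shuffle (c Fin.zero) (f Fin.zero) (g Fin.zero) _ _)
  where
  shuffle : ∀ c f g s t → c ℚ.* (f ℚ.- g) ℚ.+ (s ℚ.- t) ≡ (c ℚ.* f ℚ.+ s) ℚ.- (c ℚ.* g ℚ.+ t)
  shuffle = RingSolver.solve-∀ ℚ-ring

kronecker : ∀ {n} → Fin n → Fin n → ℤ
kronecker Fin.zero    Fin.zero    = 1ℤ
kronecker Fin.zero    (Fin.suc j) = 0ℤ
kronecker (Fin.suc i) Fin.zero    = 0ℤ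
kronecker (Fin.suc i) (Fin.suc j) = kronecker i j

sumℚ-kronecker : ∀ {n} (c : Fin n → ℚ) j → sumℚ (λ i → c i ℚ.* (kronecker i j / 1)) ≡ c j
sumℚ-kronecker {suc n} c Fin.zero    = trans
  (cong₂ ℚ._+_ (ℚₚ.*-identityʳ (c Fin.zero)) (sumℚ-zero _ (λ i → ℚₚ.*-zeroʳ (c (Fin.suc i)))))
  (ℚₚ.+-identityʳ (c Fin.zero))
sumℚ-kronecker {suc n} c (Fin.suc j) = trans
  (cong₂ ℚ._+_ (ℚₚ.*-zeroʳ (c Fin.zero)) (sumℚ-kronecker (c ∘ Fin.suc) j))
  (ℚₚ.+-identityˡ (c (Fin.suc j)))

sumℚ-pad : ∀ {m n} (c : Fin m → ℚ) (t : Fin m → ℚ) (w : Fin m → Fin n → ℚ) i →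
  sumℚ (λ l → c l ℚ.* pad 0ℚ (t l) (w l) i)
  ≡ pad 0ℚ (sumℚ (λ l → c l ℚ.* t l)) (λ j → sumℚ (λ l → c l ℚ.* w l j)) i
sumℚ-pad             c t w zero    = refl
sumℚ-pad {n = zero}  c t w (suc i) = sumℚ-zero _ (λ l → ℚₚ.*-zeroʳ (c l))
sumℚ-pad {n = suc n} c t w (suc i) = sumℚ-pad c (λ l → w l Fin.zero) (λ l → w l ∘ Fin.suc) i

-- The flow on each edge is a difference of two potentials: inj₁ i stands for
-- the i-th entry of the first padded sequence and inj₂ i for that of the second.

Potential : Set
Potential = ℕ ⊎ ℕ

value : {A : Set} → (ℕ → A) → (ℕ → A) → Potential → A
value U V = [ U , V ]′

value-map : ∀ {A B : Set} (φ : A → B) (U V : ℕ → A) {U′ V′ : ℕ → B} →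
            (∀ i → φ (U i) ≡ U′ i) → (∀ i → φ (V i) ≡ V′ i) → ∀ p → φ (value U V p) ≡ value U′ V′ p
value-map φ U V eq₁ eq₂ (inj₁ i) = eq₁ i
value-map φ U V eq₁ eq₂ (inj₂ i) = eq₂ i

cat : {A : Set} → ℕ → (ℕ → A) → (ℕ → A) → ℕ → A
cat zero    f g i       = g i
cat (suc m) f g zero    = f 0
cat (suc m) f g (suc i) = cat m (f ∘ suc) g i

cat-< : {A : Set} {f g : ℕ → A} → ∀ {m i} → i < m → cat m f g i ≡ f i
cat-< {m = suc m} {zero}  i<m       = refl
cat-< {f = f} {m = suc m} {suc i} (s≤s i<m) = cat-< {f = f ∘ suc} i<m

cat-+ : {A : Set} {f g : ℕ → A} → ∀ m i → cat m f g (m ℕ.+ i) ≡ g i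
cat-+ zero    i = refl
cat-+ {f = f} (suc m) i = cat-+ {f = f ∘ suc} m i

module _ (k : ℕ) where
  xEnds yEnds zEnds : ℕ → Potential × Potential
  xEnds i = inj₁ i , inj₁ (suc i)
  zEnds i = inj₂ i , inj₂ (suc i)
  -- The last path edge is the exception. It carries everything that arrives at vertex `2 + k`,
  -- namely `V k - V (suc k)`, as an edge of the third block from that vertex would.
  yEnds = cat k (λ i → inj₂ (suc i) , inj₁ (suc i)) (λ _ → zEnds k)

  ends : ℕ → Potential × Potential
  ends = cat (suc k) xEnds (cat (suc k) yEnds zEnds)

  ends-x : ∀ {i} → i ≤ k → ends i ≡ xEnds i
  ends-x i≤k = cat-< {f = xEnds} (s≤s i≤k)

  ends-y : ∀ {i} → i < k → ends (suc k ℕ.+ i) ≡ (inj₂ (suc i) , inj₁ (suc i))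
  ends-y {i} i<k = trans (cat-+ {f = xEnds} (suc k) i)
    (trans (cat-< {f = yEnds} (ℕₚ.m≤n⇒m≤1+n i<k)) (cat-< {f = λ i → inj₂ (suc i) , inj₁ (suc i)} i<k))

  ends-last : ends (suc k ℕ.+ k) ≡ zEnds k
  ends-last = trans (cat-+ {f = xEnds} (suc k) k)
    (trans (cat-< {f = yEnds} (ℕₚ.n<1+n k)) (trans (cong yEnds (sym (ℕₚ.+-identityʳ k)))
      (cat-+ {f = λ i → inj₂ (suc i) , inj₁ (suc i)} k 0)))

  ends-z : ∀ i → ends (suc k ℕ.+ (suc k ℕ.+ i)) ≡ zEnds i
  ends-z i = trans (cat-+ {f = xEnds} (suc k) (suc k ℕ.+ i)) (cat-+ {f = yEnds} (suc k) i)

  module _ (P : ℕ → Set)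
    (Px : ∀ i → i ≤ k → P i)
    (Py : ∀ i → i < k → P (suc k ℕ.+ i))
    (Plast : P (suc k ℕ.+ k))
    (Pz : ∀ i → i < k → P (suc k ℕ.+ (suc k ℕ.+ i))) where

    private
      below : ∀ {m n} (Q : ℕ → Set) → (∀ i → i < m → Q i) → (∀ i → i < n → Q (m ℕ.+ i)) → ∀ i →
          i < m ℕ.+ n → Q i
      below {m} {n} Q lo hi i i<m+n with i ℕₚ.<? m
      ... | yes i<m = lo i i<m
      ... | no  i≮m = subst Q (ℕₚ.m+[n∸m]≡n m≤i) (hi (i ∸ m)
            (ℕₚ.+-cancelˡ-< m (i ∸ m) n (subst (_< m ℕ.+ n) (sym (ℕₚ.m+[n∸m]≡n m≤i)) i<m+n)))
        where m≤i = ℕₚ.≮⇒≥ i≮m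

    positions : (e : Fin (length (caracol (2 ℕ.+ k)))) → P (toℕ e)
    positions e = below P (λ i → Px i ∘ ℕₚ.≤-pred)
      (below (P ∘ (suc k ℕ.+_)) y (λ i → Pz i)) (toℕ e)
      (subst (toℕ e <_) (length-caracol k) (Finₚ.toℕ<n e))
      where
      y : ∀ i → i < suc k → P (suc k ℕ.+ i)
      y i (s≤s i≤k) with i ℕₚ.≟ k
      ... | yes refl = Plast
      ... | no  i≢k  = Py i (ℕₚ.≤∧≢⇒< i≤k i≢k)

  highEnd lowEnd : Fin (length (caracol (2 ℕ.+ k))) → Potential
  highEnd e = proj₁ (ends (toℕ e))
  lowEnd e = proj₂ (ends (toℕ e))

  flow : (ℕ → ℚ) → (ℕ → ℚ) → ℕ → ℚ
  flow U V p = value U V (proj₁ (ends p)) ℚ.- value U V (proj₂ (ends p))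

  flow-cong : ∀ {U V U′ V′} → (∀ i → U i ≡ U′ i) → (∀ i → V i ≡ V′ i) → ∀ p → flow U V p ≡ flow U′ V′ p
  flow-cong {U} {V} {U′} {V′} eq₁ eq₂ p = cong₂ ℚ._-_ (eq (proj₁ (ends p))) (eq (proj₂ (ends p)))
    where
    eq : ∀ q → value U V q ≡ value U′ V′ q
    eq (inj₁ i) = eq₁ i
    eq (inj₂ i) = eq₂ i

  module _ {U V : ℕ → ℚ} where
    flow-x : ∀ {i} → i ≤ k → flow U V i ≡ U i ℚ.- U (suc i)
    flow-x i≤k rewrite ends-x i≤k = refl

    flow-y : ∀ {i} → i < k → flow U V (suc k ℕ.+ i) ≡ V (suc i) ℚ.- U (suc i)
    flow-y i<k rewrite ends-y i<k = refl

    flow-last : flow U V (suc k ℕ.+ k) ≡ V k ℚ.- V (suc k)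
    flow-last rewrite ends-last = refl

    flow-z : ∀ i → flow U V (suc k ℕ.+ (suc k ℕ.+ i)) ≡ V i ℚ.- V (suc i)
    flow-z i rewrite ends-z i = refl

caracolFlow : ∀ k → (ℕ → ℚ) → (ℕ → ℚ) → Fin (length (caracol (2 ℕ.+ k))) → ℚ
caracolFlow k U V e = flow k U V (toℕ e)

at-< : ∀ {n} (b : Fin n → ℚ) (f : ℕ → ℚ) → (∀ e → b e ≡ f (toℕ e)) → ∀ {i} → i < n → at 0ℚ b i ≡ f i
at-< b f eq i<n = trans (cong (at 0ℚ b) (sym (Finₚ.toℕ-fromℕ< i<n)))
  (trans (at-toℕ 0ℚ b _) (trans (eq _) (cong f (Finₚ.toℕ-fromℕ< i<n))))

module _ (k : ℕ) where
  x< : ∀ {i} → i ≤ k → i < length (caracol (2 ℕ.+ k))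
  x< {i} i≤k = subst (i <_) (sym (length-caracol k)) (ℕₚ.≤-trans (s≤s i≤k) (ℕₚ.m≤m+n (suc k) _))

  y< : ∀ {i} → i ≤ k → suc k ℕ.+ i < length (caracol (2 ℕ.+ k))
  y< {i} i≤k = subst (suc k ℕ.+ i <_) (sym (length-caracol k))
    (ℕₚ.+-monoʳ-< (suc k) (ℕₚ.≤-trans (s≤s i≤k) (ℕₚ.m≤m+n (suc k) k)))

  z< : ∀ {i} → i < k → suc k ℕ.+ (suc k ℕ.+ i) < length (caracol (2 ℕ.+ k))
  z< {i} i<k = subst (suc k ℕ.+ (suc k ℕ.+ i) <_) (sym (length-caracol k))
    (ℕₚ.+-monoʳ-< (suc k) (ℕₚ.+-monoʳ-< (suc k) i<k))

  module FlowVertices (U V : ℕ → ℚ) (U-end : U (suc k) ≡ 0ℚ) (V-end : V (suc k) ≡ 0ℚ)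
    (b : Fin (length (caracol (2 ℕ.+ k))) → ℚ) (b≡ : ∀ e → b e ≡ caracolFlow k U V e) where
    open Vertices k b

    private
      x≡ : ∀ {i} → i ≤ k → x i ≡ U i ℚ.- U (suc i)
      x≡ i≤k = trans (at-< b (flow k U V) b≡ (x< i≤k)) (flow-x k i≤k)

      y≡ : ∀ {i} → i < k → y i ≡ V (suc i) ℚ.- U (suc i)
      y≡ i<k = trans (at-< b (flow k U V) b≡ (y< (ℕₚ.<⇒≤ i<k))) (flow-y k i<k)

      last≡ : y k ≡ V k ℚ.- V (suc k)
      last≡ = trans (at-< b (flow k U V) b≡ (y< ℕₚ.≤-refl)) (flow-last k)

      z≡ : ∀ {i} → i < k → z i ≡ V i ℚ.- V (suc i)
      z≡ {i} i<k = trans (at-< b (flow k U V) b≡ (z< i<k)) (flow-z k i)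

      telescope : ∀ n → ∑< n (λ i → U i ℚ.- U (suc i)) ≡ U 0 ℚ.- U n
      telescope zero    = sym (ℚₚ.+-inverseʳ (U 0))
      telescope (suc n) = trans (cong (ℚ._+ (U n ℚ.- U (suc n))) (telescope n)) (cancel (U 0) (U n) (U (suc n)))
        where
        cancel : ∀ a b c → (a ℚ.- b) ℚ.+ (b ℚ.- c) ≡ a ℚ.- c
        cancel = RingSolver.solve-∀ ℚ-ring

      -- The amount supplied at vertex `2 + i`. With it, `V i - U i` is what enters that vertex
      -- apart from the edge from vertex 1; at vertex 2, where no path edge arrives, it is all
      -- supply.
      initial : ℕ → ℚ
      initial zero    = V 0 ℚ.- U 0
      initial (suc i) = 0ℚ

      prev≡ : ∀ i → i ≤ k → prev y i ℚ.+ initial i ≡ V i ℚ.- U i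
      prev≡ zero    _   = ℚₚ.+-identityˡ _
      prev≡ (suc i) i<k = trans (ℚₚ.+-identityʳ (y i)) (y≡ i<k)

      solve-initial : ∀ p i w → p ℚ.+ i ≡ w → i ≡ w ℚ.- p
      solve-initial p i w eq = trans (cancel p i) (cong (ℚ._- p) eq)
        where
        cancel : ∀ p i → i ≡ (p ℚ.+ i) ℚ.- p
        cancel = RingSolver.solve-∀ ℚ-ring

    netflow-source : netflowℚ (caracol (2 ℕ.+ k)) b 1 ≡ U 0
    netflow-source = trans source (trans (∑<-cong (suc k) (λ i i≤k → x≡ (ℕₚ.≤-pred i≤k)))
      (trans (telescope (suc k)) (trans (cong (λ s → U 0 ℚ.- s) U-end) (ℚₚ.+-identityʳ (U 0)))))

    private
      netflow-vertex : ∀ i → i ≤ k → netflowℚ (caracol (2 ℕ.+ k)) b (2 ℕ.+ i) ≡ initial i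
      netflow-vertex i i≤k with i ℕₚ.≟ k
      ... | no i≢k = trans (inner i i<k) (trans
              (cong₂ (λ s t → s ℚ.- (t ℚ.+ prev y i)) (cong₂ ℚ._+_ (y≡ i<k) (z≡ i<k)) (x≡ i≤k))
              (trans (cancel (V i) (V (suc i)) (U i) (U (suc i)) (prev y i))
                     (sym (solve-initial (prev y i) (initial i) _ (prev≡ i i≤k)))))
        where
        i<k = ℕₚ.≤∧≢⇒< i≤k i≢k
        cancel : ∀ v v′ u u′ p → ((v′ ℚ.- u′) ℚ.+ (v ℚ.- v′)) ℚ.- ((u ℚ.- u′) ℚ.+ p) ≡ (v ℚ.- u) ℚ.- p
        cancel = RingSolver.solve-∀ ℚ-ring
      ... | yes refl = trans final (trans
              (cong₂ (λ s t → s ℚ.- (t ℚ.+ prev y k)) (trans last≡ (cong (λ s → V k ℚ.- s) V-end))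
                 (trans (x≡ i≤k) (cong (λ s → U k ℚ.- s) U-end)))
              (trans (cancel (V k) (U k) (prev y k))
                     (sym (solve-initial (prev y k) (initial k) _ (prev≡ k i≤k)))))
        where
        cancel : ∀ v u p → (v ℚ.- 0ℚ) ℚ.- ((u ℚ.- 0ℚ) ℚ.+ p) ≡ (v ℚ.- u) ℚ.- p
        cancel = RingSolver.solve-∀ ℚ-ring

    netflow-second : netflowℚ (caracol (2 ℕ.+ k)) b 2 ≡ V 0 ℚ.- U 0
    netflow-second = netflow-vertex 0 z≤n

    netflow-later : ∀ i → i < k → netflowℚ (caracol (2 ℕ.+ k)) b (3 ℕ.+ i) ≡ 0ℚ
    netflow-later i i<k = netflow-vertex (suc i) i<k

  module Reconstruction (b : Fin (length (caracol (2 ℕ.+ k))) → ℚ)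
    (circulation : ∀ j → j < 2 ℕ.+ k → netflowℚ (caracol (2 ℕ.+ k)) b (suc j) ≡ 0ℚ)
    (U V : ℕ → ℚ) (U-end : U (suc k) ≡ 0ℚ) (V-end : V (suc k) ≡ 0ℚ)
    (V-zero : V 0 ≡ 0ℚ)
    (U≡ : ∀ i → i ≤ k → U i ≡ ℚ.- ∑< i (Vertices.x k b))
    (V≡ : ∀ i → i < k → V (suc i) ≡ Vertices.y k b i ℚ.+ U (suc i)) where
    open Vertices k b

    private
      ∑x≡0 : ∑< (suc k) x ≡ 0ℚ
      ∑x≡0 = trans (sym source) (circulation 0 (s≤s z≤n))

      U≡′ : ∀ i → i ≤ suc k → U i ≡ ℚ.- ∑< i x
      U≡′ i i≤1+k with i ℕₚ.≟ suc k
      ... | yes refl = trans U-end (sym (cong ℚ.-_ ∑x≡0))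
      ... | no  i≢1+k = U≡ i (ℕₚ.≤-pred (ℕₚ.≤∧≢⇒< i≤1+k i≢1+k))

      step : ∀ i → i ≤ k → U i ℚ.- U (suc i) ≡ x i
      step i i≤k = trans (cong₂ ℚ._-_ (U≡′ i (ℕₚ.m≤n⇒m≤1+n i≤k)) (U≡′ (suc i) (s≤s i≤k)))
          (cancel (∑< i x) (x i))
        where
        cancel : ∀ s a → (ℚ.- s) ℚ.- (ℚ.- (s ℚ.+ a)) ≡ a
        cancel = RingSolver.solve-∀ ℚ-ring

      V≡′ : ∀ i → i ≤ k → V i ≡ prev y i ℚ.+ U i
      V≡′ zero    _   = trans V-zero (sym (trans (ℚₚ.+-identityˡ (U 0)) (U≡ 0 z≤n)))
      V≡′ (suc i) i<k = V≡ i i<k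

      move : ∀ {s t} → s ℚ.- t ≡ 0ℚ → s ≡ t
      move {s} {t} eq = trans (cancel s t) (trans (cong (ℚ._+ t) eq) (ℚₚ.+-identityˡ t))
        where
        cancel : ∀ s t → s ≡ (s ℚ.- t) ℚ.+ t
        cancel = RingSolver.solve-∀ ℚ-ring

    -- The first two blocks determine the potentials, the last edge of the first block by
    -- conservation at vertex 1. The last path edge and the third block are then forced by
    -- conservation at the other vertices.
    reconstruct : ∀ e → caracolFlow k U V e ≡ b e
    reconstruct e = trans (positions k (λ p → flow k U V p ≡ at 0ℚ b p) onX onY onLast onZ e) (at-toℕ 0ℚ b e)
      where
      onX : ∀ i → i ≤ k → flow k U V i ≡ x i
      onX i i≤k = trans (flow-x k i≤k) (step i i≤k)

      onY : ∀ i → i < k → flow k U V (suc k ℕ.+ i) ≡ y i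
      onY i i<k = trans (flow-y k i<k) (trans (cong (ℚ._- U (suc i)) (V≡ i i<k)) (cancel (y i) (U (suc i))))
        where
        cancel : ∀ a b → (a ℚ.+ b) ℚ.- b ≡ a
        cancel = RingSolver.solve-∀ ℚ-ring

      onLast : flow k U V (suc k ℕ.+ k) ≡ y k
      onLast = trans (flow-last k) (trans (cong₂ ℚ._-_ (V≡′ k ℕₚ.≤-refl) (trans V-end (sym U-end)))
        (trans (shuffle (prev y k) (U k) (U (suc k)))
        (trans (cong (ℚ._+ prev y k) (step k ℕₚ.≤-refl))
        (sym (move (trans (sym final) (circulation (suc k) ℕₚ.≤-refl)))))))
        where
        shuffle : ∀ p u u′ → (p ℚ.+ u) ℚ.- u′ ≡ (u ℚ.- u′) ℚ.+ p
        shuffle = RingSolver.solve-∀ ℚ-ring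

      onZ : ∀ i → i < k → flow k U V (suc k ℕ.+ (suc k ℕ.+ i)) ≡ z i
      onZ i i<k = trans (flow-z k i) (trans (cong₂ ℚ._-_ (V≡′ i (ℕₚ.<⇒≤ i<k)) (V≡ i i<k))
        (trans (shuffle (prev y i) (U i) (y i) (U (suc i)))
        (trans (cong (λ s → s ℚ.+ prev y i ℚ.- y i) (step i (ℕₚ.<⇒≤ i<k)))
        (trans (cong (ℚ._- y i)
            (sym (move {y i ℚ.+ z i} {x i ℚ.+ prev y i}
                (trans (sym (inner i i<k)) (circulation (suc i) (s≤s (ℕₚ.m≤n⇒m≤1+n i<k)))))))
        (cancel (y i) (z i))))))
        where
        shuffle : ∀ p u a u′ → (p ℚ.+ u) ℚ.- (a ℚ.+ u′) ≡ (u ℚ.- u′) ℚ.+ p ℚ.- a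
        shuffle = RingSolver.solve-∀ ℚ-ring
        cancel : ∀ a b → (a ℚ.+ b) ℚ.- a ≡ b
        cancel = RingSolver.solve-∀ ℚ-ring

-- The lattice coordinates

-- The top of the second sequence is the total supply 1 + 1 of vertices 1 and 2, that of the first
-- sequence the supply of vertex 1 alone.
two : ℚ
two = + 2 / 1

↑-elim : ∀ {m n} (P : Fin (m ℕ.+ n) → Set) → (∀ i → P (i ↑ˡ n)) → (∀ j → P (m ↑ʳ j)) → ∀ i → P i
↑-elim {m} {n} P left right i = subst P (Finₚ.join-splitAt m n i) (go (Fin.splitAt m i))
  where
  go : ∀ s → P (Fin.join m n s)
  go (inj₁ i) = left i
  go (inj₂ j) = right j

module _ (k : ℕ) where
  private
    G = caracol (2 ℕ.+ k)
    d = k ℕ.+ k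

  basisValue : Fin d → Potential → ℤ
  basisValue i = value (pad 0ℤ 0ℤ (λ j → kronecker i (j ↑ˡ k))) (pad 0ℤ 0ℤ (λ j → kronecker i (k ↑ʳ j)))

  basisFlow : Fin d → Fin (length G) → ℤ
  basisFlow i e = basisValue i (highEnd k e) ℤ.- basisValue i (lowEnd k e)
  paddedFlow : ℚ → ℚ → (Fin d → ℚ) → Fin (length G) → ℚ
  paddedFlow s t c = caracolFlow k (pad 0ℚ s (c ∘ (_↑ˡ k))) (pad 0ℚ t (c ∘ (k ↑ʳ_)))

  paddedFlow-cong : ∀ s t {c c′} → (∀ i → c i ≡ c′ i) → ∀ e → paddedFlow s t c e ≡ paddedFlow s t c′ e
  paddedFlow-cong s t eq e = flow-cong k (pad-cong 0ℚ s (λ j → eq (j ↑ˡ k)))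
      (pad-cong 0ℚ t (λ j → eq (k ↑ʳ j))) (toℕ e)

  basisFlow-/1 : ∀ i e → basisFlow i e / 1 ≡ paddedFlow 0ℚ 0ℚ (λ l → kronecker i l / 1) e
  basisFlow-/1 i e = trans (/1-minus (basisValue i (highEnd k e)) (basisValue i (lowEnd k e)))
      (cong₂ ℚ._-_ (eq (highEnd k e)) (eq (lowEnd k e)))
    where
    eq : ∀ p → basisValue i p / 1 ≡ value (pad 0ℚ 0ℚ (λ j → kronecker i (j ↑ˡ k) / 1))
        (pad 0ℚ 0ℚ (λ j → kronecker i (k ↑ʳ j) / 1)) p
    eq = value-map (_/ 1) (pad 0ℤ 0ℤ (λ j → kronecker i (j ↑ˡ k))) (pad 0ℤ 0ℤ (λ j → kronecker i (k ↑ʳ j)))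
           (pad-map (_/ 1) 0ℤ 0ℤ (λ j → kronecker i (j ↑ˡ k)))
               (pad-map (_/ 1) 0ℤ 0ℤ (λ j → kronecker i (k ↑ʳ j)))

  combination : ∀ (c : Fin d → ℚ) e → sumℚ (λ i → c i ℚ.* (basisFlow i e / 1)) ≡ paddedFlow 0ℚ 0ℚ c e
  combination c e = begin
    sumℚ (λ i → c i ℚ.* (basisFlow i e / 1))
      ≡⟨ sumℚ-cong (λ i → cong (c i ℚ.*_) (basisFlow-/1 i e)) ⟩
    sumℚ (λ i → c i ℚ.* (val i (highEnd k e) ℚ.- val i (lowEnd k e)))
      ≡⟨ sumℚ-*-minus c _ _ ⟩
    sumℚ (λ i → c i ℚ.* val i (highEnd k e)) ℚ.- sumℚ (λ i → c i ℚ.* val i (lowEnd k e))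
      ≡⟨ cong₂ ℚ._-_ (eq (highEnd k e)) (eq (lowEnd k e)) ⟩
    paddedFlow 0ℚ 0ℚ c e ∎
    where
    open ≡-Reasoning
    val : Fin d → Potential → ℚ
    val i = value (pad 0ℚ 0ℚ (λ j → kronecker i (j ↑ˡ k) / 1)) (pad 0ℚ 0ℚ (λ j → kronecker i (k ↑ʳ j) / 1))

    along : (inj : Fin k → Fin d) → ∀ n → sumℚ
        (λ i → c i ℚ.* pad 0ℚ 0ℚ (λ j → kronecker i (inj j) / 1) n) ≡ pad 0ℚ 0ℚ (c ∘ inj) n
    along inj n = begin
      sumℚ (λ i → c i ℚ.* pad 0ℚ 0ℚ (λ j → kronecker i (inj j) / 1) n)
        ≡⟨ sumℚ-pad c (λ _ → 0ℚ) (λ i j → kronecker i (inj j) / 1) n ⟩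
      pad 0ℚ (sumℚ (λ i → c i ℚ.* 0ℚ)) (λ j → sumℚ (λ i → c i ℚ.* (kronecker i (inj j) / 1))) n
        ≡⟨ cong (λ t → pad 0ℚ t (λ j → sumℚ (λ i → c i ℚ.* (kronecker i (inj j) / 1))) n)
             (sumℚ-zero _ (λ i → ℚₚ.*-zeroʳ (c i))) ⟩
      pad 0ℚ 0ℚ (λ j → sumℚ (λ i → c i ℚ.* (kronecker i (inj j) / 1))) n
        ≡⟨ pad-cong 0ℚ 0ℚ (λ j → sumℚ-kronecker c (inj j)) n ⟩
      pad 0ℚ 0ℚ (c ∘ inj) n ∎

    eq : ∀ p → sumℚ (λ i → c i ℚ.* val i p) ≡ value (pad 0ℚ 0ℚ (c ∘ (_↑ˡ k))) (pad 0ℚ 0ℚ (c ∘ (k ↑ʳ_))) p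
    eq (inj₁ n) = along (_↑ˡ k) n
    eq (inj₂ n) = along (k ↑ʳ_) n

  integerCombination-/1 : ∀ c e → integerCombination basisFlow c e / 1 ≡ paddedFlow 0ℚ 0ℚ (λ i → c i / 1) e
  integerCombination-/1 c e = trans (sum-homo ℤ.+-0-rawGroup (_/ 1) refl /1-+ (λ i → c i ℤ.* basisFlow i e))
    (trans (sumℚ-cong (λ i → /1-* (c i) (basisFlow i e))) (combination (λ i → c i / 1) e))

  private
    module TopsVertices (s t : ℚ) (c : Fin d → ℚ) = FlowVertices k
      (pad 0ℚ s (c ∘ (_↑ˡ k))) (pad 0ℚ t (c ∘ (k ↑ʳ_))) (pad-end 0ℚ s (c ∘ (_↑ˡ k)))
          (pad-end 0ℚ t (c ∘ (k ↑ʳ_)))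

  netflow-paddedFlow : ∀ c b → (∀ e → b e ≡ paddedFlow 1ℚ two c e) →
                 ∀ (j : Fin (2 ℕ.+ k)) → netflowℚ G b (suc (toℕ j)) ≡ ⟨1,1,0,…,0⟩ (2 ℕ.+ k) j / 1
  netflow-paddedFlow c b eq Fin.zero              = TopsVertices.netflow-source 1ℚ two c b eq
  netflow-paddedFlow c b eq (Fin.suc Fin.zero)    = TopsVertices.netflow-second 1ℚ two c b eq
  netflow-paddedFlow c b eq (Fin.suc (Fin.suc j)) = TopsVertices.netflow-later 1ℚ two c b eq (toℕ j)
      (Finₚ.toℕ<n j)

  hasNetflow : ∀ b (c : ℕ → Fin d → ℚ) → (∀ e m → seq (b e) m ≡ paddedFlow 1ℚ two (c m) e) →
               HasNetflow G (⟨1,1,0,…,0⟩ (2 ℕ.+ k)) b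
  hasNetflow b c eq j = ≡⇒≈ᴿ {netflowᴿ G b (suc (toℕ j))} {fromℤ (⟨1,1,0,…,0⟩ (2 ℕ.+ k) j)} λ m →
    trans (netflow-seq G b (suc (toℕ j)) m) (netflow-paddedFlow (c m) (λ e → seq (b e) m) (λ e → eq e m) j)

  basisFlow-circulation : ∀ i → Circulation (2 ℕ.+ k) G (basisFlow i)
  basisFlow-circulation i j = /1-injective (trans (netflow-/1 G (basisFlow i) (suc (toℕ j))) (zero-netflow j))
    where
    zero-netflow : ∀ (j : Fin (2 ℕ.+ k)) → netflowℚ G (λ e → basisFlow i e / 1) (suc (toℕ j)) ≡ 0ℚ
    zero-netflow Fin.zero              = TopsVertices.netflow-source 0ℚ 0ℚ (λ l → kronecker i l / 1) _
        (basisFlow-/1 i)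
    zero-netflow (Fin.suc Fin.zero)    = TopsVertices.netflow-second 0ℚ 0ℚ (λ l → kronecker i l / 1) _
        (basisFlow-/1 i)
    zero-netflow (Fin.suc (Fin.suc j)) = TopsVertices.netflow-later 0ℚ 0ℚ (λ l → kronecker i l / 1) _
        (basisFlow-/1 i) (toℕ j) (Finₚ.toℕ<n j)

  private
    module Span (z : Fin (length G) → ℤ) (circ : Circulation (2 ℕ.+ k) G z) where
      ∑ᶻ : ℕ → ℤ
      ∑ᶻ zero    = 0ℤ
      ∑ᶻ (suc n) = ∑ᶻ n ℤ.+ at 0ℤ z n

      -- The potentials are recovered from the edge values by sums and differences only. This is the
      -- unimodularity: an integer circulation has integer coordinates.
      u v : Fin k → ℤ
      u j = ℤ.- ∑ᶻ (suc (toℕ j))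
      v j = at 0ℤ z (suc k ℕ.+ toℕ j) ℤ.+ u j

      c : Fin d → ℤ
      c i = [ u , v ]′ (Fin.splitAt k i)

      b : Fin (length G) → ℚ
      b e = z e / 1

      U V : ℕ → ℚ
      U = pad 0ℚ 0ℚ (λ j → c (j ↑ˡ k) / 1)
      V = pad 0ℚ 0ℚ (λ j → c (k ↑ʳ j) / 1)

      open Vertices k b using (x; y)

      ∑ᶻ-/1 : ∀ n → ∑ᶻ n / 1 ≡ ∑< n x
      ∑ᶻ-/1 zero    = refl
      ∑ᶻ-/1 (suc n) = trans (/1-+ (∑ᶻ n) (at 0ℤ z n)) (cong₂ ℚ._+_ (∑ᶻ-/1 n) (at-map (_/ 1) 0ℤ z n))

      U-suc : ∀ j → U (suc (toℕ j)) ≡ ℚ.- ∑< (suc (toℕ j)) x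
      U-suc j = begin
        U (suc (toℕ j))                     ≡⟨ pad-suc-toℕ 0ℚ 0ℚ (λ j → c (j ↑ˡ k) / 1) j ⟩
        c (j ↑ˡ k) / 1                      ≡⟨ cong (λ s → [ u , v ]′ s / 1) (Finₚ.splitAt-↑ˡ k j k) ⟩
        (ℤ.- ∑ᶻ (suc (toℕ j))) / 1          ≡⟨ /1-neg (∑ᶻ (suc (toℕ j))) ⟩
        ℚ.- (∑ᶻ (suc (toℕ j)) / 1)          ≡⟨ cong ℚ.-_ (∑ᶻ-/1 (suc (toℕ j))) ⟩
        ℚ.- ∑< (suc (toℕ j)) x ∎
        where open ≡-Reasoning

      V-suc : ∀ j → V (suc (toℕ j)) ≡ y (toℕ j) ℚ.+ U (suc (toℕ j))
      V-suc j = begin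
        V (suc (toℕ j))                     ≡⟨ pad-suc-toℕ 0ℚ 0ℚ (λ j → c (k ↑ʳ j) / 1) j ⟩
        c (k ↑ʳ j) / 1                      ≡⟨ cong (λ s → [ u , v ]′ s / 1) (Finₚ.splitAt-↑ʳ k k j) ⟩
        v j / 1                             ≡⟨ /1-+ (at 0ℤ z (suc k ℕ.+ toℕ j)) (u j) ⟩
        at 0ℤ z (suc k ℕ.+ toℕ j) / 1 ℚ.+ u j / 1
          ≡⟨ cong₂ ℚ._+_ (at-map (_/ 1) 0ℤ z (suc k ℕ.+ toℕ j))
               (trans (/1-neg (∑ᶻ (suc (toℕ j)))) (cong ℚ.-_ (∑ᶻ-/1 (suc (toℕ j))))) ⟩
        y (toℕ j) ℚ.+ (ℚ.- ∑< (suc (toℕ j)) x)   ≡⟨ cong (y (toℕ j) ℚ.+_) (U-suc j) ⟨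
        y (toℕ j) ℚ.+ U (suc (toℕ j)) ∎
        where open ≡-Reasoning

      U≡ : ∀ i → i ≤ k → U i ≡ ℚ.- ∑< i x
      U≡ zero    _   = refl
      U≡ (suc i) i<k = subst (λ i → U (suc i) ≡ ℚ.- ∑< (suc i) x) (Finₚ.toℕ-fromℕ< i<k) (U-suc (Fin.fromℕ< i<k))

      V≡ : ∀ i → i < k → V (suc i) ≡ y i ℚ.+ U (suc i)
      V≡ i i<k = subst (λ i → V (suc i) ≡ y i ℚ.+ U (suc i)) (Finₚ.toℕ-fromℕ< i<k) (V-suc (Fin.fromℕ< i<k))

      circulation : ∀ j → j < 2 ℕ.+ k → netflowℚ G b (suc j) ≡ 0ℚ
      circulation j j<n = subst (λ j → netflowℚ G b (suc j) ≡ 0ℚ) (Finₚ.toℕ-fromℕ< j<n)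
        (trans (sym (netflow-/1 G z (suc (toℕ (Fin.fromℕ< j<n))))) (cong (_/ 1) (circ (Fin.fromℕ< j<n))))

      spanned : ∀ e → integerCombination basisFlow c e ≡ z e
      spanned e = /1-injective (trans (integerCombination-/1 c e)
        (Reconstruction.reconstruct k b circulation U V (pad-end 0ℚ 0ℚ (λ j → c (j ↑ˡ k) / 1))
            (pad-end 0ℚ 0ℚ (λ j → c (k ↑ʳ j) / 1)) refl U≡ V≡ e))

    module Independent (c : Fin d → ℤ) (vanish : ∀ e → integerCombination basisFlow c e ≡ 0ℤ) where
      U V : ℕ → ℚ
      U = pad 0ℚ 0ℚ (λ j → c (j ↑ˡ k) / 1)
      V = pad 0ℚ 0ℚ (λ j → c (k ↑ʳ j) / 1)

      flow≡0 : ∀ {p} → p < length G → flow k U V p ≡ 0ℚ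
      flow≡0 p<n = subst (λ p → flow k U V p ≡ 0ℚ) (Finₚ.toℕ-fromℕ< p<n)
        (trans (sym (integerCombination-/1 c (Fin.fromℕ< p<n))) (cong (_/ 1) (vanish (Fin.fromℕ< p<n))))

      difference : ∀ {s t} → s ℚ.- t ≡ 0ℚ → s ≡ t
      difference {s} {t} eq = trans (cancel s t) (trans (cong (ℚ._+ t) eq) (ℚₚ.+-identityˡ t))
        where
        cancel : ∀ s t → s ≡ (s ℚ.- t) ℚ.+ t
        cancel = RingSolver.solve-∀ ℚ-ring

      -- Vanishing on the first block keeps `U` at its top value 0, and vanishing on the path edges
      -- then forces `V` to agree with `U`.
      U≡0 : ∀ i → i ≤ k → U i ≡ 0ℚ
      U≡0 zero    _   = refl
      U≡0 (suc i) i<k = trans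
          (sym (difference (trans (sym (flow-x k (ℕₚ.<⇒≤ i<k))) (flow≡0 (x< k (ℕₚ.<⇒≤ i<k))))))
              (U≡0 i (ℕₚ.<⇒≤ i<k))

      V≡0 : ∀ i → i < k → V (suc i) ≡ 0ℚ
      V≡0 i i<k = trans (difference (trans (sym (flow-y k i<k)) (flow≡0 (y< k (ℕₚ.<⇒≤ i<k))))) (U≡0 (suc i) i<k)

      c≡0 : ∀ i → c i ≡ 0ℤ
      c≡0 = ↑-elim _
        (λ j → /1-injective (trans (sym (pad-suc-toℕ 0ℚ 0ℚ _ j)) (U≡0 (suc (toℕ j)) (Finₚ.toℕ<n j))))
        (λ j → /1-injective (trans (sym (pad-suc-toℕ 0ℚ 0ℚ _ j)) (V≡0 (toℕ j) (Finₚ.toℕ<n j))))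

  frame : Frame G (⟨1,1,0,…,0⟩ (2 ℕ.+ k)) d
  frame = record
    -- All free potentials are 0 at the origin, so the coordinates of a point are its potentials,
    -- without a shift.
    { origin      = λ e → fromℚ (paddedFlow 1ℚ two (λ _ → 0ℚ) e)
    ; origin∈     = hasNetflow (λ e → fromℚ (paddedFlow 1ℚ two (λ _ → 0ℚ) e)) (λ _ _ → 0ℚ) (λ _ _ → refl)
    ; basis       = basisFlow
    ; basis∈      = basisFlow-circulation
    ; spanning    = λ z circ → Span.c z circ , Span.spanned z circ
    ; independent = Independent.c≡0
    }

  seq-point : ∀ x e m → seq (Frame.point frame x e) m ≡ paddedFlow 1ℚ two (λ i → seq (x i) m) e
  seq-point x e m = begin
    paddedFlow 1ℚ two (λ _ → 0ℚ) e ℚ.+ seq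
        (sumᴹ (RawGroup.rawMonoid +-0-rawGroupᴿ) (λ i → (basisFlow i e / 1) ·ᴿ x i)) m
      ≡⟨ cong (paddedFlow 1ℚ two (λ _ → 0ℚ) e ℚ.+_) (begin
           seq (sumᴹ (RawGroup.rawMonoid +-0-rawGroupᴿ) (λ i → (basisFlow i e / 1) ·ᴿ x i)) m
             ≡⟨ sum-homo +-0-rawGroupᴿ (λ r → seq r m) refl (λ _ _ → refl) (λ i → (basisFlow i e / 1) ·ᴿ x i) ⟩
           sumℚ (λ i → (basisFlow i e / 1) ℚ.* seq (x i) m)
             ≡⟨ sumℚ-cong (λ i → ℚₚ.*-comm (basisFlow i e / 1) (seq (x i) m)) ⟩
           sumℚ (λ i → seq (x i) m ℚ.* (basisFlow i e / 1))
             ≡⟨ combination (λ i → seq (x i) m) e ⟩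
           paddedFlow 0ℚ 0ℚ (λ i → seq (x i) m) e ∎) ⟩
    paddedFlow 1ℚ two (λ _ → 0ℚ) e ℚ.+ paddedFlow 0ℚ 0ℚ (λ i → seq (x i) m) e
      ≡⟨ regroup (left (highEnd k e)) (left (lowEnd k e)) (right (highEnd k e)) (right (lowEnd k e)) ⟩
    (left (highEnd k e) ℚ.+ right (highEnd k e))
      ℚ.- (left (lowEnd k e) ℚ.+ right (lowEnd k e))
      ≡⟨ cong₂ ℚ._-_ (add (highEnd k e)) (add (lowEnd k e)) ⟩
    paddedFlow 1ℚ two (λ i → 0ℚ ℚ.+ seq (x i) m) e
      ≡⟨ paddedFlow-cong 1ℚ two (λ i → ℚₚ.+-identityˡ (seq (x i) m)) e ⟩
    paddedFlow 1ℚ two (λ i → seq (x i) m) e ∎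
    where
    open ≡-Reasoning
    left right : Potential → ℚ
    left  = value (pad 0ℚ 1ℚ {k} (λ _ → 0ℚ)) (pad 0ℚ two {k} (λ _ → 0ℚ))
    right = value (pad 0ℚ 0ℚ (λ j → seq (x (j ↑ˡ k)) m)) (pad 0ℚ 0ℚ (λ j → seq (x (k ↑ʳ j)) m))

    regroup : ∀ a b c d → (a ℚ.- b) ℚ.+ (c ℚ.- d) ≡ (a ℚ.+ c) ℚ.- (b ℚ.+ d)
    regroup = RingSolver.solve-∀ ℚ-ring

    add : ∀ p → left p ℚ.+ right p ≡ value (pad 0ℚ 1ℚ (λ j → 0ℚ ℚ.+ seq (x (j ↑ˡ k)) m))
        (pad 0ℚ two (λ j → 0ℚ ℚ.+ seq (x (k ↑ʳ j)) m)) p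
    add (inj₁ i) = trans (pad-+ 1ℚ 0ℚ (λ _ → 0ℚ) (λ j → seq (x (j ↑ˡ k)) m) i) refl
    add (inj₂ i) = trans (pad-+ two 0ℚ (λ _ → 0ℚ) (λ j → seq (x (k ↑ʳ j)) m) i) refl

-- The polytope in coordinates, and cells inside it

padᴿ : ℝ → ∀ {n} → (Fin n → ℝ) → ℕ → ℝ
padᴿ = pad (fromℚ 0ℚ)

Antitone : ℝ → ∀ {n} → (Fin n → ℝ) → Set
Antitone t {n} u = ∀ i → i ≤ n → padᴿ t u (suc i) ≤ᴿ padᴿ t u i

antitone-tail : ∀ {t n} {u : Fin (suc n) → ℝ} → Antitone t u → Antitone (u Fin.zero) (u ∘ Fin.suc)
antitone-tail anti i i≤n = anti (suc i) (s≤s i≤n)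

antitone-≤ : ∀ {t n} {u : Fin n → ℝ} → Antitone t u → ∀ i → u i ≤ᴿ t
antitone-≤ anti Fin.zero = anti 0 z≤n
antitone-≤ {t} {suc n} {u} anti (Fin.suc i) = ≤ᴿ-trans {u (Fin.suc i)} {u Fin.zero} {t}
  (antitone-≤ {u Fin.zero} {n} {u ∘ Fin.suc} (antitone-tail {t} {n} {u} anti) i) (anti 0 z≤n)

antitone-top : ∀ {t n} {u : Fin n → ℝ} → Antitone t u → fromℚ 0ℚ ≤ᴿ t
antitone-top {t} {zero}  anti = anti 0 z≤n
antitone-top {t} {suc n} {u} anti = ≤ᴿ-trans {fromℚ 0ℚ} {u Fin.zero} {t}
  (antitone-top {u Fin.zero} {n} {u ∘ Fin.suc} (antitone-tail {t} {n} {u} anti)) (anti 0 z≤n)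

antitone-0≤ : ∀ {t n} {u : Fin n → ℝ} → Antitone t u → ∀ i → fromℚ 0ℚ ≤ᴿ u i
antitone-0≤ {t} {suc n} {u} anti Fin.zero = antitone-top {u Fin.zero} {n} {u ∘ Fin.suc}
    (antitone-tail {t} {n} {u} anti)
antitone-0≤ {t} {suc n} {u} anti (Fin.suc i) = antitone-0≤ {u Fin.zero} {n} {u ∘ Fin.suc}
    (antitone-tail {t} {n} {u} anti) i

module _ (k : ℕ) where
  private
    G = caracol (2 ℕ.+ k)
    d = k ℕ.+ k

  Region : (Fin d → ℝ) → Set
  Region x = Antitone (fromℚ 1ℚ) (x ∘ (_↑ˡ k)) × Antitone (fromℚ two) (x ∘ (k ↑ʳ_))
           × (∀ j → x (j ↑ˡ k) ≤ᴿ x (k ↑ʳ j))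

  private
    module Values (x : Fin d → ℝ) where
      U V : ℕ → ℝ
      U = padᴿ (fromℚ 1ℚ) (x ∘ (_↑ˡ k))
      V = padᴿ (fromℚ two) (x ∘ (k ↑ʳ_))

      from to : ℕ → ℝ
      from p = value U V (proj₁ (ends k p))
      to   p = value U V (proj₂ (ends k p))

      seq-difference : ∀ e m → seq (Frame.point (frame k) x e) m ≡ seq (from (toℕ e)) m ℚ.- seq (to (toℕ e)) m
      seq-difference e m = trans (seq-point k x e m) (sym (cong₂ ℚ._-_ (eq (highEnd k e)) (eq (lowEnd k e))))
        where
        eq : ∀ p → seq (value U V p) m ≡ value
               (pad 0ℚ 1ℚ (λ j → seq (x (j ↑ˡ k)) m)) (pad 0ℚ two (λ j → seq (x (k ↑ʳ j)) m)) p
        eq = value-map (λ r → seq r m) U V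
               (pad-map (λ r → seq r m) (fromℚ 0ℚ) (fromℚ 1ℚ) (x ∘ (_↑ˡ k)))
               (pad-map (λ r → seq r m) (fromℚ 0ℚ) (fromℚ two) (x ∘ (k ↑ʳ_)))

      U-suc : ∀ j → U (suc (toℕ j)) ≡ x (j ↑ˡ k)
      U-suc = pad-suc-toℕ (fromℚ 0ℚ) (fromℚ 1ℚ) (x ∘ (_↑ˡ k))

      V-suc : ∀ j → V (suc (toℕ j)) ≡ x (k ↑ʳ j)
      V-suc = pad-suc-toℕ (fromℚ 0ℚ) (fromℚ two) (x ∘ (k ↑ʳ_))

  region⇒polytope : ∀ x → Region x → Frame.point (frame k) x ∈ FlowPolytope G (⟨1,1,0,…,0⟩ (2 ℕ.+ k))
  region⇒polytope x (antiU , antiV , u≤v) =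
    (λ e → ≤ᴿ⇒0≤- {to (toℕ e)} {from (toℕ e)} {Frame.point (frame k) x e} (seq-difference e)
      (positions k (λ p → to p ≤ᴿ from p) onX onY onLast onZ e)) ,
    hasNetflow k (Frame.point (frame k) x) (λ m i → seq (x i) m) (seq-point k x)
    where
    open Values x
    transport : ∀ p {q} → ends k p ≡ q → value U V (proj₂ q) ≤ᴿ value U V (proj₁ q) → to p ≤ᴿ from p
    transport p eq = subst (λ q → value U V (proj₂ q) ≤ᴿ value U V (proj₁ q)) (sym eq)

    onX : ∀ i → i ≤ k → to i ≤ᴿ from i
    onX i i≤k = transport i (ends-x k i≤k) (antiU i i≤k)

    onY : ∀ i → i < k → to (suc k ℕ.+ i) ≤ᴿ from (suc k ℕ.+ i)
    onY i i<k = transport (suc k ℕ.+ i) (ends-y k i<k)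
        (subst (λ i → U (suc i) ≤ᴿ V (suc i)) (Finₚ.toℕ-fromℕ< i<k)
      (subst₂ _≤ᴿ_ (sym (U-suc (Fin.fromℕ< i<k))) (sym (V-suc (Fin.fromℕ< i<k))) (u≤v (Fin.fromℕ< i<k))))

    onLast : to (suc k ℕ.+ k) ≤ᴿ from (suc k ℕ.+ k)
    onLast = transport (suc k ℕ.+ k) (ends-last k) (antiV k ℕₚ.≤-refl)

    onZ : ∀ i → i < k → to (suc k ℕ.+ (suc k ℕ.+ i)) ≤ᴿ from (suc k ℕ.+ (suc k ℕ.+ i))
    onZ i i<k = transport (suc k ℕ.+ (suc k ℕ.+ i)) (ends-z k i) (antiV i (ℕₚ.<⇒≤ i<k))

  polytope⇒region : ∀ x → Frame.point (frame k) x ∈ FlowPolytope G (⟨1,1,0,…,0⟩ (2 ℕ.+ k)) → Region x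
  polytope⇒region x (0≤point , _) = antiU , antiV , u≤v
    where
    open Values x
    to≤from : ∀ e → to (toℕ e) ≤ᴿ from (toℕ e)
    to≤from e = 0≤-⇒≤ᴿ {to (toℕ e)} {from (toℕ e)} {Frame.point (frame k) x e} (seq-difference e) (0≤point e)

    ordered : ∀ p q → p < length G → ends k p ≡ q → value U V (proj₂ q) ≤ᴿ value U V (proj₁ q)
    ordered p q p<n eq = subst (λ q → value U V (proj₂ q) ≤ᴿ value U V (proj₁ q)) eq
      (subst (λ p → to p ≤ᴿ from p) (Finₚ.toℕ-fromℕ< p<n) (to≤from (Fin.fromℕ< p<n)))

    antiU : Antitone (fromℚ 1ℚ) (x ∘ (_↑ˡ k))
    antiU i i≤k = ordered i (xEnds k i) (x< k i≤k) (ends-x k i≤k)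

    antiV : Antitone (fromℚ two) (x ∘ (k ↑ʳ_))
    antiV i i≤k = cases (i ℕₚ.≟ k)
      where
      cases : Dec (i ≡ k) → V (suc i) ≤ᴿ V i
      -- The lowest step of the second sequence is read off the last path edge, all others off the
      -- third block.
      cases (yes refl) = ordered (suc k ℕ.+ k) (zEnds k k) (y< k ℕₚ.≤-refl) (ends-last k)
      cases (no  i≢k)  = ordered (suc k ℕ.+ (suc k ℕ.+ i)) (zEnds k i) (z< k (ℕₚ.≤∧≢⇒< i≤k i≢k)) (ends-z k i)

    u≤v : ∀ j → x (j ↑ˡ k) ≤ᴿ x (k ↑ʳ j)
    u≤v j = subst₂ _≤ᴿ_ (U-suc j) (V-suc j)
        (ordered (suc k ℕ.+ toℕ j) (inj₂ (suc (toℕ j)) , inj₁ (suc (toℕ j))) (y< k (ℕₚ.<⇒≤ (Finₚ.toℕ<n j)))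
            (ends-y k (Finₚ.toℕ<n j)))

InCell : ℚ → ℚ → ℕ → ℝ → Set
InCell h w c x = fromℚ (ι c ℚ.* h) ≤ᴿ x × x ≤ᴿ fromℚ (ι c ℚ.* h ℚ.+ w)

InCube : ℚ → ℚ → ∀ {a b} → Corner a b → (Fin a → ℝ) → (Fin b → ℝ) → Set
InCube h w (c , c′) u v = (∀ i → InCell h w (c i) (u i)) × (∀ j → InCell h w (c′ j) (v j))

-- Both sequences are matched from their last entries.
Aligned : ∀ a b → (Fin a → ℝ) → (Fin b → ℝ) → Set
Aligned a b u v = ∀ i j → toℕ i ℕ.+ b ≡ toℕ j ℕ.+ a → u i ≤ᴿ v j

All-guard : {P A : Set} {Q : A → Set} (d : Dec P) {xs : List A} → (P → All Q xs) → All Q (guard d xs)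
All-guard (yes p) all = all p
All-guard (no _)  all = All.[]

AllPairs-guard : {P A : Set} {R : A → A → Set} (d : Dec P) {xs : List A} → AllPairs R xs → AllPairs R
    (guard d xs)
AllPairs-guard (yes p) all = all
AllPairs-guard (no _)  all = AllPairs.[]

ι-suc-* : ∀ n h → ι (suc n) ℚ.* h ≡ ι n ℚ.* h ℚ.+ h
ι-suc-* n h = trans (cong (ℚ._* h) (ι-+ 1 n)) (identity (ι n) h)
  where
  identity : ∀ x h → (1ℚ ℚ.+ x) ℚ.* h ≡ x ℚ.* h ℚ.+ h
  identity = RingSolver.solve-∀ ℚ-ring

module Inner (M : ℕ) (h : ℚ) (0≤h : 0ℚ ℚ.≤ h) where
  open Corners (λ _ s → s) M

  ι*-mono : ∀ {m n} → m ≤ n → ι m ℚ.* h ℚ.≤ ι n ℚ.* h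
  ι*-mono m≤n = ℚₚ.*-monoʳ-≤-nonNeg h {{ℚ.nonNegative 0≤h}} (ι-mono m≤n)

  -- The tops `t` range over all reals at or above the current level, so that the next higher entry
  -- of the same sequence can later be inserted for `t`. The minimum with `M` records that u's start
  -- below level `M`; at the end of the sweep it turns the bound into 1.
  Ordered : ∀ a b → ℕ → Corner a b → Set
  Ordered a b s c = ∀ u v → InCube h h c u v →
      (∀ t → fromℚ (ι (s ℕ.⊓ M) ℚ.* h) ≤ᴿ t → Antitone t u)
    × (∀ t → fromℚ (ι s ℚ.* h) ≤ᴿ t → Antitone t v)
    × Aligned a b u v

  private
    0≤ : ∀ {t} → fromℚ (ι 0 ℚ.* h) ≤ᴿ t → fromℚ 0ℚ ≤ᴿ t
    0≤ {t} = subst (λ q → fromℚ q ≤ᴿ t) (ℚₚ.*-zeroˡ h)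

    lower : ∀ {m n t} → m ≤ n → fromℚ (ι n ℚ.* h) ≤ᴿ t → fromℚ (ι m ℚ.* h) ≤ᴿ t
    lower {m} {n} {t} m≤n = ≤ᴿ-trans {fromℚ (ι m ℚ.* h)} {fromℚ (ι n ℚ.* h)} {t} (fromℚ-mono (ι*-mono m≤n))

    head-≤ : ∀ {n x t} → x ≤ᴿ fromℚ (ι n ℚ.* h ℚ.+ h) → fromℚ (ι (suc n) ℚ.* h) ≤ᴿ t → x ≤ᴿ t
    head-≤ {n} {x} {t} x≤ ≤t = ≤ᴿ-trans {x} {fromℚ (ι (suc n) ℚ.* h)} {t}
      (subst (λ q → x ≤ᴿ fromℚ q) (sym (ι-suc-* n h)) x≤) ≤t

    antitone-∷ : ∀ {t n} {u : Fin (suc n) → ℝ} → u Fin.zero ≤ᴿ t →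
                 Antitone (u Fin.zero) (u ∘ Fin.suc) → Antitone t u
    antitone-∷ u₀≤t anti zero    _         = u₀≤t
    antitone-∷ u₀≤t anti (suc i) (s≤s i≤n) = anti i i≤n

    empty : ∀ {t} {u : Fin 0 → ℝ} → fromℚ 0ℚ ≤ᴿ t → Antitone t u
    empty 0≤t zero    _ = 0≤t
    empty 0≤t (suc i) ()

    weaken : ∀ {a b s} {c : Corner a b} → Ordered a b s c → Ordered a b (suc s) c
    weaken {s = s} ord u v inC =
        (λ t le → proj₁ (ord u v inC) t (lower {t = t} (ℕₚ.⊓-monoˡ-≤ M (ℕₚ.n≤1+n s)) le))
      , (λ t le → proj₁ (proj₂ (ord u v inC)) t (lower {t = t} (ℕₚ.n≤1+n s) le))
      , proj₂ (proj₂ (ord u v inC))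

    pushˡ : ∀ {a b s} {c : Corner a b} → s < M → b ≤ a → Ordered a b s c → Ordered (suc a) b (suc s) (consˡ s c)
    pushˡ {a} {b} {s} s<M b≤a ord u v (inU , inV) =
        (λ t le → antitone-∷ {t} {a} {u} (head-≤ {s} {u Fin.zero} {t} (proj₂ (inU Fin.zero))
                    (subst (λ m → fromℚ (ι m ℚ.* h) ≤ᴿ t) (ℕₚ.m≤n⇒m⊓n≡m s<M) le))
                  (proj₁ rest (u Fin.zero) (lower {t = u Fin.zero} (ℕₚ.m⊓n≤m s M) (proj₁ (inU Fin.zero)))))
      , (λ t le → proj₁ (proj₂ rest) t (lower {t = t} (ℕₚ.n≤1+n s) le))
      , aligned
      where
      rest = ord (u ∘ Fin.suc) v ((inU ∘ Fin.suc) , inV)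
      aligned : Aligned (suc a) b u v
      -- The partner of the new u is not among the remaining v's: it was placed before, at a higher
      -- level.
      aligned Fin.zero    j eq = contradiction (subst (_≤ a) eq b≤a)
        (ℕₚ.<⇒≱ (ℕₚ.m≤n+m (suc a) (toℕ j)))
      aligned (Fin.suc i) j eq = proj₂ (proj₂ rest) i j (ℕₚ.suc-injective (trans eq (ℕₚ.+-suc (toℕ j) a)))

    pushʳ : ∀ {a b s} {c : Corner a b} → Ordered a b s c → Ordered a (suc b) (suc s) (consʳ s c)
    pushʳ {a} {b} {s} ord u v (inU , inV) =
        (λ t le → proj₁ rest t (lower {t = t} (ℕₚ.⊓-monoˡ-≤ M (ℕₚ.n≤1+n s)) le))
      , (λ t le → antitone-∷ {t} {b} {v} (head-≤ {s} {v Fin.zero} {t} (proj₂ (inV Fin.zero)) le)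
                  (proj₁ (proj₂ rest) (v Fin.zero) (proj₁ (inV Fin.zero))))
      , aligned
      where
      rest = ord u (v ∘ Fin.suc) (inU , (inV ∘ Fin.suc))
      aligned : Aligned a (suc b) u v
      -- The new v lies above every remaining u, in particular above its partner.
      aligned i Fin.zero    eq = antitone-≤ {v Fin.zero} {a} {u}
        (proj₁ rest (v Fin.zero) (lower {t = v Fin.zero} (ℕₚ.m⊓n≤m s M) (proj₁ (inV Fin.zero)))) i
      aligned i (Fin.suc j) eq = proj₂ (proj₂ rest) i j (ℕₚ.suc-injective (trans (sym (ℕₚ.+-suc (toℕ i) b)) eq))

  corners-ordered : ∀ a b s → All (Ordered a b s) (corners a b s)
  corners-ordered zero zero zero =
    (λ u v _ → (λ t le → empty {t} {u} (0≤ {t} le)) , (λ t le → empty {t} {v} (0≤ {t} le)) , λ ()) All.∷ All.[]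
  corners-ordered zero    (suc b) zero = All.[]
  corners-ordered (suc a) b       zero = All.[]
  corners-ordered zero zero (suc s) =
    Allₚ.++⁺ (All.map (λ {c} → weaken {c = c}) (corners-ordered zero zero s)) All.[]
  corners-ordered zero (suc b) (suc s) =
    Allₚ.++⁺ (All.map (λ {c} → weaken {c = c}) (corners-ordered zero (suc b) s))
             (Allₚ.map⁺ (All.map (λ {c} → pushʳ {c = c}) (corners-ordered zero b s)))
  corners-ordered (suc a) b (suc s) =
    Allₚ.++⁺ (All.map (λ {c} → weaken {c = c}) (corners-ordered (suc a) b s))
      (Allₚ.++⁺
        (All-guard (s ℕₚ.<? M) λ s<M → All-guard (b ℕₚ.≤? a) λ b≤a →
          Allₚ.map⁺ (All.map (λ {c} → pushˡ {c = c} s<M b≤a) (corners-ordered a b s)))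
        (onTakeʳ b))
    where
    onTakeʳ : ∀ b → All (Ordered (suc a) b (suc s)) (takeʳ (suc a) b s)
    onTakeʳ zero    = All.[]
    onTakeʳ (suc b) = Allₚ.map⁺ (All.map (λ {c} → pushʳ {c = c}) (corners-ordered (suc a) b s))

  Bounded : ∀ {a b} → ℕ → Corner a b → Set
  Bounded s (c , c′) = (∀ i → c i < s) × (∀ j → c′ j < s)

  private
    weakenᵇ : ∀ {a b s} {c : Corner a b} → Bounded s c → Bounded (suc s) c
    weakenᵇ (p , q) = (λ i → ℕₚ.m≤n⇒m≤1+n (p i)) , (λ j → ℕₚ.m≤n⇒m≤1+n (q j))

    pushˡᵇ : ∀ {a b s} {c : Corner a b} → Bounded s c → Bounded (suc s) (consˡ s c)
    pushˡᵇ {s = s} {c} bd =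
        (λ { Fin.zero → ℕₚ.n<1+n s ; (Fin.suc i) → proj₁ (weakenᵇ {c = c} bd) i }) , proj₂ (weakenᵇ {c = c} bd)

    pushʳᵇ : ∀ {a b s} {c : Corner a b} → Bounded s c → Bounded (suc s) (consʳ s c)
    pushʳᵇ {s = s} {c} bd = proj₁ (weakenᵇ {c = c} bd) ,
        (λ { Fin.zero → ℕₚ.n<1+n s ; (Fin.suc i) → proj₂ (weakenᵇ {c = c} bd) i })

  corners-bounded : ∀ a b s → All (Bounded s) (corners a b s)
  corners-bounded zero zero zero = ((λ ()) , (λ ())) All.∷ All.[]
  corners-bounded zero    (suc b) zero = All.[]
  corners-bounded (suc a) b       zero = All.[]
  corners-bounded zero zero (suc s) =
    Allₚ.++⁺ (All.map (λ {c} → weakenᵇ {c = c}) (corners-bounded zero zero s)) All.[]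
  corners-bounded zero (suc b) (suc s) =
    Allₚ.++⁺ (All.map (λ {c} → weakenᵇ {c = c}) (corners-bounded zero (suc b) s))
             (Allₚ.map⁺ (All.map (λ {c} → pushʳᵇ {c = c}) (corners-bounded zero b s)))
  corners-bounded (suc a) b (suc s) =
    Allₚ.++⁺ (All.map (λ {c} → weakenᵇ {c = c}) (corners-bounded (suc a) b s))
      (Allₚ.++⁺
        (All-guard (s ℕₚ.<? M) λ _ → All-guard (b ℕₚ.≤? a) λ _ →
          Allₚ.map⁺ (All.map (λ {c} → pushˡᵇ {c = c}) (corners-bounded a b s)))
        (onTakeʳ b))
    where
    onTakeʳ : ∀ b → All (Bounded (suc s)) (takeʳ (suc a) b s)
    onTakeʳ zero    = All.[]
    onTakeʳ (suc b) = Allₚ.map⁺ (All.map (λ {c} → pushʳᵇ {c = c}) (corners-bounded (suc a) b s))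

  Separated : ∀ {a b} → Corner a b → Corner a b → Set
  Separated (c , c′) (e , e′) =
    (∃ λ i → c i < e i ⊎ e i < c i) ⊎ (∃ λ j → c′ j < e′ j ⊎ e′ j < c′ j)

  private
    cross : {A : Set} {P Q : A → Set} {R : A → A → Set} {xs ys : List A} →
            (∀ {x y} → P x → Q y → R x y) → All P xs → All Q ys → All (λ x → All (R x) ys) xs
    cross r ps qs = All.map (λ p → All.map (r p) qs) ps

    separated-consˡ : ∀ {a b s} {c e : Corner a b} → Separated c e → Separated (consˡ s c) (consˡ s e)
    separated-consˡ (inj₁ (i , lt)) = inj₁ (Fin.suc i , lt)
    separated-consˡ (inj₂ (j , lt)) = inj₂ (j , lt)

    separated-consʳ : ∀ {a b s} {c e : Corner a b} → Separated c e → Separated (consʳ s c) (consʳ s e)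
    separated-consʳ (inj₁ (i , lt)) = inj₁ (i , lt)
    separated-consʳ (inj₂ (j , lt)) = inj₂ (Fin.suc j , lt)

    takeˡ-head : ∀ a b s → All (λ c → proj₁ c Fin.zero ≡ s) (takeˡ (suc a) b s)
    takeˡ-head a b s = All-guard (s ℕₚ.<? M) λ _ → All-guard (b ℕₚ.≤? a) λ _ →
      Allₚ.map⁺ (All.universal (λ _ → refl) (corners a b s))

    takeʳ-bounded : ∀ a b s → All (λ c → ∀ i → proj₁ c i < s) (takeʳ a b s)
    takeʳ-bounded a zero    s = All.[]
    takeʳ-bounded a (suc b) s = Allₚ.map⁺ (All.map proj₁ (corners-bounded a b s))

    vs-takeʳ : ∀ a b s → All (λ c → All (Separated c) (takeʳ a b s)) (corners a b s)
    vs-takeʳ a zero    s = All.universal (λ _ → All.[]) _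
    vs-takeʳ a (suc b) s = cross {P = Bounded s} {Q = λ c → proj₂ c Fin.zero ≡ s}
      (λ {c} (_ , p) eq → inj₂ (Fin.zero , inj₁ (subst (proj₂ c Fin.zero <_) (sym eq) (p Fin.zero))))
      (corners-bounded a (suc b) s) (Allₚ.map⁺ (All.universal (λ _ → refl) (corners a b s)))

  -- Lists that treat level `s` differently are told apart by the entry placed there in one of them:
  -- by `corners-bounded`, the same entry of the other list lies strictly lower. Lists that treat it
  -- alike differ further down.
  corners-separated : ∀ a b s → AllPairs Separated (corners a b s)
  corners-separated zero zero zero = All.[] AllPairs.∷ AllPairs.[]
  corners-separated zero    (suc b) zero = AllPairs.[]
  corners-separated (suc a) b       zero = AllPairs.[]
  corners-separated zero zero (suc s) =
    AllPairsₚ.++⁺ (corners-separated zero zero s) AllPairs.[] (All.universal (λ _ → All.[]) _)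
  corners-separated zero (suc b) (suc s) =
    AllPairsₚ.++⁺ (corners-separated zero (suc b) s)
      (AllPairsₚ.map⁺ (AllPairs.map (λ {c} {e} → separated-consʳ {c = c} {e}) (corners-separated zero b s)))
      (vs-takeʳ zero (suc b) s)
  corners-separated (suc a) b (suc s) =
    AllPairsₚ.++⁺ (corners-separated (suc a) b s)
      (AllPairsₚ.++⁺
        (AllPairs-guard (s ℕₚ.<? M) (AllPairs-guard (b ℕₚ.≤? a)
          (AllPairsₚ.map⁺ (AllPairs.map (λ {c} {e} → separated-consˡ {c = c} {e}) (corners-separated a b s)))))
        (onTakeʳ b)
        (cross {P = λ c → proj₁ c Fin.zero ≡ s} {Q = λ c → ∀ i → proj₁ c i < s}
          (λ {c} {e} eq q → inj₁ (Fin.zero , inj₂ (subst (proj₁ e Fin.zero <_) (sym eq) (q Fin.zero))))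
          (takeˡ-head a b s) (takeʳ-bounded (suc a) b s)))
      (All.zipWith (λ { (p , q) → Allₚ.++⁺ p q })
        ( cross {P = Bounded s} {Q = λ c → proj₁ c Fin.zero ≡ s}
            (λ {c} (p , _) eq → inj₁ (Fin.zero , inj₁ (subst (proj₁ c Fin.zero <_) (sym eq) (p Fin.zero))))
            (corners-bounded (suc a) b s) (takeˡ-head a b s)
        , vs-takeʳ (suc a) b s))
    where
    onTakeʳ : ∀ b → AllPairs Separated (takeʳ (suc a) b s)
    onTakeʳ zero    = AllPairs.[]
    onTakeʳ (suc b) = AllPairsₚ.map⁺
        (AllPairs.map (λ {c} {e} → separated-consʳ {c = c} {e}) (corners-separated (suc a) b s))

-- Covering the polytope

Any-guard : {P A : Set} {Q : A → Set} (d : Dec P) {xs : List A} → P → Any Q xs → Any Q (guard d xs)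
Any-guard d p any = subst (Any _) (sym (guard-yes d p)) any

-- A value whose grid cell is uncertain is put in the higher of two candidate
-- cells, so cells of width h + δ suffice.  In a list for a + b remaining values
-- and bound s ≥ a + b, cells start at most at s ∸ (a + b): this encodes weak
-- chains of cells by the strict chains counted by `corners`.
module Outer (M D : ℕ) (h δ : ℚ) (0<δ : 0ℚ ℚ.< δ) (0≤h : 0ℚ ℚ.≤ h) (Mh≡1 : ι M ℚ.* h ≡ 1ℚ) where
  open Corners (λ n s → s ∸ n) (M ℕ.+ D)

  width : ℚ
  width = h ℚ.+ δ

  bound : ℕ → ℝ
  bound r = fromℚ (ι r ℚ.* h ℚ.+ δ)

  Covered : ∀ {a b} → (Fin a → ℝ) → (Fin b → ℝ) → List (Corner a b) → Set
  Covered u v = Any λ c → InCube h width c u v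

  private
    p<p+δ : ∀ p → p ℚ.< p ℚ.+ δ
    p<p+δ p = subst (ℚ._< p ℚ.+ δ) (ℚₚ.+-identityʳ p) (ℚₚ.+-monoʳ-< p 0<δ)

    inCell : ∀ r {x} → fromℚ (ι r ℚ.* h) ≤ᴿ x → x ≤ᴿ bound (suc r) → InCell h width r x
    inCell r {x} lo hi = lo , subst (λ q → x ≤ᴿ fromℚ q)
      (trans (cong (ℚ._+ δ) (ι-suc-* r h)) (ℚₚ.+-assoc (ι r ℚ.* h) h δ)) hi

    cell≡ : ∀ {s n r} → s ≡ n ℕ.+ r → s ∸ n ≡ r
    cell≡ {n = n} {r} refl = ℕₚ.m+n∸m≡n n r

    below : ∀ {t n q} {w : Fin (suc n) → ℝ} → Antitone t w → w Fin.zero ≤ᴿ q → ∀ i → w i ≤ᴿ q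
    below                 anti w₀≤q Fin.zero    = w₀≤q
    below {t} {n} {q} {w} anti w₀≤q (Fin.suc i) = ≤ᴿ-trans {w (Fin.suc i)} {w Fin.zero} {q}
      (antitone-≤ {w Fin.zero} {n} {w ∘ Fin.suc} (antitone-tail {t} {n} {w} anti) i) w₀≤q

    1≤bound : ∀ {r} → M ≤ r → fromℚ 1ℚ ≤ᴿ bound r
    1≤bound {r} M≤r = fromℚ-mono (ℚₚ.≤-trans
      (subst (ℚ._≤ ι r ℚ.* h) Mh≡1 (ℚₚ.*-monoʳ-≤-nonNeg h {{ℚ.nonNegative 0≤h}} (ι-mono M≤r)))
      (ℚₚ.<⇒≤ (p<p+δ (ι r ℚ.* h))))

  -- Here `r` is the grid index under consideration: all remaining values are known to lie at most
  -- slightly above cell `r`. Placing a value uses one level and keeps `r`, so several values may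
  -- share a cell; leaving a level empty lowers `r`. The first v is tested before the first u, which
  -- matches the ballot rule.
  cover : ∀ s a b r → s ≡ a ℕ.+ b ℕ.+ r → b ≤ a → a ℕ.+ b ≤ D → ∀ {u v t t′} →
          Antitone t u → Antitone t′ v → Aligned a b u v → (∀ i → u i ≤ᴿ fromℚ 1ℚ) →
          (∀ i → u i ≤ᴿ bound (suc r)) → (∀ j → v j ≤ᴿ bound (suc r)) →
          Covered u v (corners a b s)

  private
    putʳ : ∀ s a b r → s ≡ a ℕ.+ b ℕ.+ r → suc b ≤ a → a ℕ.+ suc b ≤ D → ∀ {u v t t′} →
           Antitone t u → Antitone t′ v → Aligned a (suc b) u v → (∀ i → u i ≤ᴿ fromℚ 1ℚ) →
           (∀ i → u i ≤ᴿ bound (suc r)) → (∀ j → v j ≤ᴿ bound (suc r)) →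
           fromℚ (ι r ℚ.* h) ≤ᴿ v Fin.zero →
           Covered u v (corners a (suc b) (suc s))
    putʳ s (suc a) b r eq b<a n≤D {u} {v} {t} {t′} antiU antiV al u≤1 u≤ v≤ lo =
      Anyₚ.++⁺ʳ (corners (suc a) (suc b) s)
          (Anyₚ.++⁺ʳ (takeˡ (suc a) (suc b) s) (Anyₚ.map⁺ (Any.map (λ {c} → push {c})
        (cover s (suc a) b r eq (ℕₚ.<⇒≤ b<a) (ℕₚ.≤-trans (ℕₚ.+-monoʳ-≤ (suc a) (ℕₚ.n≤1+n b)) n≤D)
          {u} {v ∘ Fin.suc} {t} {v Fin.zero} antiU (antitone-tail {t′} {b} {v} antiV)
          (λ i j e → al i (Fin.suc j) (trans (ℕₚ.+-suc (toℕ i) b) (cong suc e)))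
          u≤1 u≤ (v≤ ∘ Fin.suc)))))
      where
      push : ∀ {c} → InCube h width c u (v ∘ Fin.suc) → InCube h width (consʳ (s ∸ (suc a ℕ.+ b)) c) u v
      push (inU , inV) = inU , λ
        { Fin.zero → subst (λ c → InCell h width c (v Fin.zero)) (sym (cell≡ {n = suc a ℕ.+ b} eq))
                       (inCell r {v Fin.zero} lo (v≤ Fin.zero))
        ; (Fin.suc j) → inV j }

    putˡ : ∀ s a b r → s ≡ a ℕ.+ b ℕ.+ r → b ≤ a → suc a ℕ.+ b ≤ D → s < M ℕ.+ D → ∀ {u v t t′} →
           Antitone t u → Antitone t′ v → Aligned (suc a) b u v → (∀ i → u i ≤ᴿ fromℚ 1ℚ) →
           (∀ i → u i ≤ᴿ bound (suc r)) → (∀ j → v j ≤ᴿ bound (suc r)) →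
           fromℚ (ι r ℚ.* h) ≤ᴿ u Fin.zero →
           Covered u v (corners (suc a) b (suc s))
    putˡ s a b r eq b≤a n≤D s<M {u} {v} {t} {t′} antiU antiV al u≤1 u≤ v≤ lo =
      Anyₚ.++⁺ʳ (corners (suc a) b s) (Anyₚ.++⁺ˡ
        (Any-guard (s ℕₚ.<? M ℕ.+ D) s<M (Any-guard (b ℕₚ.≤? a) b≤a (Anyₚ.map⁺ (Any.map (λ {c} → push {c})
          (cover s a b r eq b≤a (ℕₚ.≤-trans (ℕₚ.n≤1+n (a ℕ.+ b)) n≤D)
            {u ∘ Fin.suc} {v} {u Fin.zero} {t′} (antitone-tail {t} {a} {u} antiU) antiV
            (λ i j e → al (Fin.suc i) j (trans (cong suc e) (sym (ℕₚ.+-suc (toℕ j) a))))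
            (u≤1 ∘ Fin.suc) (u≤ ∘ Fin.suc) v≤))))))
      where
      push : ∀ {c} → InCube h width c (u ∘ Fin.suc) v → InCube h width (consˡ (s ∸ (a ℕ.+ b)) c) u v
      push (inU , inV) = (λ
        { Fin.zero → subst (λ c → InCell h width c (u Fin.zero)) (sym (cell≡ {n = a ℕ.+ b} eq))
                       (inCell r {u Fin.zero} lo (u≤ Fin.zero))
        ; (Fin.suc i) → inU i }) , inV

    skip : ∀ s a b r → s ≡ a ℕ.+ b ℕ.+ suc r → b ≤ suc a → suc a ℕ.+ b ≤ D → ∀ {u v t t′} →
           Antitone t u → Antitone t′ v → Aligned (suc a) b u v → (∀ i → u i ≤ᴿ fromℚ 1ℚ) →
           u Fin.zero ≤ᴿ bound (suc r) → (∀ j → v j ≤ᴿ bound (suc r)) →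
           Covered u v (corners (suc a) b (suc s))
    skip s a b r eq b≤ n≤D {u} {v} {t} {t′} antiU antiV al u≤1 u₀≤ v≤ = Anyₚ.++⁺ˡ
      (cover s (suc a) b r (trans eq (ℕₚ.+-suc (a ℕ.+ b) r)) b≤ n≤D {u} {v} {t} {t′} antiU antiV al u≤1
        (below {t} {a} {bound (suc r)} {u} antiU u₀≤) v≤)

    tryˡ : ∀ s a b r → s ≡ a ℕ.+ b ℕ.+ r → b ≤ suc a → suc a ℕ.+ b ≤ D → ∀ {u v t t′} →
           Antitone t u → Antitone t′ v → Aligned (suc a) b u v → (∀ i → u i ≤ᴿ fromℚ 1ℚ) →
           (∀ i → u i ≤ᴿ bound (suc r)) → (∀ j → v j ≤ᴿ bound (suc r)) →
           (∀ j → v j ≤ᴿ bound r) → (r ≡ 0 → b ≡ 0) →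
           Covered u v (corners (suc a) b (suc s))
    -- There is no cell below index 0, so the value is placed here, its lower bound being
    -- nonnegativity. The v's have been placed first, hence `b ≡ 0`, and both guards hold.
    tryˡ s a b zero eq b≤ n≤D {u} {v} {t} {t′} antiU antiV al u≤1 u≤ v≤ _ b≡0 =
      putˡ s a b zero eq (subst (_≤ a) (sym (b≡0 refl)) z≤n) n≤D
        (subst (_< M ℕ.+ D) (sym (trans eq (ℕₚ.+-identityʳ (a ℕ.+ b)))) (ℕₚ.≤-trans n≤D (ℕₚ.m≤n+m D M)))
        {u} {v} {t} {t′} antiU antiV al u≤1 u≤ v≤
        (subst (λ q → fromℚ q ≤ᴿ u Fin.zero) (sym (ℚₚ.*-zeroˡ h)) (antitone-0≤ {t} {suc a} {u} antiU Fin.zero))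
    tryˡ s a b (suc r) eq b≤ n≤D {u} {v} {t} {t′} antiU antiV al u≤1 u≤ v≤ v≤′ _ =
      cases (b ℕₚ.≤? a) (s ℕₚ.<? M ℕ.+ D)
      where
      skip′ : u Fin.zero ≤ᴿ bound (suc r) → Covered u v (corners (suc a) b (suc s))
      skip′ u₀≤ = skip s a b r eq b≤ n≤D {u} {v} {t} {t′} antiU antiV al u≤1 u₀≤ v≤′

      u₀≤v₀ : ∀ {b} → b ≡ suc a → (w : Fin b → ℝ) → Aligned (suc a) b u w → (∀ j → w j ≤ᴿ bound (suc r)) →
          u Fin.zero ≤ᴿ bound (suc r)
      u₀≤v₀ refl w al w≤ = ≤ᴿ-trans {u Fin.zero} {w Fin.zero} {bound (suc r)} (al Fin.zero Fin.zero refl)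
          (w≤ Fin.zero)

      -- At most `D` levels serve as spacing, so a level closed to u has grid index at least `M`;
      -- since u is at most 1, the level can be left empty.
      M≤ : ¬ s < M ℕ.+ D → M ≤ suc r
      M≤ s≮ = ℕₚ.+-cancelʳ-≤ D M (suc r) (begin
        M ℕ.+ D              ≤⟨ ℕₚ.≮⇒≥ s≮ ⟩
        s                    ≡⟨ eq ⟩
        a ℕ.+ b ℕ.+ suc r    ≤⟨ ℕₚ.+-monoˡ-≤ (suc r) (ℕₚ.≤-trans (ℕₚ.n≤1+n (a ℕ.+ b)) n≤D) ⟩
        D ℕ.+ suc r          ≡⟨ ℕₚ.+-comm D (suc r) ⟩
        suc r ℕ.+ D ∎)
        where open ℕₚ.≤-Reasoning

      cases : Dec (b ≤ a) → Dec (s < M ℕ.+ D) → Covered u v (corners (suc a) b (suc s))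
      -- With equally many u's and v's left, the two first entries are partners, so u inherits the
      -- upper bound just found for v.
      cases (no b≰a) _ = skip′ (u₀≤v₀ (ℕₚ.≤-antisym b≤ (ℕₚ.≰⇒> b≰a)) v al v≤′)
      cases (yes _)  (no s≮) = skip′
          (≤ᴿ-trans {u Fin.zero} {fromℚ 1ℚ} {bound (suc r)} (u≤1 Fin.zero) (1≤bound (M≤ s≮)))
      cases (yes b≤a) (yes s<) = [ skip′ , putˡ s a b
          (suc r) eq b≤a n≤D s< {u} {v} {t} {t′} antiU antiV al u≤1 u≤ v≤ ]′
        (approximate-dichotomy (u Fin.zero) (p<p+δ (ι (suc r) ℚ.* h)))

  cover zero    zero    zero    r eq b≤a n≤D antiU antiV al u≤1 u≤ v≤ = Any.here ((λ ()) , (λ ()))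
  cover (suc s) zero    zero    r eq b≤a n≤D {u} {v} {t} {t′} antiU antiV al u≤1 u≤ v≤ =
    Anyₚ.++⁺ˡ (cover s zero zero s refl b≤a n≤D {u} {v} {t} {t′} antiU antiV al u≤1 (λ ()) (λ ()))
  cover (suc s) (suc a) zero    r eq b≤a n≤D {u} {v} {t} {t′} antiU antiV al u≤1 u≤ v≤ =
    tryˡ s a zero r (ℕₚ.suc-injective eq) z≤n n≤D {u} {v} {t} {t′} antiU antiV al u≤1 u≤ v≤ (λ ()) (λ _ → refl)
  cover (suc s) (suc a) (suc b) zero eq b≤a n≤D {u} {v} {t} {t′} antiU antiV al u≤1 u≤ v≤ =
    putʳ s (suc a) b zero (trans (ℕₚ.suc-injective eq) (cong (ℕ._+ 0) (ℕₚ.+-suc a b))) b≤a n≤D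
      {u} {v} {t} {t′} antiU antiV al u≤1 u≤ v≤
      (subst (λ q → fromℚ q ≤ᴿ v Fin.zero) (sym (ℚₚ.*-zeroˡ h)) (antitone-0≤ {t′} {suc b} {v} antiV Fin.zero))
  cover (suc s) (suc a) (suc b) (suc r) eq b≤a n≤D {u} {v} {t} {t′} antiU antiV al u≤1 u≤ v≤ =
    [ (λ v₀≤ → tryˡ s a (suc b) (suc r) (ℕₚ.suc-injective eq) b≤a n≤D {u} {v} {t} {t′} antiU antiV al u≤1 u≤ v≤
                 (below {t′} {b} {bound (suc r)} {v} antiV v₀≤) (λ ()))
    , putʳ s (suc a) b (suc r) (trans (ℕₚ.suc-injective eq) (cong (ℕ._+ suc r) (ℕₚ.+-suc a b))) b≤a n≤D
        {u} {v} {t} {t′} antiU antiV al u≤1 u≤ v≤ ]′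
    (approximate-dichotomy (v Fin.zero) (p<p+δ (ι (suc r) ℚ.* h)))

-- Volumes of the two families of cubes

^ℚ-foldr : ∀ {n} {w} (f : Fin n → ℚ) → (∀ i → f i ≡ w) → Vector.foldr ℚ._*_ 1ℚ f ≡ w ^ℚ n
^ℚ-foldr {zero}  f eq = refl
^ℚ-foldr {suc n} f eq = cong₂ ℚ._*_ (eq Fin.zero) (^ℚ-foldr (f ∘ Fin.suc) (eq ∘ Fin.suc))

module Cubes (h w : ℚ) (0≤w : 0ℚ ℚ.≤ w) (k : ℕ) where
  cube : Corner k k → Box (k ℕ.+ k)
  cube (c , c′) = record
    { lo    = λ i → ι ((c Vector.++ c′) i) ℚ.* h
    ; hi    = λ i → ι ((c Vector.++ c′) i) ℚ.* h ℚ.+ w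
    ; lo≤hi = λ i → subst (ℚ._≤ ι ((c Vector.++ c′) i) ℚ.* h ℚ.+ w) (ℚₚ.+-identityʳ _)
        (ℚₚ.+-monoʳ-≤ (ι ((c Vector.++ c′) i) ℚ.* h) 0≤w)
    }

  ++-↑ˡ : ∀ {A : Set} (c c′ : Fin k → A) j → (c Vector.++ c′) (j ↑ˡ k) ≡ c j
  ++-↑ˡ c c′ j = cong [ c , c′ ]′ (Finₚ.splitAt-↑ˡ k j k)

  ++-↑ʳ : ∀ {A : Set} (c c′ : Fin k → A) j → (c Vector.++ c′) (k ↑ʳ j) ≡ c′ j
  ++-↑ʳ c c′ j = cong [ c , c′ ]′ (Finₚ.splitAt-↑ʳ k k j)

  ∈cube⇒InCube : ∀ c x → x ∈ ⟦ cube c ⟧ → InCube h w c (x ∘ (_↑ˡ k)) (x ∘ (k ↑ʳ_))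
  ∈cube⇒InCube (c , c′) x x∈ =
      (λ j → subst (λ m → InCell h w m (x (j ↑ˡ k))) (++-↑ˡ c c′ j) (x∈ (j ↑ˡ k)))
    , (λ j → subst (λ m → InCell h w m (x (k ↑ʳ j))) (++-↑ʳ c c′ j) (x∈ (k ↑ʳ j)))

  InCube⇒∈cube : ∀ c x → InCube h w c (x ∘ (_↑ˡ k)) (x ∘ (k ↑ʳ_)) → x ∈ ⟦ cube c ⟧
  InCube⇒∈cube (c , c′) x (inU , inV) = ↑-elim (λ i → InCell h w ((c Vector.++ c′) i) (x i))
    (λ j → subst (λ m → InCell h w m (x (j ↑ˡ k))) (sym (++-↑ˡ c c′ j)) (inU j))
    (λ j → subst (λ m → InCell h w m (x (k ↑ʳ j))) (sym (++-↑ʳ c c′ j)) (inV j))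

  totalVolume-cubes : ∀ cs → totalVolume (map cube cs) ≡ ι (length cs) ℚ.* (w ^ℚ (k ℕ.+ k))
  totalVolume-cubes List.[]       = sym (ℚₚ.*-zeroˡ (w ^ℚ (k ℕ.+ k)))
  totalVolume-cubes (c List.∷ cs) = trans
    (cong₂ ℚ._+_ (^ℚ-foldr _ (λ i → cancel (lo (cube c) i) w)) (totalVolume-cubes cs))
    (trans (collect (ι (length cs)) (w ^ℚ (k ℕ.+ k))) (cong (ℚ._* (w ^ℚ (k ℕ.+ k))) (sym (ι-+ 1 (length cs)))))
    where
    cancel : ∀ a b → (a ℚ.+ b) ℚ.- a ≡ b
    cancel = RingSolver.solve-∀ ℚ-ring
    collect : ∀ l p → p ℚ.+ l ℚ.* p ≡ (1ℚ ℚ.+ l) ℚ.* p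
    collect = RingSolver.solve-∀ ℚ-ring

separated⇒nonOverlapping : ∀ {h k} (0≤h : 0ℚ ℚ.≤ h) {c e : Corner k k} {M} → Inner.Separated M h 0≤h c e →
  NonOverlapping (Cubes.cube h h 0≤h k c) (Cubes.cube h h 0≤h k e)
separated⇒nonOverlapping {h} {k} 0≤h {c , c′} {e , e′} = λ
  { (inj₁ (i , inj₁ lt)) → (i ↑ˡ k) , inj₁ (subst₂ Gap (sym (++-↑ˡ c c′ i)) (sym (++-↑ˡ e e′ i)) (gap lt))
  ; (inj₁ (i , inj₂ lt)) → (i ↑ˡ k) , inj₂ (subst₂ Gap (sym (++-↑ˡ e e′ i)) (sym (++-↑ˡ c c′ i)) (gap lt))
  ; (inj₂ (j , inj₁ lt)) → (k ↑ʳ j) , inj₁ (subst₂ Gap (sym (++-↑ʳ c c′ j)) (sym (++-↑ʳ e e′ j)) (gap lt))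
  ; (inj₂ (j , inj₂ lt)) → (k ↑ʳ j) , inj₂ (subst₂ Gap (sym (++-↑ʳ e e′ j)) (sym (++-↑ʳ c c′ j)) (gap lt))
  }
  where
  open Cubes h h 0≤h k using (++-↑ˡ; ++-↑ʳ)
  Gap : ℕ → ℕ → Set
  Gap m n = ι m ℚ.* h ℚ.+ h ℚ.≤ ι n ℚ.* h
  gap : ∀ {m n} → m < n → Gap m n
  gap {m} {n} m<n = subst (ℚ._≤ ι n ℚ.* h) (ι-suc-* m h)
    (ℚₚ.*-monoʳ-≤-nonNeg h {{ℚ.nonNegative 0≤h}} (ι-mono m<n))

-- Bernoulli's inequality for (1 - e/M)^j, multiplied by M^(j+1).
bernoulli : ∀ M e j → M ℕ.* M ℕ.^ j ≤ M ℕ.* (M ∸ e) ℕ.^ j ℕ.+ j ℕ.* e ℕ.* M ℕ.^ j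
bernoulli M e zero    = ℕₚ.m≤m+n _ _
bernoulli M e (suc j) = begin
  M ℕ.* (M ℕ.* M ℕ.^ j)
    ≤⟨ ℕₚ.*-monoʳ-≤ M (bernoulli M e j) ⟩
  M ℕ.* (M ℕ.* X ℕ.+ j ℕ.* e ℕ.* M ℕ.^ j)
    ≡⟨ ℕₚ.*-distribˡ-+ M (M ℕ.* X) _ ⟩
  M ℕ.* (M ℕ.* X) ℕ.+ M ℕ.* (j ℕ.* e ℕ.* M ℕ.^ j)
    ≤⟨ ℕₚ.+-monoˡ-≤ _ (ℕₚ.*-monoʳ-≤ M (ℕₚ.*-monoˡ-≤ X (ℕₚ.m≤n+m∸n M e))) ⟩
  M ℕ.* ((e ℕ.+ (M ∸ e)) ℕ.* X) ℕ.+ M ℕ.* (j ℕ.* e ℕ.* M ℕ.^ j)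
    ≡⟨ expand M e (M ∸ e) X j (M ℕ.^ j) ⟩
  M ℕ.* ((M ∸ e) ℕ.* X) ℕ.+ (e ℕ.* M ℕ.* X ℕ.+ j ℕ.* e ℕ.* (M ℕ.* M ℕ.^ j))
    ≤⟨ ℕₚ.+-monoʳ-≤ (M ℕ.* ((M ∸ e) ℕ.* X))
         (ℕₚ.+-monoˡ-≤ _ (ℕₚ.*-monoʳ-≤ (e ℕ.* M) (ℕₚ.^-monoˡ-≤ j (ℕₚ.m∸n≤m M e)))) ⟩
  M ℕ.* ((M ∸ e) ℕ.* X) ℕ.+ (e ℕ.* M ℕ.* M ℕ.^ j ℕ.+ j ℕ.* e ℕ.* (M ℕ.* M ℕ.^ j))
    ≡⟨ cong (M ℕ.* ((M ∸ e) ℕ.* X) ℕ.+_) (collect e M (M ℕ.^ j) j) ⟩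
  M ℕ.* ((M ∸ e) ℕ.* X) ℕ.+ suc j ℕ.* e ℕ.* (M ℕ.* M ℕ.^ j) ∎
  where
  open ℕₚ.≤-Reasoning
  X = (M ∸ e) ℕ.^ j
  expand : ∀ m e r x j p → m ℕ.* ((e ℕ.+ r) ℕ.* x) ℕ.+ m ℕ.* (j ℕ.* e ℕ.* p)
         ≡ m ℕ.* (r ℕ.* x) ℕ.+ (e ℕ.* m ℕ.* x ℕ.+ j ℕ.* e ℕ.* (m ℕ.* p))
  expand = ℕ-Solver.solve-∀
  collect : ∀ e m p j → e ℕ.* m ℕ.* p ℕ.+ j ℕ.* e ℕ.* (m ℕ.* p) ≡ suc j ℕ.* e ℕ.* (m ℕ.* p)
  collect = ℕ-Solver.solve-∀

-- A constant B with (1 + c/M)^n ≤ 1 + B/M whenever `c ≤ M`. In the product (1 + c/M) (1 + B/M) the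
-- mixed term is at most B/M, which explains the doubling.
powerError : ℕ → ℕ → ℕ
powerError c zero    = 0
powerError c (suc n) = c ℕ.+ 2 ℕ.* powerError c n

^-powerError : ∀ {M c} → c ≤ M → ∀ n → (M ℕ.+ c) ℕ.^ n ℕ.* M ≤ M ℕ.^ n ℕ.* (M ℕ.+ powerError c n)
^-powerError {M} {c} c≤M zero    = ℕₚ.≤-reflexive (cong (1 ℕ.*_) (sym (ℕₚ.+-identityʳ M)))
^-powerError {M} {c} c≤M (suc n) = begin
  (M ℕ.+ c) ℕ.* (M ℕ.+ c) ℕ.^ n ℕ.* M
    ≡⟨ ℕₚ.*-assoc (M ℕ.+ c) _ M ⟩
  (M ℕ.+ c) ℕ.* ((M ℕ.+ c) ℕ.^ n ℕ.* M)
    ≤⟨ ℕₚ.*-monoʳ-≤ (M ℕ.+ c) (^-powerError c≤M n) ⟩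
  (M ℕ.+ c) ℕ.* (M ℕ.^ n ℕ.* (M ℕ.+ B))
    ≡⟨ expand M c (M ℕ.^ n) B ⟩
  M ℕ.^ n ℕ.* (M ℕ.* M ℕ.+ c ℕ.* M ℕ.+ B ℕ.* M ℕ.+ B ℕ.* c)
    ≤⟨ ℕₚ.*-monoʳ-≤ (M ℕ.^ n) (ℕₚ.+-monoʳ-≤ (M ℕ.* M ℕ.+ c ℕ.* M ℕ.+ B ℕ.* M) (ℕₚ.*-monoʳ-≤ B c≤M)) ⟩
  M ℕ.^ n ℕ.* (M ℕ.* M ℕ.+ c ℕ.* M ℕ.+ B ℕ.* M ℕ.+ B ℕ.* M)
    ≡⟨ collect M c (M ℕ.^ n) B ⟩
  M ℕ.* M ℕ.^ n ℕ.* (M ℕ.+ (c ℕ.+ 2 ℕ.* B)) ∎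
  where
  open ℕₚ.≤-Reasoning
  B = powerError c n
  expand : ∀ m c p b → (m ℕ.+ c) ℕ.* (p ℕ.* (m ℕ.+ b)) ≡ p ℕ.* (m ℕ.* m ℕ.+ c ℕ.* m ℕ.+ b ℕ.* m ℕ.+ b ℕ.* c)
  expand = ℕ-Solver.solve-∀
  collect : ∀ m c p b → p ℕ.* (m ℕ.* m ℕ.+ c ℕ.* m ℕ.+ b ℕ.* m ℕ.+ b ℕ.* m) ≡ m ℕ.* p ℕ.*
      (m ℕ.+ (c ℕ.+ 2 ℕ.* b))
  collect = ℕ-Solver.solve-∀

-- Both sides of the comparison of K wᵈ with V / F ± A / M, for w = L / N,
-- multiplied by F Nᵈ M.
module Clearing (d F V K A M N L : ℕ) (v η w : ℚ)
  (v≡ : ι F ℚ.* v ≡ ι V) (η≡ : ι M ℚ.* η ≡ ι A) (w≡ : ι N ℚ.* w ≡ ι L) where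

  P : ℕ
  P = F ℕ.* (N ℕ.^ d ℕ.* M)

  private
    ιP : ι P ≡ ι F ℚ.* (ι (N ℕ.^ d) ℚ.* ι M)
    ιP = trans (ι-* F _) (cong (ι F ℚ.*_) (ι-* (N ℕ.^ d) M))

  clear-v : ι P ℚ.* v ≡ ι (N ℕ.^ d ℕ.* M ℕ.* V)
  clear-v = begin
    ι P ℚ.* v                                   ≡⟨ cong (ℚ._* v) ιP ⟩
    ι F ℚ.* (ι (N ℕ.^ d) ℚ.* ι M) ℚ.* v         ≡⟨ shuffle (ι F) (ι (N ℕ.^ d)) (ι M) v ⟩
    ι (N ℕ.^ d) ℚ.* ι M ℚ.* (ι F ℚ.* v)         ≡⟨ cong₂ ℚ._*_ (sym (ι-* (N ℕ.^ d) M)) v≡ ⟩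
    ι (N ℕ.^ d ℕ.* M) ℚ.* ι V                   ≡⟨ ι-* (N ℕ.^ d ℕ.* M) V ⟨
    ι (N ℕ.^ d ℕ.* M ℕ.* V) ∎
    where
    open ≡-Reasoning
    shuffle : ∀ f n m v → f ℚ.* (n ℚ.* m) ℚ.* v ≡ n ℚ.* m ℚ.* (f ℚ.* v)
    shuffle = RingSolver.solve-∀ ℚ-ring

  clear-η : ι P ℚ.* η ≡ ι (F ℕ.* N ℕ.^ d ℕ.* A)
  clear-η = begin
    ι P ℚ.* η                                   ≡⟨ cong (ℚ._* η) ιP ⟩
    ι F ℚ.* (ι (N ℕ.^ d) ℚ.* ι M) ℚ.* η         ≡⟨ shuffle (ι F) (ι (N ℕ.^ d)) (ι M) η ⟩
    ι F ℚ.* ι (N ℕ.^ d) ℚ.* (ι M ℚ.* η)         ≡⟨ cong₂ ℚ._*_ (sym (ι-* F (N ℕ.^ d))) η≡ ⟩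
    ι (F ℕ.* N ℕ.^ d) ℚ.* ι A                   ≡⟨ ι-* (F ℕ.* N ℕ.^ d) A ⟨
    ι (F ℕ.* N ℕ.^ d ℕ.* A) ∎
    where
    open ≡-Reasoning
    shuffle : ∀ f n m v → f ℚ.* (n ℚ.* m) ℚ.* v ≡ f ℚ.* n ℚ.* (m ℚ.* v)
    shuffle = RingSolver.solve-∀ ℚ-ring

  clear-K : ι P ℚ.* (ι K ℚ.* (w ^ℚ d)) ≡ ι (F ℕ.* K ℕ.* M ℕ.* L ℕ.^ d)
  clear-K = begin
    ι P ℚ.* (ι K ℚ.* (w ^ℚ d))                                ≡⟨ cong (ℚ._* (ι K ℚ.* (w ^ℚ d))) ιP ⟩
    ι F ℚ.* (ι (N ℕ.^ d) ℚ.* ι M) ℚ.* (ι K ℚ.* (w ^ℚ d))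
      ≡⟨ shuffle (ι F) (ι (N ℕ.^ d)) (ι M) (ι K) (w ^ℚ d) ⟩
    ι F ℚ.* ι K ℚ.* ι M ℚ.* (ι (N ℕ.^ d) ℚ.* (w ^ℚ d))
      ≡⟨ cong₂ (λ p q → p ℚ.* ι M ℚ.* q) (sym (ι-* F K)) (^ℚ-cleared {w} {N} {L} d w≡) ⟩
    ι (F ℕ.* K) ℚ.* ι M ℚ.* ι (L ℕ.^ d)                       ≡⟨ cong (ℚ._* ι (L ℕ.^ d)) (ι-* (F ℕ.* K) M) ⟨
    ι (F ℕ.* K ℕ.* M) ℚ.* ι (L ℕ.^ d)                         ≡⟨ ι-* (F ℕ.* K ℕ.* M) (L ℕ.^ d) ⟨
    ι (F ℕ.* K ℕ.* M ℕ.* L ℕ.^ d) ∎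
    where
    open ≡-Reasoning
    shuffle : ∀ f n m k p → f ℚ.* (n ℚ.* m) ℚ.* (k ℚ.* p) ≡ f ℚ.* k ℚ.* m ℚ.* (n ℚ.* p)
    shuffle = RingSolver.solve-∀ ℚ-ring

  clear-+ : ∀ {x y m n} → ι P ℚ.* x ≡ ι m → ι P ℚ.* y ≡ ι n → ι P ℚ.* (x ℚ.+ y) ≡ ι (m ℕ.+ n)
  clear-+ {x} {y} {m} {n} eq₁ eq₂ = trans (ℚₚ.*-distribˡ-+ (ι P) x y)
      (trans (cong₂ ℚ._+_ eq₁ eq₂) (sym (ι-+ m n)))

-- A grid of mesh 1 / M with M = A q bounds the volume up to A / M = 1 / q.
module Grid (k q : ℕ) where
  d V F c A M : ℕ
  d = k ℕ.+ k
  V = shuffleCount k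
  F = d !
  -- Chosen so that `(M + d) * (M + 1) ≤ M * (M + c)`, which merges the extra levels and the extra
  -- width of the covering cells into one factor.
  c = suc (d ℕ.+ d)
  -- The summand `c` secures `c ≤ M`; the other two dominate the errors of the inner and of the
  -- outer estimate.
  A = c ℕ.+ V ℕ.* (d ℕ.* d ℕ.+ powerError c d)
  M = A ℕ.* suc q

  instance
    F-nonZero : ℕ.NonZero F
    F-nonZero = ℕₚ._!≢0 d

  A≤M : A ≤ M
  A≤M = ℕₚ.m≤m*n A (suc q)

  c≤M : c ≤ M
  c≤M = ℕₚ.≤-trans (ℕₚ.m≤m+n c _) A≤M

  instance
    M-nonZero : ℕ.NonZero M
    M-nonZero = ℕ.>-nonZero (ℕₚ.≤-trans (s≤s z≤n) c≤M)

  v h η : ℚ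
  v = + V / F
  h = + 1 / M
  η = + 1 / suc q

  Mh≡1 : ι M ℚ.* h ≡ 1ℚ
  Mh≡1 = denominator 1 M

  Mη≡A : ι M ℚ.* η ≡ ι A
  Mη≡A = begin
    ι (A ℕ.* suc q) ℚ.* η          ≡⟨ cong (ℚ._* η) (ι-* A (suc q)) ⟩
    ι A ℚ.* ι (suc q) ℚ.* η        ≡⟨ ℚₚ.*-assoc (ι A) (ι (suc q)) η ⟩
    ι A ℚ.* (ι (suc q) ℚ.* η)      ≡⟨ cong (ι A ℚ.*_) (denominator 1 (suc q)) ⟩
    ι A ℚ.* 1ℚ                     ≡⟨ ℚₚ.*-identityʳ (ι A) ⟩
    ι A ∎
    where open ≡-Reasoning

  0<h : 0ℚ ℚ.< h
  0<h = ℚₚ.positive⁻¹ h {{ℚₚ.normalize-pos 1 M}}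

  0≤h : 0ℚ ℚ.≤ h
  0≤h = ℚₚ.<⇒≤ 0<h

  δ w : ℚ
  -- Then `w` is `h` times 1 + 1/M, that is (M + 1)/M², so the widening is again a relative error of
  -- order 1/M.
  δ = h ℚ.* h
  w = h ℚ.+ δ

  0<δ : 0ℚ ℚ.< δ
  0<δ = ℚₚ.positive⁻¹ δ {{ℚₚ.pos*pos⇒pos h {{ℚₚ.normalize-pos 1 M}} h {{ℚₚ.normalize-pos 1 M}}}}

  M²w≡M+1 : ι (M ℕ.* M) ℚ.* w ≡ ι (M ℕ.+ 1)
  M²w≡M+1 = begin
    ι (M ℕ.* M) ℚ.* (h ℚ.+ h ℚ.* h)                         ≡⟨ cong (ℚ._* (h ℚ.+ h ℚ.* h)) (ι-* M M) ⟩
    ι M ℚ.* ι M ℚ.* (h ℚ.+ h ℚ.* h)                         ≡⟨ expand (ι M) h ⟩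
    ι M ℚ.* (ι M ℚ.* h) ℚ.+ (ι M ℚ.* h) ℚ.* (ι M ℚ.* h)     ≡⟨ cong (λ p → ι M ℚ.* p ℚ.+ p ℚ.* p) Mh≡1 ⟩
    ι M ℚ.* 1ℚ ℚ.+ 1ℚ ℚ.* 1ℚ                                ≡⟨ cong (ℚ._+ 1ℚ) (ℚₚ.*-identityʳ (ι M)) ⟩
    ι M ℚ.+ ι 1                                             ≡⟨ ι-+ M 1 ⟨
    ι (M ℕ.+ 1) ∎
    where
    open ≡-Reasoning
    expand : ∀ m h → m ℚ.* m ℚ.* (h ℚ.+ h ℚ.* h) ≡ m ℚ.* (m ℚ.* h) ℚ.+ (m ℚ.* h) ℚ.* (m ℚ.* h)
    expand = RingSolver.solve-∀ ℚ-ring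

  private
    A≤FA : A ≤ F ℕ.* A
    A≤FA = ℕₚ.m≤n*m A F

    error≤ : ∀ {e} → e ≤ d ℕ.* d ℕ.+ powerError c d → V ℕ.* e ≤ F ℕ.* A
    error≤ e≤ = ℕₚ.≤-trans (ℕₚ.≤-trans (ℕₚ.*-monoʳ-≤ V e≤) (ℕₚ.m≤n+m _ c)) A≤FA

    M^d-nonZero : ℕ.NonZero (M ℕ.^ d)
    M^d-nonZero = ℕₚ.m^n≢0 M d

  -- The inner cubes fill at least v (1 - d/M)^d, which Bernoulli bounds below by v - v d²/M; the
  -- constant `A` makes v d²/M at most `η`.
  inner-≤ : v ℚ.≤ ι (chainCount k M) ℚ.* (h ^ℚ d) ℚ.+ η
  inner-≤ = ≤-cleared P {m = M ℕ.^ d ℕ.* M ℕ.* V} {{P-nonZero}} clear-v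
      (clear-+ {m = F ℕ.* chainCount k M ℕ.* M ℕ.* 1 ℕ.^ d} clear-K clear-η) (begin
    M ℕ.^ d ℕ.* M ℕ.* V
      ≡⟨ cong (ℕ._* V) (ℕₚ.*-comm (M ℕ.^ d) M) ⟩
    M ℕ.* M ℕ.^ d ℕ.* V
      ≤⟨ ℕₚ.*-monoˡ-≤ V (bernoulli M d d) ⟩
    (M ℕ.* (M ∸ d) ℕ.^ d ℕ.+ d ℕ.* d ℕ.* M ℕ.^ d) ℕ.* V
      ≡⟨ expand M ((M ∸ d) ℕ.^ d) (d ℕ.* d) (M ℕ.^ d) V ⟩
    M ℕ.* ((M ∸ d) ℕ.^ d ℕ.* V) ℕ.+ V ℕ.* (d ℕ.* d) ℕ.* M ℕ.^ d
      ≤⟨ ℕₚ.+-mono-≤ (ℕₚ.*-monoʳ-≤ M (chainCount-≥ k M))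
           (ℕₚ.*-monoˡ-≤ (M ℕ.^ d) (error≤ (ℕₚ.m≤m+n (d ℕ.* d) _))) ⟩
    M ℕ.* (F ℕ.* chainCount k M) ℕ.+ F ℕ.* A ℕ.* M ℕ.^ d
      ≡⟨ arrange M F (chainCount k M) A (M ℕ.^ d) ⟩
    F ℕ.* chainCount k M ℕ.* M ℕ.* 1 ℕ.+ F ℕ.* M ℕ.^ d ℕ.* A
      ≡⟨ cong (λ o → F ℕ.* chainCount k M ℕ.* M ℕ.* o ℕ.+ F ℕ.* M ℕ.^ d ℕ.* A) (ℕₚ.^-zeroˡ d) ⟨
    F ℕ.* chainCount k M ℕ.* M ℕ.* 1 ℕ.^ d ℕ.+ F ℕ.* M ℕ.^ d ℕ.* A ∎)
    where
    open Clearing d F V (chainCount k M) A M M 1 v η h (denominator V F) Mη≡A Mh≡1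
    open ℕₚ.≤-Reasoning
    P-nonZero : ℕ.NonZero P
    P-nonZero = ℕₚ.m*n≢0 F _ {{F-nonZero}} {{ℕₚ.m*n≢0 (M ℕ.^ d) M {{M^d-nonZero}}}}
    expand : ∀ m x e p v → (m ℕ.* x ℕ.+ e ℕ.* p) ℕ.* v ≡ m ℕ.* (x ℕ.* v) ℕ.+ v ℕ.* e ℕ.* p
    expand = ℕ-Solver.solve-∀
    arrange : ∀ m f k a p → m ℕ.* (f ℕ.* k) ℕ.+ f ℕ.* a ℕ.* p ≡ f ℕ.* k ℕ.* m ℕ.* 1 ℕ.+ f ℕ.* p ℕ.* a
    arrange = ℕ-Solver.solve-∀

  -- The outer cubes have total volume at most v ((M + d) (M + 1)/M²)^d, hence at most v (1 +
  -- c/M)^d, and `powerError` linearises this power.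
  outer-≤ : ι (chainCount k (M ℕ.+ d)) ℚ.* (w ^ℚ d) ℚ.≤ v ℚ.+ η
  outer-≤ = ≤-cleared P {m = F ℕ.* K ℕ.* M ℕ.* (M ℕ.+ 1) ℕ.^ d} {{P-nonZero}} clear-K
      (clear-+ {m = (M ℕ.* M) ℕ.^ d ℕ.* M ℕ.* V} clear-v clear-η) (begin
    F ℕ.* K ℕ.* M ℕ.* (M ℕ.+ 1) ℕ.^ d
      ≤⟨ ℕₚ.*-monoˡ-≤ ((M ℕ.+ 1) ℕ.^ d) (ℕₚ.*-monoˡ-≤ M (chainCount-≤ k (M ℕ.+ d))) ⟩
    (M ℕ.+ d) ℕ.^ d ℕ.* V ℕ.* M ℕ.* (M ℕ.+ 1) ℕ.^ d
      ≡⟨ regroup ((M ℕ.+ d) ℕ.^ d) V M ((M ℕ.+ 1) ℕ.^ d) ⟩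
    V ℕ.* M ℕ.* ((M ℕ.+ d) ℕ.^ d ℕ.* (M ℕ.+ 1) ℕ.^ d)
      ≡⟨ cong (V ℕ.* M ℕ.*_) (^-distrib-* (M ℕ.+ d) (M ℕ.+ 1) d) ⟨
    V ℕ.* M ℕ.* ((M ℕ.+ d) ℕ.* (M ℕ.+ 1)) ℕ.^ d
      ≤⟨ ℕₚ.*-monoʳ-≤ (V ℕ.* M) (ℕₚ.^-monoˡ-≤ d product≤) ⟩
    V ℕ.* M ℕ.* (M ℕ.* (M ℕ.+ c)) ℕ.^ d
      ≡⟨ cong (V ℕ.* M ℕ.*_) (^-distrib-* M (M ℕ.+ c) d) ⟩
    V ℕ.* M ℕ.* (M ℕ.^ d ℕ.* (M ℕ.+ c) ℕ.^ d)
      ≡⟨ regroup₂ V M (M ℕ.^ d) ((M ℕ.+ c) ℕ.^ d) ⟩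
    V ℕ.* M ℕ.^ d ℕ.* ((M ℕ.+ c) ℕ.^ d ℕ.* M)
      ≤⟨ ℕₚ.*-monoʳ-≤ (V ℕ.* M ℕ.^ d) (^-powerError c≤M d) ⟩
    V ℕ.* M ℕ.^ d ℕ.* (M ℕ.^ d ℕ.* (M ℕ.+ powerError c d))
      ≡⟨ regroup₃ V (M ℕ.^ d) M (powerError c d) ⟩
    M ℕ.^ d ℕ.* M ℕ.^ d ℕ.* M ℕ.* V ℕ.+ V ℕ.* powerError c d ℕ.* (M ℕ.^ d ℕ.* M ℕ.^ d)
      ≤⟨ ℕₚ.+-monoʳ-≤ (M ℕ.^ d ℕ.* M ℕ.^ d ℕ.* M ℕ.* V)
           (ℕₚ.*-monoˡ-≤ (M ℕ.^ d ℕ.* M ℕ.^ d) (error≤ (ℕₚ.m≤n+m _ (d ℕ.* d)))) ⟩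
    M ℕ.^ d ℕ.* M ℕ.^ d ℕ.* M ℕ.* V ℕ.+ F ℕ.* A ℕ.* (M ℕ.^ d ℕ.* M ℕ.^ d)
      ≡⟨ cong (λ p → p ℕ.* M ℕ.* V ℕ.+ F ℕ.* A ℕ.* p) (^-distrib-* M M d) ⟨
    (M ℕ.* M) ℕ.^ d ℕ.* M ℕ.* V ℕ.+ F ℕ.* A ℕ.* (M ℕ.* M) ℕ.^ d
      ≡⟨ cong ((M ℕ.* M) ℕ.^ d ℕ.* M ℕ.* V ℕ.+_) (swap F A ((M ℕ.* M) ℕ.^ d)) ⟩
    (M ℕ.* M) ℕ.^ d ℕ.* M ℕ.* V ℕ.+ F ℕ.* (M ℕ.* M) ℕ.^ d ℕ.* A ∎)
    where
    K = chainCount k (M ℕ.+ d)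
    open Clearing d F V K A M (M ℕ.* M) (M ℕ.+ 1) v η w (denominator V F) Mη≡A M²w≡M+1
    open ℕₚ.≤-Reasoning

    P-nonZero : ℕ.NonZero P
    P-nonZero = ℕₚ.m*n≢0 F _ {{F-nonZero}} {{ℕₚ.m*n≢0
        ((M ℕ.* M) ℕ.^ d) M {{ℕₚ.m^n≢0 (M ℕ.* M) d {{ℕₚ.m*n≢0 M M}}}}}}

    ^-distrib-* : ∀ m n e → (m ℕ.* n) ℕ.^ e ≡ m ℕ.^ e ℕ.* n ℕ.^ e
    ^-distrib-* m n zero    = refl
    ^-distrib-* m n (suc e) = trans (cong (m ℕ.* n ℕ.*_) (^-distrib-* m n e))
        (interchange m n (m ℕ.^ e) (n ℕ.^ e))
      where
      interchange : ∀ m n p q → m ℕ.* n ℕ.* (p ℕ.* q) ≡ m ℕ.* p ℕ.* (n ℕ.* q)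
      interchange = ℕ-Solver.solve-∀

    product≤ : (M ℕ.+ d) ℕ.* (M ℕ.+ 1) ≤ M ℕ.* (M ℕ.+ c)
    product≤ = begin
      (M ℕ.+ d) ℕ.* (M ℕ.+ 1)                       ≡⟨ expand M d ⟩
      M ℕ.* M ℕ.+ d ℕ.* M ℕ.+ M ℕ.+ d               ≤⟨ ℕₚ.+-monoʳ-≤ (M ℕ.* M ℕ.+ d ℕ.* M ℕ.+ M) (ℕₚ.m≤m*n d M) ⟩
      M ℕ.* M ℕ.+ d ℕ.* M ℕ.+ M ℕ.+ d ℕ.* M         ≡⟨ collect M d ⟩
      M ℕ.* (M ℕ.+ suc (d ℕ.+ d)) ∎
      where
      expand : ∀ m d → (m ℕ.+ d) ℕ.* (m ℕ.+ 1) ≡ m ℕ.* m ℕ.+ d ℕ.* m ℕ.+ m ℕ.+ d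
      expand = ℕ-Solver.solve-∀
      collect : ∀ m d → m ℕ.* m ℕ.+ d ℕ.* m ℕ.+ m ℕ.+ d ℕ.* m ≡ m ℕ.* (m ℕ.+ suc (d ℕ.+ d))
      collect = ℕ-Solver.solve-∀

    regroup : ∀ a v m b → a ℕ.* v ℕ.* m ℕ.* b ≡ v ℕ.* m ℕ.* (a ℕ.* b)
    regroup = ℕ-Solver.solve-∀
    regroup₂ : ∀ v m a b → v ℕ.* m ℕ.* (a ℕ.* b) ≡ v ℕ.* a ℕ.* (b ℕ.* m)
    regroup₂ = ℕ-Solver.solve-∀
    regroup₃ : ∀ v p m b → v ℕ.* p ℕ.* (p ℕ.* (m ℕ.+ b)) ≡ p ℕ.* p ℕ.* m ℕ.* v ℕ.+ v ℕ.* b ℕ.* (p ℕ.* p)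
    regroup₃ = ℕ-Solver.solve-∀
    swap : ∀ f a p → f ℕ.* a ℕ.* p ≡ f ℕ.* p ℕ.* a
    swap = ℕ-Solver.solve-∀

-- The content of the polytope

content : ∀ k → ℚ
content k = (+ shuffleCount k / ((k ℕ.+ k) !)) {{ℕₚ._!≢0 (k ℕ.+ k)}}

polytope-content : ∀ k → HasContent
  (λ x → Frame.point (frame k) x ∈ FlowPolytope (caracol (2 ℕ.+ k)) (⟨1,1,0,…,0⟩ (2 ℕ.+ k))) (content k)
polytope-content k ε 0<ε = inner , outer
  where
  q : ℕ
  q = proj₁ (unit-fraction-≤ ε 0<ε)

  open Grid k q

  η≤ε : η ℚ.≤ ε
  η≤ε = proj₂ (unit-fraction-≤ ε 0<ε)

  S : (Fin d → ℝ) → Set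
  S x = Frame.point (frame k) x ∈ FlowPolytope (caracol (2 ℕ.+ k)) (⟨1,1,0,…,0⟩ (2 ℕ.+ k))

  2M*h≡2 : ι (M ℕ.+ M) ℚ.* h ≡ two
  2M*h≡2 = trans (cong (ℚ._* h) (ι-+ M M)) (trans (ℚₚ.*-distribʳ-+ h (ι M) (ι M)) (cong₂ ℚ._+_ Mh≡1 Mh≡1))

  inner : ∃ λ Bs → AllPairs NonOverlapping Bs × All (λ B → ⟦ B ⟧ ⊆ S) Bs × content k ℚ.- ε ℚ.≤ totalVolume Bs
  inner = map cube cs
        , AllPairsₚ.map⁺ (AllPairs.map (λ {c} {e} → separated⇒nonOverlapping {h} {k} 0≤h {c} {e} {M})
            (corners-separated k k (M ℕ.+ M)))
        , Allₚ.map⁺ (All.map (λ {c} ord {x} x∈ → region⇒polytope k x (region {c} {x} ord (∈cube⇒InCube c x x∈)))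
            (corners-ordered k k (M ℕ.+ M)))
        , subst (content k ℚ.- ε ℚ.≤_) (sym volume) bound-below
    where
    open Corners (λ _ s → s) M
    open Inner M h 0≤h
    open Cubes h h 0≤h k
    cs = corners k k (M ℕ.+ M)

    region : ∀ {c x} → Ordered k k (M ℕ.+ M) c → InCube h h c (x ∘ (_↑ˡ k)) (x ∘ (k ↑ʳ_)) → Region k x
    region {c} {x} ord inC =
        proj₁ chain (fromℚ 1ℚ) (fromℚ-mono (ℚₚ.≤-reflexive
          (trans (cong (λ m → ι m ℚ.* h) (ℕₚ.m≥n⇒m⊓n≡n (ℕₚ.m≤m+n M M))) Mh≡1)))
      , proj₁ (proj₂ chain) (fromℚ two) (fromℚ-mono (ℚₚ.≤-reflexive 2M*h≡2))
      , λ j → proj₂ (proj₂ chain) j j refl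
      where chain = ord (x ∘ (_↑ˡ k)) (x ∘ (k ↑ʳ_)) inC

    volume : totalVolume (map cube cs) ≡ ι (chainCount k M) ℚ.* (h ^ℚ d)
    volume = trans (totalVolume-cubes cs)
      (cong (λ n → ι n ℚ.* (h ^ℚ d)) (Counting.length-corners-high (λ _ s → s) M k k M))

    bound-below : content k ℚ.- ε ℚ.≤ ι (chainCount k M) ℚ.* (h ^ℚ d)
    bound-below = begin
      v ℚ.- ε
        ≤⟨ ℚₚ.+-monoˡ-≤ (ℚ.- ε) (ℚₚ.≤-trans inner-≤ (ℚₚ.+-monoʳ-≤ K η≤ε)) ⟩
      (K ℚ.+ ε) ℚ.- ε                                   ≡⟨ cancel K ε ⟩
      K ∎
      where
      K = ι (chainCount k M) ℚ.* (h ^ℚ d)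
      open ℚₚ.≤-Reasoning
      cancel : ∀ a b → (a ℚ.+ b) ℚ.- b ≡ a
      cancel = RingSolver.solve-∀ ℚ-ring

  outer : ∃ λ Bs → S ⊆ ⋃ Bs × totalVolume Bs ℚ.≤ content k ℚ.+ ε
  outer = map cube cs
        , (λ {x} x∈ → Anyₚ.map⁺ (Any.map (λ {c} → InCube⇒∈cube c x) (covered x (polytope⇒region k x x∈))))
        , subst (ℚ._≤ content k ℚ.+ ε) (sym volume) (ℚₚ.≤-trans outer-≤ (ℚₚ.+-monoʳ-≤ v η≤ε))
    where
    0≤w : 0ℚ ℚ.≤ w
    0≤w = ℚₚ.+-mono-≤ 0≤h (ℚₚ.<⇒≤ 0<δ)
    open Corners (λ n s → s ∸ n) (M ℕ.+ d)
    open Outer M d h δ 0<δ 0≤h Mh≡1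
    open Cubes h w 0≤w k
    cs = corners k k ((M ℕ.+ d) ℕ.+ (M ℕ.+ d))

    r : ℕ
    -- Of the 2 (M + d) levels, `d` are reserved as spacing for the `d` values. The remaining
    -- indices reach beyond height 2, and this total is the one for which the count is
    -- `chainCount k (M + d)`.
    r = M ℕ.+ M ℕ.+ d

    2≤bound : two ℚ.≤ ι (suc r) ℚ.* h ℚ.+ δ
    2≤bound = subst (ℚ._≤ ι (suc r) ℚ.* h ℚ.+ δ) (trans (ℚₚ.+-identityʳ _) 2M*h≡2)
      (ℚₚ.+-mono-≤ (ℚₚ.*-monoʳ-≤-nonNeg h {{ℚ.nonNegative 0≤h}}
          (ι-mono (ℕₚ.m≤n⇒m≤1+n (ℕₚ.m≤m+n (M ℕ.+ M) d)))) (ℚₚ.<⇒≤ 0<δ))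

    1≤2 : 1ℚ ℚ.≤ two
    1≤2 = ι-mono {1} {2} (s≤s z≤n)

    total : ∀ M d → (M ℕ.+ d) ℕ.+ (M ℕ.+ d) ≡ d ℕ.+ (M ℕ.+ M ℕ.+ d)
    total = ℕ-Solver.solve-∀

    covered : ∀ x → Region k x → Covered (x ∘ (_↑ˡ k)) (x ∘ (k ↑ʳ_)) cs
    covered x (antiU , antiV , u≤v) = cover ((M ℕ.+ d) ℕ.+ (M ℕ.+ d)) k k r (total M d) ℕₚ.≤-refl ℕₚ.≤-refl
      {u} {v′} {fromℚ 1ℚ} {fromℚ two} antiU antiV
      (λ i j eq → subst (λ j → u i ≤ᴿ v′ j) (Finₚ.toℕ-injective (ℕₚ.+-cancelʳ-≡ k (toℕ i) (toℕ j) eq)) (u≤v i))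
      u≤1
      (λ i → ≤ᴿ-trans {u i} {fromℚ 1ℚ} {bound (suc r)} (u≤1 i) (fromℚ-mono (ℚₚ.≤-trans 1≤2 2≤bound)))
      (λ j → ≤ᴿ-trans {v′ j} {fromℚ two} {bound (suc r)} (antitone-≤ {fromℚ two} {k} {v′} antiV j)
          (fromℚ-mono 2≤bound))
      where
      u v′ : Fin k → ℝ
      u  = x ∘ (_↑ˡ k)
      v′ = x ∘ (k ↑ʳ_)
      u≤1 : ∀ i → u i ≤ᴿ fromℚ 1ℚ
      u≤1 = antitone-≤ {fromℚ 1ℚ} {k} {u} antiU

    volume : totalVolume (map cube cs) ≡ ι (chainCount k (M ℕ.+ d)) ℚ.* (w ^ℚ d)
    volume = trans (totalVolume-cubes cs)
      (cong (λ n → ι n ℚ.* (w ^ℚ d)) (Counting.length-corners-high (λ n s → s ∸ n) (M ℕ.+ d) k k (M ℕ.+ d)))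

-- Dimension and closed formula

dimension : ∀ k → k ℕ.+ k ≡ length (caracol (2 ℕ.+ k)) ∸ (2 ℕ.+ k)
dimension k = sym (trans (cong (_∸ (2 ℕ.+ k)) (trans (length-caracol k) (rearrange k)))
    (ℕₚ.m+n∸m≡n (2 ℕ.+ k) (k ℕ.+ k)))
  where
  rearrange : ∀ k → suc k ℕ.+ (suc k ℕ.+ k) ≡ 2 ℕ.+ k ℕ.+ (k ℕ.+ k)
  rearrange = ℕ-Solver.solve-∀

-- The dimension is `k + k` only propositionally; with a variable `d` the equation can be matched,
-- and the frame needs no transport.
normalizedVolume : ∀ {n G} {a : Fin n → ℤ} {V d} → d ≡ length G ∸ n → (F : Frame G a d) → ∀ c →
  HasContent (λ x → Frame.point F x ∈ FlowPolytope G a) c → V ≡ (+ (d !) / 1) ℚ.* c → HasNormalizedVolume G a V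
normalizedVolume refl F c content eq = F , c , content , eq

shuffleCount-catalan : ∀ k → suc k ℕ.* 2 ℕ.* shuffleCount k ≡ ((2 ℕ.* k) C k) ℕ.* (2 ℕ.+ k) ℕ.* 2 ℕ.^ k
shuffleCount-catalan k = ℕₚ.*-cancelˡ-≡ _ _
    (k ! ℕ.* k !) {{ℕₚ.m*n≢0 (k !) (k !) {{ℕₚ._!≢0 k}} {{ℕₚ._!≢0 k}} }} (begin
  k ! ℕ.* k ! ℕ.* (suc k ℕ.* 2 ℕ.* shuffleCount k)
    ≡⟨ permute (k !) k (shuffleCount k) ⟩
  2 ℕ.* ((suc k) ! ℕ.* k ! ℕ.* shuffleCount k)
    ≡⟨ shuffleCount-closed k ⟩
  (k ℕ.+ k) ! ℕ.* ((k ℕ.+ 2) ℕ.* 2 ℕ.^ k)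
    ≡⟨ cong (ℕ._* ((k ℕ.+ 2) ℕ.* 2 ℕ.^ k)) (binomial-factorials k k) ⟨
  ((k ℕ.+ k) C k) ℕ.* (k ! ℕ.* k !) ℕ.* ((k ℕ.+ 2) ℕ.* 2 ℕ.^ k)
    ≡⟨ cong (λ m → ((k ℕ.+ m) C k) ℕ.* (k ! ℕ.* k !) ℕ.* ((k ℕ.+ 2) ℕ.* 2 ℕ.^ k)) (ℕₚ.+-identityʳ k) ⟨
  ((2 ℕ.* k) C k) ℕ.* (k ! ℕ.* k !) ℕ.* ((k ℕ.+ 2) ℕ.* 2 ℕ.^ k)
    ≡⟨ permute₂ ((2 ℕ.* k) C k) (k !) k (2 ℕ.^ k) ⟩
  k ! ℕ.* k ! ℕ.* (((2 ℕ.* k) C k) ℕ.* (2 ℕ.+ k) ℕ.* 2 ℕ.^ k) ∎)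
  where
  open ≡-Reasoning
  permute : ∀ p k s → p ℕ.* p ℕ.* (suc k ℕ.* 2 ℕ.* s) ≡ 2 ℕ.* (suc k ℕ.* p ℕ.* p ℕ.* s)
  permute = ℕ-Solver.solve-∀
  permute₂ : ∀ c p k t → c ℕ.* (p ℕ.* p) ℕ.* ((k ℕ.+ 2) ℕ.* t) ≡ p ℕ.* p ℕ.* (c ℕ.* (2 ℕ.+ k) ℕ.* t)
  permute₂ = ℕ-Solver.solve-∀

-- The exponent n - 3 = k - 1 is negative for `k = 0`, where the power is ½; doubling makes it a
-- natural power in all cases.
2*2^ : ∀ k → ι 2 ℚ.* 2^ (+ (2 ℕ.+ k) ℤ.- + 3) ≡ ι (2 ℕ.^ k)
2*2^ zero    = refl
2*2^ (suc k) = sym (ι-* 2 (2 ℕ.^ k))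

volume-formula : ∀ k →
  catalan k ℚ.* (+ (2 ℕ.+ k) / 1) ℚ.* 2^ (+ (2 ℕ.+ k) ℤ.- + 3) ≡ (+ ((k ℕ.+ k) !) / 1) ℚ.* content k
-- The factor `suc k` clears the denominator of the Catalan number, the factor 2 the possibly
-- negative power.
volume-formula k = ≡-cleared (suc k ℕ.* 2) {m = suc k ℕ.* 2 ℕ.* shuffleCount k}
  (begin
    ι (suc k ℕ.* 2) ℚ.* (catalan k ℚ.* ι (2 ℕ.+ k) ℚ.* t)
      ≡⟨ cong (ℚ._* (catalan k ℚ.* ι (2 ℕ.+ k) ℚ.* t)) (ι-* (suc k) 2) ⟩
    ι (suc k) ℚ.* ι 2 ℚ.* (catalan k ℚ.* ι (2 ℕ.+ k) ℚ.* t)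
      ≡⟨ permute (ι (suc k)) (ι 2) (catalan k) (ι (2 ℕ.+ k)) t ⟩
    (ι (suc k) ℚ.* catalan k) ℚ.* ι (2 ℕ.+ k) ℚ.* (ι 2 ℚ.* t)
      ≡⟨ cong₂ (λ p q → p ℚ.* ι (2 ℕ.+ k) ℚ.* q) (denominator ((2 ℕ.* k) C k) (suc k)) (2*2^ k) ⟩
    ι ((2 ℕ.* k) C k) ℚ.* ι (2 ℕ.+ k) ℚ.* ι (2 ℕ.^ k)
      ≡⟨ cong (ℚ._* ι (2 ℕ.^ k)) (ι-* ((2 ℕ.* k) C k) (2 ℕ.+ k)) ⟨
    ι (((2 ℕ.* k) C k) ℕ.* (2 ℕ.+ k)) ℚ.* ι (2 ℕ.^ k)
      ≡⟨ ι-* (((2 ℕ.* k) C k) ℕ.* (2 ℕ.+ k)) (2 ℕ.^ k) ⟨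
    ι (((2 ℕ.* k) C k) ℕ.* (2 ℕ.+ k) ℕ.* 2 ℕ.^ k)
      ≡⟨ cong ι (shuffleCount-catalan k) ⟨
    ι (suc k ℕ.* 2 ℕ.* shuffleCount k) ∎)
  (begin
    ι (suc k ℕ.* 2) ℚ.* (ι ((k ℕ.+ k) !) ℚ.* content k)
      ≡⟨ cong (ι (suc k ℕ.* 2) ℚ.*_) (denominator (shuffleCount k) ((k ℕ.+ k) !) {{ℕₚ._!≢0 (k ℕ.+ k)}}) ⟩
    ι (suc k ℕ.* 2) ℚ.* ι (shuffleCount k)
      ≡⟨ ι-* (suc k ℕ.* 2) (shuffleCount k) ⟨
    ι (suc k ℕ.* 2 ℕ.* shuffleCount k) ∎)
  where
  open ≡-Reasoning
  t : ℚ
  t = 2^ (+ (2 ℕ.+ k) ℤ.- + 3)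
  permute : ∀ a b c e t → a ℚ.* b ℚ.* (c ℚ.* e ℚ.* t) ≡ (a ℚ.* c) ℚ.* e ℚ.* (b ℚ.* t)
  permute = RingSolver.solve-∀ ℚ-ring

proposition6p9 : (n : ℕ) → 2 ≤ n →
    HasNormalizedVolume (caracol n) (⟨1,1,0,…,0⟩ n)
    (catalan (n ∸ 2) * (+ n / 1) * 2^ (+ n - + 3))
proposition6p9 (suc (suc k)) (s≤s (s≤s z≤n)) =
  normalizedVolume (dimension k) (frame k) (content k) (polytope-content k) (volume-formula k)
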